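{- Let $L, n, K$ be integers with $2K \le n$, $L + 1 \le K$, and $L \ge 12 \ln(4n)$. Suppose $\mathcal{A}$ is an adversarially robust coloring algorithm for insert-only graph streams on the vertex set $[n]$ which works as long as the input graph has maximum degree at most $L$, and which maintains a coloring using at most $K$ colors such that, against any adaptive adversary, with probability at least $1/4$ all the colorings it reports are proper. Then $\mathcal{A}$ uses at least $C$ bits of space, where \[ C \ge \frac{1}{40 \ln 2}\cdot \frac{n L^2}{K} - 3. \]
   Context: An insert-only graph stream on vertex set $[n]$ is a sequence of edges (each edge appearing at most once), describing the graph formed by all edges inserted so far. A randomized streaming algorithm with $s$ bits of space and random string $R$ consists of an initial state (a function of $R$), a state-update function taking the current $s$-bit state, the next stream token and $R$ to a new $s$-bit state, and a query function taking the current state and $R$ to an output (here: an assignment of colors to the $n$ vertices). Adaptive adversary model: an adversary generates the stream token by token, where the $i$-th token is an arbitrary deterministic function of the outputs the algorithm gave to queries after each of the previous tokens (the adversary may query the algorithm after every token). A $K$-coloring output is proper if it uses at most $K$ colors and no edge of the current graph has both endpoints of the same color. The algorithm's space is the number of bits $s$ of its state. -}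

module Defs where

open import Data.Nat using (ℕ; zero; suc; _+_; _*_; _^_; _≤_; _!)

open import Data.Fin using (Fin; _≟_)
open import Data.Fin.Subset using (Subset; _∈_; ∣_∣)
open import Data.Bool using (Bool; if_then_else_; _∨_)
open import Data.Vec using (Vec)
open import Data.Vec.Membership.Propositional renaming (_∈_ to _∈ᵥ_)
open import Data.List using (List; []; _∷_; _++_; [_])
open import Data.List.Relation.Unary.All using (All)
open import Data.List.Relation.Unary.AllPairs using (AllPairs)
open import Data.Product using (Σ; ∃; _×_; _,_; proj₁; proj₂)
open import Data.Sum using (_⊎_)
open import Data.Unit using (⊤)
open import Relation.Nullary using (¬_)
open import Relation.Nullary.Decidable using (⌊_⌋)
open import Relation.Binary.PropositionalEquality using (_≡_; _≢_)

-- Exponential comparisons, expressed exactly in ℕ.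
-- expNum x N = N! * Σ_{k ≤ N} x^k / k!   (an integer), so the N-th partial
-- sum of the series of e^x is expNum x N / N!, increasing to e^x.

expNum : ℕ → ℕ → ℕ
expNum x zero    = 1
expNum x (suc N) = suc N * expNum x N + x ^ suc N

-- e^x ≥ M  (via some partial sum; equality e^x = M with M ∈ ℕ never
-- happens in the situation used)
ExpAtLeast : ℕ → ℕ → Set
ExpAtLeast x M = ∃ λ N → M * (N !) ≤ expNum x N

ExpAtMost : ℕ → ℕ → Set
ExpAtMost x B = ∀ N → expNum x N ≤ B * (N !)

Edge : ℕ → Set
Edge n = Fin n × Fin n

SameEdge : ∀ {n} → Edge n → Edge n → Set
SameEdge (a , b) (c , d) = (a ≡ c × b ≡ d) ⊎ (a ≡ d × b ≡ c)

degree : ∀ {n} → Fin n → List (Edge n) → ℕ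
degree v [] = 0
degree v ((a , b) ∷ es) =
  (if ⌊ a ≟ v ⌋ ∨ ⌊ b ≟ v ⌋ then 1 else 0) + degree v es

ValidStream : ∀ n → ℕ → List (Edge n) → Set
ValidStream n L es =
  All (λ e → proj₁ e ≢ proj₂ e) es ×
  AllPairs (λ e f → ¬ SameEdge e f) es ×
  (∀ (v : Fin n) → degree v es ≤ L)

Coloring : ℕ → Set
Coloring n = Fin n → ℕ

UsesAtMost : ∀ {n} → ℕ → Coloring n → Set
UsesAtMost {n} K c = Σ (Vec ℕ K) λ cs → ∀ (v : Fin n) → c v ∈ᵥ cs

ProperKColoring : ∀ {n} → ℕ → List (Edge n) → Coloring n → Set
ProperKColoring K es c =
  UsesAtMost K c × All (λ e → c (proj₁ e) ≢ c (proj₂ e)) es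

-- Randomized streaming algorithms with s bits of state; the random string
-- R is uniform over a finite nonempty set Fin (suc r).

State : ℕ → Set
State s = Vec Bool s

record Algorithm (n s r : ℕ) : Set where
  field
    init   : Fin (suc r) → State s
    update : State s → Edge n → Fin (suc r) → State s
    query  : State s → Fin (suc r) → Coloring n
open Algorithm public

-- adaptive adversary: next token is a deterministic function of all
-- previous outputs (in chronological order)
Adversary : ℕ → Set
Adversary n = List (Coloring n) → Edge n

record Snapshot (n s : ℕ) : Set where
  constructor snap
  field
    state   : State s
    edges   : List (Edge n)
    outputs : List (Coloring n)
    current : Coloring n
open Snapshot public

run : ∀ {n s r} → Algorithm n s r → Adversary n → ℕ → Fin (suc r) → Snapshot n s
run A adv zero R = snap (init A R) [] [] (query A (init A R) R)
run A adv (suc t) R =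
  let S  = run A adv t R
      e  = adv (outputs S)
      st = update A (state S) e R
      c  = query A st R
  in snap st (edges S ++ [ e ]) (outputs S ++ [ c ]) c

AllProper : ∀ {n s r} → Algorithm n s r → Adversary n → ℕ → ℕ → Fin (suc r) → Set
AllProper A adv K zero R = ⊤
AllProper A adv K (suc t) R =
  AllProper A adv K t R ×
  ProperKColoring K (edges (run A adv (suc t) R)) (current (run A adv (suc t) R))

-- adversarially robust K-coloring for streams of max degree ≤ L, success
-- probability ≥ 1/4 (probability over uniform R ∈ Fin (suc r))
Robust : ∀ {n s r} → ℕ → ℕ → Algorithm n s r → Set
Robust {n} {s} {r} L K A =
  ∀ (adv : Adversary n) (T : ℕ) →
  (∀ R → ValidStream n L (edges (run A adv T R))) →
  Σ (Subset (suc r)) λ G →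
    suc r ≤ ∣ G ∣ * 4 × (∀ R → R ∈ G → AllProper A adv K T R)

{-# OPTIONS --safe #-}

-- Cut the vertices into blocks of about 2K vertices (between 3K/2 and 3K). The stream begins with the edges of h ≈ L/4
-- independent uniformly random permutations of every block, which have degree at most about L/2, and continues
-- adaptively: while some block has more than K vertices with fewer than R ≈ L/2 adaptive edges, two of them have the
-- same colour, and joining them gives an adaptive edge. If all answers are proper, the set T of adaptive edges is a
-- function of the state after the first part and of the random string, and by construction T avoids the first
-- part. Hence, for some random string and some state, a fraction 2^-(s+2) of all first parts avoids one set T. The
-- permutations avoiding T are counted by a permanent with row sums m − deg_T(x), and Bregman's bound makes their
-- proportion at most about e^(−2|T|/m) per layer. As 2|T| is about R (m − K) times the number of blocks, comparing
-- the two estimates bounds s from below.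

module Submission where

open import Defs
import Data.Bool as Bool
open import Data.Bool using (Bool; true; false; not; _∧_; _∨_; if_then_else_)
open import Data.Empty using (⊥)
open import Data.Fin using (Fin; zero; suc)
import Data.Fin as Fin
import Data.Fin.Properties as Finₚ
import Data.Fin.Subset as Subset
open import Data.Fin.Subset using (Subset; ∣_∣)
import Data.List as List
open import Data.List using (List; []; _∷_; _++_; [_]; length; map; filter; allFin;
  cartesianProduct; cartesianProductWith; replicate)
import Data.List.Membership.DecPropositional as DecMem
import Data.List.Membership.Propositional as Mem
open import Data.List.Membership.Propositional using (_∈_; _∉_)
import Data.List.Membership.Propositional.Properties as Memₚ
open import Data.List.Membership.Propositional.Properties using (∈-filter⁺; ∈-filter⁻; ∈-allFin;
  ∈-map⁺; ∈-map⁻; ∈-++⁺ˡ; ∈-++⁺ʳ; ∈-++⁻; ∈-cartesianProduct⁺; ∈-cartesianProductWith⁻)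
import Data.List.Properties as Listₚ
open import Data.List.Properties using (length-++; length-replicate; length-tabulate)
open import Data.List.Relation.Unary.All as All using (All; []; _∷_)
import Data.List.Relation.Unary.All.Properties as Allₚ
open import Data.List.Relation.Unary.AllPairs as AllPairs using (AllPairs; []; _∷_)
import Data.List.Relation.Unary.AllPairs.Properties as AllPairsₚ
open import Data.List.Relation.Unary.Any as Any using (here; there)
open import Data.List.Relation.Unary.Unique.Propositional using (Unique)
import Data.List.Relation.Unary.Unique.Propositional.Properties as Uniqueₚ
open import Data.Nat
open import Data.Nat.DivMod using (_/_; _%_; m/n*n≡m; m≡m%n+[m/n]*n; m/n*n≤m; m%n<n)
open import Data.Nat.Divisibility using (∣-trans; m∣m*n; m≤n⇒m!∣n!)
open import Data.Nat.Properties
open import Data.Nat.Tactic.RingSolver using (solve-∀)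
open import Data.Product using (Σ; ∃; _×_; _,_; proj₁; proj₂)
import Data.Product.Properties as Productₚ
open import Data.Sum using (inj₁; inj₂)
open import Data.Unit using (tt)
open import Data.Vec as Vec using (Vec; []; _∷_; lookup)
import Data.Vec.Properties as Vecₚ
import Data.Vec.Relation.Unary.Any as VecAny
import Data.Vec.Relation.Unary.Any.Properties as VecAnyₚ
open import Function using (_∘_; id)
open import Relation.Binary.Definitions using (DecidableEquality)
open import Relation.Binary.PropositionalEquality hiding ([_])
open import Relation.Nullary using (¬_; Dec; yes; no; does; contradiction)
open import Relation.Nullary.Decidable using (¬?; ⌊_⌋; toWitness; _×-dec_; _⊎-dec_)

-- The obstacle is that the adaptive edges must reveal nothing about the first part beyond the
-- state. To avoid repeating an edge the adversary has to consult the first part; but an edge that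
-- is monochromatic in a proper colouring is automatically new, so with proper answers the same
-- choice can be made without that knowledge. Robustness speaks only about adversaries whose stream
-- is valid for every random string, so the stream must also continue legally after a wrong answer;
-- L + 1 ≤ K then guarantees a new pair. All estimates stay in ℕ: roots and logarithms are removed
-- by raising to powers. The number e is bounded below by 13/5 when permutations are counted, and
-- above by (100/99)^100 when the exponential series is compared with a power of 2. To leading order
-- the least favourable block size gives the constant 36 in place of 40; rounding raises it to 38,
-- and ln(13/5) ≥ 19/20 raises 38 to 40. The bound L ≥ 77, extracted from L ≥ 12 ln(4n), keeps the
-- rounding within this margin.

variable
  I I′ : Set

-- Finite sums and products over lists

∑ : List I → (I → ℕ) → ℕ
∑ []       f = 0
∑ (x ∷ xs) f = f x + ∑ xs f

∏ : List I → (I → ℕ) → ℕ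
∏ []       f = 1
∏ (x ∷ xs) f = f x * ∏ xs f

infixr 8 ∑ ∏

𝟙 : Bool → ℕ
𝟙 true  = 1
𝟙 false = 0

𝟙≤1 : ∀ b → 𝟙 b ≤ 1
𝟙≤1 true  = ≤-refl
𝟙≤1 false = z≤n

∑-cong : ∀ (xs : List I) {f g : I → ℕ} → (∀ {x} → x ∈ xs → f x ≡ g x) → ∑ xs f ≡ ∑ xs g
∑-cong []       h = refl
∑-cong (x ∷ xs) h = cong₂ _+_ (h (here refl)) (∑-cong xs (h ∘ there))

∏-cong : ∀ (xs : List I) {f g : I → ℕ} → (∀ {x} → x ∈ xs → f x ≡ g x) → ∏ xs f ≡ ∏ xs g
∏-cong []       h = refl
∏-cong (x ∷ xs) h = cong₂ _*_ (h (here refl)) (∏-cong xs (h ∘ there))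

∑-mono : ∀ (xs : List I) {f g : I → ℕ} → (∀ {x} → x ∈ xs → f x ≤ g x) → ∑ xs f ≤ ∑ xs g
∑-mono []       h = ≤-refl
∑-mono (x ∷ xs) h = +-mono-≤ (h (here refl)) (∑-mono xs (h ∘ there))

∏-mono : ∀ (xs : List I) {f g : I → ℕ} → (∀ {x} → x ∈ xs → f x ≤ g x) → ∏ xs f ≤ ∏ xs g
∏-mono []       h = ≤-refl
∏-mono (x ∷ xs) h = *-mono-≤ (h (here refl)) (∏-mono xs (h ∘ there))

∑-const : ∀ (xs : List I) c → ∑ xs (λ _ → c) ≡ length xs * c
∑-const []       c = refl
∑-const (x ∷ xs) c = cong (c +_) (∑-const xs c)

∏-const : ∀ (xs : List I) c → ∏ xs (λ _ → c) ≡ c ^ length xs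
∏-const []       c = refl
∏-const (x ∷ xs) c = cong (c *_) (∏-const xs c)

∑-0 : ∀ (xs : List I) {f : I → ℕ} → (∀ {x} → x ∈ xs → f x ≡ 0) → ∑ xs f ≡ 0
∑-0 xs h = trans (∑-cong xs h) (trans (∑-const xs 0) (*-zeroʳ (length xs)))

∑-+ : ∀ (xs : List I) (f g : I → ℕ) → ∑ xs (λ x → f x + g x) ≡ ∑ xs f + ∑ xs g
∑-+ []       f g = refl
∑-+ (x ∷ xs) f g = trans (cong (f x + g x +_) (∑-+ xs f g)) (interchange (f x) (g x) (∑ xs f) (∑ xs g))
  where
  interchange : ∀ a b c d → a + b + (c + d) ≡ a + c + (b + d)
  interchange = solve-∀

∏-* : ∀ (xs : List I) (f g : I → ℕ) → ∏ xs (λ x → f x * g x) ≡ ∏ xs f * ∏ xs g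
∏-* []       f g = refl
∏-* (x ∷ xs) f g = trans (cong (f x * g x *_) (∏-* xs f g)) (interchange (f x) (g x) (∏ xs f) (∏ xs g))
  where
  interchange : ∀ a b c d → a * b * (c * d) ≡ a * c * (b * d)
  interchange = solve-∀

∑-*ˡ : ∀ (xs : List I) c (f : I → ℕ) → ∑ xs (λ x → c * f x) ≡ c * ∑ xs f
∑-*ˡ []       c f = sym (*-zeroʳ c)
∑-*ˡ (x ∷ xs) c f = trans (cong (c * f x +_) (∑-*ˡ xs c f)) (sym (*-distribˡ-+ c (f x) (∑ xs f)))

∑-*ʳ : ∀ (xs : List I) c (f : I → ℕ) → ∑ xs (λ x → f x * c) ≡ ∑ xs f * c
∑-*ʳ xs c f = trans (∑-cong xs (λ {x} _ → *-comm (f x) c)) (trans (∑-*ˡ xs c f) (*-comm c _))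

∑-swap : ∀ (xs : List I) (ys : List I′) (f : I → I′ → ℕ) →
         ∑ xs (λ x → ∑ ys (f x)) ≡ ∑ ys (λ y → ∑ xs (λ x → f x y))
∑-swap []       ys f = sym (∑-0 ys (λ _ → refl))
∑-swap (x ∷ xs) ys f = trans (cong (∑ ys (f x) +_) (∑-swap xs ys f))
                             (sym (∑-+ ys (f x) (λ y → ∑ xs (λ x′ → f x′ y))))

∏-swap : ∀ (xs : List I) (ys : List I′) (f : I → I′ → ℕ) →
         ∏ xs (λ x → ∏ ys (f x)) ≡ ∏ ys (λ y → ∏ xs (λ x → f x y))
∏-swap []       ys f = sym (trans (∏-const ys 1) (^-zeroˡ (length ys)))
∏-swap (x ∷ xs) ys f = trans (cong (∏ ys (f x) *_) (∏-swap xs ys f))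
                             (sym (∏-* ys (f x) (λ y → ∏ xs (λ x′ → f x′ y))))

^-distribʳ-* : ∀ a b k → (a * b) ^ k ≡ a ^ k * b ^ k
^-distribʳ-* a b zero    = refl
^-distribʳ-* a b (suc k) = trans (cong (a * b *_) (^-distribʳ-* a b k)) (interchange a b (a ^ k) (b ^ k))
  where
  interchange : ∀ a b c d → a * b * (c * d) ≡ a * c * (b * d)
  interchange = solve-∀

∏-^ : ∀ (xs : List I) (f : I → ℕ) k → ∏ xs (λ x → f x ^ k) ≡ ∏ xs f ^ k
∏-^ []       f k = sym (^-zeroˡ k)
∏-^ (x ∷ xs) f k = trans (cong (f x ^ k *_) (∏-^ xs f k)) (sym (^-distribʳ-* (f x) (∏ xs f) k))

∏-base^ : ∀ (xs : List I) b (f : I → ℕ) → ∏ xs (λ x → b ^ f x) ≡ b ^ ∑ xs f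
∏-base^ []       b f = refl
∏-base^ (x ∷ xs) b f = trans (cong (b ^ f x *_) (∏-base^ xs b f)) (sym (^-distribˡ-+-* b (f x) (∑ xs f)))

∑-++ : ∀ (xs ys : List I) (f : I → ℕ) → ∑ (xs ++ ys) f ≡ ∑ xs f + ∑ ys f
∑-++ []       ys f = refl
∑-++ (x ∷ xs) ys f = trans (cong (f x +_) (∑-++ xs ys f)) (sym (+-assoc (f x) (∑ xs f) (∑ ys f)))

∑-map : ∀ (g : I → I′) (xs : List I) (f : I′ → ℕ) → ∑ (map g xs) f ≡ ∑ xs (f ∘ g)
∑-map g []       f = refl
∑-map g (x ∷ xs) f = cong (f (g x) +_) (∑-map g xs f)

∑-filter : ∀ {P : I → Set} (P? : ∀ x → Dec (P x)) xs (f : I → ℕ) →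
           ∑ (filter P? xs) f ≡ ∑ xs (λ x → 𝟙 (does (P? x)) * f x)
∑-filter P? []       f = refl
∑-filter P? (x ∷ xs) f with does (P? x)
... | true  = cong₂ _+_ (sym (+-identityʳ (f x))) (∑-filter P? xs f)
... | false = ∑-filter P? xs f

∑-1 : ∀ (xs : List I) → ∑ xs (λ _ → 1) ≡ length xs
∑-1 xs = trans (∑-const xs 1) (*-identityʳ (length xs))

length-filter : ∀ {P : I → Set} (P? : ∀ x → Dec (P x)) xs →
                length (filter P? xs) ≡ ∑ xs (λ x → 𝟙 (does (P? x)))
length-filter P? xs = trans (sym (∑-1 (filter P? xs)))
  (trans (∑-filter P? xs (λ _ → 1)) (∑-cong xs (λ {x} _ → *-identityʳ _)))

term≤∑ : ∀ (xs : List I) (f : I → ℕ) {x} → x ∈ xs → f x ≤ ∑ xs f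
term≤∑ (x ∷ xs) f (here refl) = m≤m+n (f x) _
term≤∑ (x ∷ xs) f (there p)   = ≤-trans (term≤∑ xs f p) (m≤n+m _ (f x))

-- Positivity of the sum excludes the empty list, for which there might be no element of `I` to
-- return.
max-term : ∀ (xs : List I) (f : I → ℕ) → 1 ≤ ∑ xs f → ∃ λ x → ∑ xs f ≤ length xs * f x
max-term {I} (x ∷ xs) f _ = top , bound (x ∷ xs) f (λ p → proj₂ (maximal x xs) p)
  where
  maximal : ∀ x xs → ∃ λ m → ∀ {y} → y ∈ (x ∷ xs) → f y ≤ f m
  maximal x []        = x , λ { (here refl) → ≤-refl }
  maximal x (x′ ∷ xs) with maximal x′ xs
  ... | m , le with ≤-total (f x) (f m)
  ... | inj₁ x≤m = m , λ { (here refl) → x≤m ; (there p) → le p }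
  ... | inj₂ m≤x = x , λ { (here refl) → ≤-refl ; (there p) → ≤-trans (le p) m≤x }
  top : I
  top = proj₁ (maximal x xs)
  bound : ∀ zs (g : I → ℕ) {c} → (∀ {y} → y ∈ zs → g y ≤ c) → ∑ zs g ≤ length zs * c
  bound zs g h = ≤-trans (∑-mono zs h) (≤-reflexive (∑-const zs _))

∏-swap₃ : ∀ (xs : List I) (ys : List I′) {K : Set} (zs : List K) (f : I → I′ → K → ℕ) →
  ∏ xs (λ x → ∏ ys (λ y → ∏ zs (f x y))) ≡ ∏ zs (λ z → ∏ ys (λ y → ∏ xs (λ x → f x y z)))
∏-swap₃ xs ys zs f = begin
  ∏ xs (λ x → ∏ ys (λ y → ∏ zs (f x y)))         ≡⟨ ∏-cong xs (λ {x} _ → ∏-swap ys zs (f x)) ⟩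
  ∏ xs (λ x → ∏ zs (λ z → ∏ ys (λ y → f x y z))) ≡⟨ ∏-swap xs zs _ ⟩
  ∏ zs (λ z → ∏ xs (λ x → ∏ ys (λ y → f x y z))) ≡⟨ ∏-cong zs (λ {z} _ → ∏-swap xs ys (λ x y → f x y z)) ⟩
  ∏ zs (λ z → ∏ ys (λ y → ∏ xs (λ x → f x y z))) ∎
  where open ≡-Reasoning

-- Arithmetic and geometric means, and the log-sum inequality

module _ where
  open ≤-Reasoning

  2uv≤u²+v² : ∀ u v → u * v + u * v ≤ u * u + v * v
  2uv≤u²+v² u v with ≤-total u v
  ... | inj₁ u≤v = subst (λ v → u * v + u * v ≤ u * u + v * v) (m+[n∸m]≡n u≤v) (square u (v ∸ u))
    where
    expand : ∀ u d → u * u + (u + d) * (u + d) ≡ u * (u + d) + u * (u + d) + d * d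
    expand = solve-∀
    square : ∀ u d → u * (u + d) + u * (u + d) ≤ u * u + (u + d) * (u + d)
    square u d = subst (u * (u + d) + u * (u + d) ≤_) (sym (expand u d)) (m≤m+n _ (d * d))
  ... | inj₂ v≤u = subst (λ u → u * v + u * v ≤ u * u + v * v) (m+[n∸m]≡n v≤u) (square v (u ∸ v))
    where
    expand : ∀ v d → (v + d) * (v + d) + v * v ≡ (v + d) * v + (v + d) * v + d * d
    expand = solve-∀
    square : ∀ v d → (v + d) * v + (v + d) * v ≤ (v + d) * (v + d) + v * v
    square v d = subst ((v + d) * v + (v + d) * v ≤_) (sym (expand v d)) (m≤m+n _ (d * d))

  -- After n u v^(n+1) is added to both sides of the induction step, the left side is (n+1) v^n ·
  -- 2uv. Once 2uv is replaced by u² + v², the part containing u² is u times the left side of the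
  -- induction hypothesis.
  young : ∀ n u v → suc n * (u * v ^ n) ≤ u ^ suc n + n * v ^ suc n
  young zero    u v = ≤-reflexive (base u)
    where
    base : ∀ u → 1 * (u * 1) ≡ u * 1 + 0
    base = solve-∀
  young (suc n) u v = +-cancelʳ-≤ (n * (u * (v * w))) _ _ (begin
    suc (suc n) * (u * (v * w)) + n * (u * (v * w))
      ≡⟨ collect n u v w ⟩
    suc n * w * (u * v + u * v)
      ≤⟨ *-monoʳ-≤ (suc n * w) (2uv≤u²+v² u v) ⟩
    suc n * w * (u * u + v * v)
      ≡⟨ split n u v w ⟩
    u * (suc n * (u * w)) + suc n * (v * (v * w))
      ≤⟨ +-monoˡ-≤ _ (*-monoʳ-≤ u (young n u v)) ⟩
    u * (u * u ^ n + n * (v * w)) + suc n * (v * (v * w))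
      ≡⟨ merge n u v w (u ^ n) ⟩
    u * (u * u ^ n) + suc n * (v * (v * w)) + n * (u * (v * w)) ∎)
    where
    w = v ^ n
    collect : ∀ n u v w → suc (suc n) * (u * (v * w)) + n * (u * (v * w)) ≡ suc n * w * (u * v + u * v)
    collect = solve-∀
    split : ∀ n u v w → suc n * w * (u * u + v * v) ≡ u * (suc n * (u * w)) + suc n * (v * (v * w))
    split = solve-∀
    merge : ∀ n u v w z → u * (u * z + n * (v * w)) + suc n * (v * (v * w))
                        ≡ u * (u * z) + suc n * (v * (v * w)) + n * (u * (v * w))
    merge = solve-∀

  -- This is `young` at u = n (x + S) and v = (n + 1) S, which coincide exactly when x equals the
  -- mean S / n of the other entries.
  amgm-step : ∀ n x S → suc n ^ suc n * (x * S ^ n) ≤ n ^ n * (x + S) ^ suc n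
  amgm-step zero      x S = ≤-trans (≤-reflexive (lhs x)) (≤-trans (m≤m+n x S) (≤-reflexive (rhs (x + S))))
    where
    lhs : ∀ x → 1 * 1 * (x * 1) ≡ x
    lhs = solve-∀
    rhs : ∀ z → z ≡ 1 * (z * 1)
    rhs = solve-∀
  amgm-step n@(suc _) x S = *-cancelˡ-≤ n (+-cancelʳ-≤ (n * (suc n * P * (S * Sⁿ))) _ _ (begin
    n * (suc n * P * (x * Sⁿ)) + n * (suc n * P * (S * Sⁿ))
      ≡⟨ collect n P x S Sⁿ ⟩
    suc n * (n * (x + S) * (P * Sⁿ))
      ≡⟨ cong (λ z → suc n * (n * (x + S) * z)) (^-distribʳ-* (suc n) S n) ⟨
    suc n * (n * (x + S) * (suc n * S) ^ n)
      ≤⟨ young n (n * (x + S)) (suc n * S) ⟩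
    (n * (x + S)) ^ suc n + n * (suc n * S) ^ suc n
      ≡⟨ cong₂ (λ y z → y + n * z) (^-distribʳ-* n (x + S) (suc n)) (^-distribʳ-* (suc n) S (suc n)) ⟩
    n * n ^ n * (x + S) ^ suc n + n * (suc n * P * (S * Sⁿ))
      ≡⟨ cong (_+ n * (suc n * P * (S * Sⁿ))) (*-assoc n (n ^ n) ((x + S) ^ suc n)) ⟩
    n * (n ^ n * (x + S) ^ suc n) + n * (suc n * P * (S * Sⁿ)) ∎))
    where
    P = suc n ^ n
    Sⁿ = S ^ n
    collect : ∀ n P x S z → n * (suc n * P * (x * z)) + n * (suc n * P * (S * z))
                          ≡ suc n * (n * (x + S) * (P * z))
    collect = solve-∀

  n^n≢0 : ∀ n → NonZero (n ^ n)
  n^n≢0 zero      = _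
  n^n≢0 n@(suc _) = m^n≢0 n n

  amgm : ∀ (xs : List I) (f : I → ℕ) → length xs ^ length xs * ∏ xs f ≤ ∑ xs f ^ length xs
  amgm []       f = ≤-refl
  amgm (x ∷ xs) f = *-cancelˡ-≤ (N ^ N) {{n^n≢0 N}} (begin
    N ^ N * (suc N ^ suc N * (f x * ∏ xs f)) ≡⟨ rearrange (N ^ N) (suc N ^ suc N) (f x) (∏ xs f) ⟩
    suc N ^ suc N * (f x * (N ^ N * ∏ xs f)) ≤⟨ *-monoʳ-≤ (suc N ^ suc N) (*-monoʳ-≤ (f x) (amgm xs f)) ⟩
    suc N ^ suc N * (f x * ∑ xs f ^ N)       ≤⟨ amgm-step N (f x) (∑ xs f) ⟩
    N ^ N * (f x + ∑ xs f) ^ suc N           ∎)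
    where
    N = length xs
    rearrange : ∀ a b c d → a * (b * (c * d)) ≡ b * (c * (a * d))
    rearrange = solve-∀

  ∑-replicate : ∀ k c → ∑ (replicate k c) id ≡ k * c
  ∑-replicate zero    c = refl
  ∑-replicate (suc k) c = cong (c +_) (∑-replicate k c)

  ∏-replicate : ∀ k c → ∏ (replicate k c) id ≡ c ^ k
  ∏-replicate zero    c = refl
  ∏-replicate (suc k) c = cong (c *_) (∏-replicate k c)

  ∏-++ : ∀ (xs ys : List I) (f : I → ℕ) → ∏ (xs ++ ys) f ≡ ∏ xs f * ∏ ys f
  ∏-++ []       ys f = sym (+-identityʳ _)
  ∏-++ (x ∷ xs) ys f = trans (cong (f x *_) (∏-++ xs ys f)) (sym (*-assoc (f x) _ _))

  -- The mean inequality for a copies of x b and b copies of y a.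
  weighted-amgm : ∀ a b x y → (a + b) ^ (a + b) * (x ^ a * y ^ b) ≤ a ^ a * b ^ b * (x + y) ^ (a + b)
  weighted-amgm zero b x y = begin
    b ^ b * (1 * y ^ b)       ≡⟨ cong (b ^ b *_) (*-identityˡ (y ^ b)) ⟩
    b ^ b * y ^ b             ≤⟨ *-monoʳ-≤ (b ^ b) (^-monoˡ-≤ b (m≤n+m y x)) ⟩
    b ^ b * (x + y) ^ b       ≡⟨ cong (_* (x + y) ^ b) (*-identityˡ (b ^ b)) ⟨
    1 * b ^ b * (x + y) ^ b   ∎
  weighted-amgm a@(suc _) zero x y = begin
    (a + 0) ^ (a + 0) * (x ^ a * 1)     ≡⟨ cong₂ _*_ (cong (λ k → k ^ k) (+-identityʳ a)) (*-identityʳ (x ^ a)) ⟩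
    a ^ a * x ^ a                       ≤⟨ *-monoʳ-≤ (a ^ a) (^-monoˡ-≤ a (m≤m+n x y)) ⟩
    a ^ a * (x + y) ^ a                 ≡⟨ cong₂ _*_ (*-identityʳ (a ^ a)) (cong ((x + y) ^_) (+-identityʳ a)) ⟨
    a ^ a * 1 * (x + y) ^ (a + 0)       ∎
  weighted-amgm a@(suc _) b@(suc _) x y = *-cancelˡ-≤ (b ^ a * a ^ b) {{m*n≢0 _ _ {{m^n≢0 b a}} {{m^n≢0 a b}}}} (begin
    b ^ a * a ^ b * (N ^ N * (x ^ a * y ^ b))
      ≡⟨ rearrange (b ^ a) (a ^ b) (N ^ N) (x ^ a) (y ^ b) ⟩
    N ^ N * ((x ^ a * b ^ a) * (y ^ b * a ^ b))
      ≡⟨ cong (N ^ N *_) (cong₂ _*_ (^-distribʳ-* x b a) (^-distribʳ-* y a b)) ⟨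
    N ^ N * ((x * b) ^ a * (y * a) ^ b)
      ≡⟨ cong₂ (λ l p → l ^ l * p) len prod ⟨
    length zs ^ length zs * ∏ zs id
      ≤⟨ amgm zs id ⟩
    ∑ zs id ^ length zs
      ≡⟨ cong₂ _^_ total len ⟩
    (a * (x * b) + b * (y * a)) ^ N
      ≡⟨ cong (_^ N) (factor a b x y) ⟩
    (a * b * (x + y)) ^ N
      ≡⟨ trans (^-distribʳ-* (a * b) (x + y) N) (cong (_* (x + y) ^ N) (^-distribʳ-* a b N)) ⟩
    a ^ N * b ^ N * (x + y) ^ N
      ≡⟨ cong₂ (λ p q → p * q * (x + y) ^ N) (^-distribˡ-+-* a a b) (^-distribˡ-+-* b a b) ⟩
    a ^ a * a ^ b * (b ^ a * b ^ b) * (x + y) ^ N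
      ≡⟨ rearrange′ (a ^ a) (a ^ b) (b ^ a) (b ^ b) ((x + y) ^ N) ⟩
    b ^ a * a ^ b * (a ^ a * b ^ b * (x + y) ^ N) ∎)
    where
    N = a + b
    zs = replicate a (x * b) ++ replicate b (y * a)
    len : length zs ≡ N
    len = trans (length-++ (replicate a (x * b))) (cong₂ _+_ (length-replicate a) (length-replicate b))
    total : ∑ zs id ≡ a * (x * b) + b * (y * a)
    total = trans (∑-++ (replicate a (x * b)) (replicate b (y * a)) id)
                  (cong₂ _+_ (∑-replicate a (x * b)) (∑-replicate b (y * a)))
    prod : ∏ zs id ≡ (x * b) ^ a * (y * a) ^ b
    prod = trans (∏-++ (replicate a (x * b)) (replicate b (y * a)) id)
                 (cong₂ _*_ (∏-replicate a (x * b)) (∏-replicate b (y * a)))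
    rearrange : ∀ p q n u v → p * q * (n * (u * v)) ≡ n * ((u * p) * (v * q))
    rearrange = solve-∀
    rearrange′ : ∀ p q r s z → p * q * (r * s) * z ≡ r * q * (p * s * z)
    rearrange′ = solve-∀
    factor : ∀ a b x y → a * (x * b) + b * (y * a) ≡ a * b * (x + y)
    factor = solve-∀

  -- Exponential form of Σ w log w ≥ W log (W / N), with 0 ^ 0 = 1 in the role of 0 log 0 = 0. The
  -- induction regards head and tail as two masses on cells of sizes 1 and r; a singleton is treated
  -- apart because r ^ p must be cancelled.
  log-sum : ∀ (xs : List I) (w : I → ℕ) →
            ∑ xs w ^ ∑ xs w ≤ length xs ^ ∑ xs w * ∏ xs (λ x → w x ^ w x)
  log-sum []            w = ≤-refl
  log-sum (x ∷ [])      w rewrite +-identityʳ (w x) | ^-zeroˡ (w x) | *-identityʳ (w x ^ w x) = m≤m+n _ 0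
  log-sum (x ∷ xs@(_ ∷ _)) w = *-cancelˡ-≤ (r ^ p) {{m^n≢0 r p}} (begin
    r ^ p * (w x + p) ^ (w x + p)
      ≡⟨ trans (*-comm (r ^ p) _) (cong ((w x + p) ^ (w x + p) *_) (sym unit)) ⟩
    (w x + p) ^ (w x + p) * (1 ^ w x * r ^ p)
      ≤⟨ weighted-amgm (w x) p 1 r ⟩
    w x ^ w x * p ^ p * suc r ^ (w x + p)
      ≤⟨ *-monoˡ-≤ (suc r ^ (w x + p)) (*-monoʳ-≤ (w x ^ w x) (log-sum xs w)) ⟩
    w x ^ w x * (r ^ p * Π) * suc r ^ (w x + p)
      ≡⟨ rearrange (w x ^ w x) (r ^ p) Π (suc r ^ (w x + p)) ⟩
    r ^ p * (suc r ^ (w x + p) * (w x ^ w x * Π)) ∎)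
    where
    r = length xs
    p = ∑ xs w
    Π = ∏ xs (λ x → w x ^ w x)
    unit : 1 ^ w x * r ^ p ≡ r ^ p
    unit = trans (cong (_* r ^ p) (^-zeroˡ (w x))) (*-identityˡ (r ^ p))
    rearrange : ∀ a b c d → a * (b * c) * d ≡ b * (d * (a * c))
    rearrange = solve-∀

-- Powers, filtered products and Kronecker deltas

^-cancelˡ-≤ : ∀ k .{{_ : NonZero k}} {a b} → a ^ k ≤ b ^ k → a ≤ b
^-cancelˡ-≤ k {a} {b} le with a ≤? b
... | yes a≤b = a≤b
... | no  a≰b = contradiction (^-monoˡ-< k (≰⇒> a≰b)) (≤⇒≯ le)

^-swap : ∀ b m n → (b ^ m) ^ n ≡ (b ^ n) ^ m
^-swap b m n = trans (^-*-assoc b m n) (trans (cong (b ^_) (*-comm m n)) (sym (^-*-assoc b n m)))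

1≤n^n : ∀ n → 1 ≤ n ^ n
1≤n^n n = >-nonZero⁻¹ (n ^ n) {{n^n≢0 n}}

∏-filter : ∀ {P : I → Set} (P? : ∀ x → Dec (P x)) xs (f : I → ℕ) →
           ∏ (filter P? xs) f ≡ ∏ xs (λ x → f x ^ 𝟙 (does (P? x)))
∏-filter P? []       f = refl
∏-filter P? (x ∷ xs) f with does (P? x)
... | true  = cong₂ _*_ (sym (*-identityʳ (f x))) (∏-filter P? xs f)
... | false = trans (∏-filter P? xs f) (sym (*-identityˡ _))

∏-filter-≤ : ∀ {P : I → Set} (P? : ∀ x → Dec (P x)) xs (f : I → ℕ) → (∀ x → 1 ≤ f x) →
             ∏ (filter P? xs) f ≤ ∏ xs f
∏-filter-≤ P? []       f 1≤f = ≤-refl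
∏-filter-≤ P? (x ∷ xs) f 1≤f with does (P? x)
... | true  = *-monoʳ-≤ (f x) (∏-filter-≤ P? xs f 1≤f)
... | false = ≤-trans (∏-filter-≤ P? xs f 1≤f)
                      (≤-trans (≤-reflexive (sym (*-identityˡ _))) (*-monoˡ-≤ (∏ xs f) (1≤f x)))

𝟙+𝟙not : ∀ b → 𝟙 b + 𝟙 (not b) ≡ 1
𝟙+𝟙not true  = refl
𝟙+𝟙not false = refl

module Kronecker {X : Set} (_≟_ : DecidableEquality X) where

  δ : X → X → ℕ
  δ x y = 𝟙 (does (x ≟ y))

  δ-refl : ∀ x → δ x x ≡ 1
  δ-refl x with x ≟ x
  ... | yes _   = refl
  ... | no  x≢x = contradiction refl x≢x

  δ-≢ : ∀ {x y} → x ≢ y → δ x y ≡ 0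
  δ-≢ {x} {y} x≢y with x ≟ y
  ... | yes x≡y = contradiction x≡y x≢y
  ... | no  _   = refl

  δ-sym : ∀ x y → δ x y ≡ δ y x
  δ-sym x y with x ≟ y
  ... | yes refl = sym (δ-refl x)
  ... | no  x≢y  = sym (δ-≢ (x≢y ∘ sym))

  ∑-δ-∉ : ∀ (xs : List X) {y} (f : X → ℕ) → y ∉ xs → ∑ xs (λ x → δ y x * f x) ≡ 0
  ∑-δ-∉ xs f y∉ = ∑-0 xs (λ {x} x∈ → cong (_* f x) (δ-≢ λ { refl → y∉ x∈ }))

  ∑-δ : ∀ {xs} → Unique xs → ∀ {y} → y ∈ xs → (f : X → ℕ) → ∑ xs (λ x → δ y x * f x) ≡ f y
  ∑-δ {xs = x ∷ xs} (x∉ ∷ u) (here refl) f = begin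
    δ x x * f x + ∑ xs (λ x′ → δ x x′ * f x′)
      ≡⟨ cong₂ _+_ (cong (_* f x) (δ-refl x)) (∑-δ-∉ xs f (λ x∈ → All.lookup x∉ x∈ refl)) ⟩
    f x + 0 + 0
      ≡⟨ trans (+-identityʳ _) (+-identityʳ _) ⟩
    f x ∎
    where open ≡-Reasoning
  ∑-δ {xs = x ∷ xs} (x∉ ∷ u) {y} (there y∈) f =
    cong₂ _+_ (cong (_* f x) (δ-≢ λ { refl → All.lookup x∉ y∈ refl })) (∑-δ u y∈ f)

  ∑-δ-injective : ∀ {Z : Set} {xs : List Z} → Unique xs → (f : Z → X) →
    (∀ {x y} → x ∈ xs → y ∈ xs → f x ≡ f y → x ≡ y) → ∀ k → ∑ xs (λ x → δ (f x) k) ≤ 1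
  ∑-δ-injective []       f inj k = z≤n
  ∑-δ-injective {xs = x ∷ xs} (x∉ ∷ u) f inj k with f x ≟ k
  ... | no  _    = ∑-δ-injective u f (λ p q → inj (there p) (there q)) k
  ... | yes refl = ≤-reflexive (cong suc
        (∑-0 xs (λ z∈ → δ-≢ λ fz≡ → All.lookup x∉ z∈ (inj (here refl) (there z∈) (sym fz≡)))))

  infixl 6 _∖_
  _∖_ : List X → X → List X
  xs ∖ x = filter (λ z → ¬? (x ≟ z)) xs

  ∑-∖ : ∀ {xs} → Unique xs → ∀ {x} → x ∈ xs → (f : X → ℕ) → ∑ (xs ∖ x) f + f x ≡ ∑ xs f
  ∑-∖ {xs} u {x} x∈ f = begin
    ∑ (xs ∖ x) f + f x
      ≡⟨ cong₂ _+_ (∑-filter (λ z → ¬? (x ≟ z)) xs f) (sym (∑-δ u x∈ f)) ⟩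
    ∑ xs (λ z → 𝟙 (not (does (x ≟ z))) * f z) + ∑ xs (λ z → δ x z * f z)
      ≡⟨ ∑-+ xs _ _ ⟨
    ∑ xs (λ z → 𝟙 (not (does (x ≟ z))) * f z + δ x z * f z)
      ≡⟨ ∑-cong xs (λ {z} _ → split (does (x ≟ z)) (f z)) ⟩
    ∑ xs f ∎
    where
    open ≡-Reasoning
    split : ∀ b c → 𝟙 (not b) * c + 𝟙 b * c ≡ c
    split true  c = +-identityʳ c
    split false c = trans (+-identityʳ _) (+-identityʳ c)

  length-∖ : ∀ {xs} → Unique xs → ∀ {x} → x ∈ xs → length (xs ∖ x) + 1 ≡ length xs
  length-∖ {xs} u {x} x∈ = trans (cong (_+ 1) (sym (∑-1 (xs ∖ x)))) (trans (∑-∖ u x∈ (λ _ → 1)) (∑-1 xs))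

  ∈-∖⁺ : ∀ {xs x z} → z ∈ xs → x ≢ z → z ∈ xs ∖ x
  ∈-∖⁺ {x = x} = ∈-filter⁺ (λ z → ¬? (x ≟ z))

  ∈-∖⁻ : ∀ {xs x z} → z ∈ xs ∖ x → z ∈ xs × x ≢ z
  ∈-∖⁻ {xs} {x} = ∈-filter⁻ (λ z → ¬? (x ≟ z)) {xs = xs}

-- Bregman's bound on permanents, following Schrijver

module Bregman {X Y P : Set} (_≟ˣ_ : DecidableEquality X) (_≟ʸ_ : DecidableEquality Y)
               (at : P → X → Y) (A : X → Y → Bool)
               (M : ℕ) {{_ : NonZero M}} (G : ℕ → ℕ) (1≤G : ∀ r → 1 ≤ G r)
               (G-step : ∀ r → suc r ^ M * G r ^ r ≤ G (suc r) ^ suc r) where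

  open Kronecker _≟ˣ_ using () renaming
    (δ to δˣ; ∑-δ to ∑-δˣ; _∖_ to _∖ˣ_; length-∖ to length-∖ˣ; ∈-∖⁺ to ∈-∖ˣ⁺; ∈-∖⁻ to ∈-∖ˣ⁻; δ-sym to δˣ-sym)
  open Kronecker _≟ʸ_

  -- The permanent is represented by a list of elements whose restrictions to `xs` are distinct
  -- injections into `ys` through entries of `A`. Elements keep their values outside `xs`, so
  -- passing to a minor is a mere filter without renumbering; `determined` says that the remaining
  -- rows still tell them apart.
  record Family (xs : List X) (ys : List Y) (S : List P) : Set where
    field
      unique-rows    : Unique xs
      unique-columns : Unique ys
      into           : ∀ {σ x} → σ ∈ S → x ∈ xs → at σ x ∈ ys
      allowed        : ∀ {σ x} → σ ∈ S → x ∈ xs → A x (at σ x) ≡ true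
      injective      : ∀ {σ x x′} → σ ∈ S → x ∈ xs → x′ ∈ xs → at σ x ≡ at σ x′ → x ≡ x′
      unique         : Unique S
      determined     : ∀ {σ τ} → σ ∈ S → τ ∈ S → (∀ {x} → x ∈ xs → at σ x ≡ at τ x) → σ ≡ τ
      size           : length ys ≤ length xs

  through : List P → X → Y → List P
  through S i k = filter (λ σ → at σ i ≟ʸ k) S

  row : X → List Y → ℕ
  row j ys = ∑ ys (λ k → 𝟙 (A j k))

  minor : ∀ {xs ys S} → Family xs ys S → ∀ {i k} → i ∈ xs → k ∈ ys → Family (xs ∖ˣ i) (ys ∖ k) (through S i k)
  minor {xs} {ys} {S} F {i} {k} i∈ k∈ = record
    { unique-rows    = Uniqueₚ.filter⁺ _ unique-rows
    ; unique-columns = Uniqueₚ.filter⁺ _ unique-columns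
    ; into           = λ σ∈ x∈ → let (σ∈S , σi≡k) = ∈-filter⁻ _ {xs = S} σ∈ ; (x∈xs , i≢x) = ∈-∖ˣ⁻ x∈ in
        ∈-∖⁺ (into σ∈S x∈xs) (λ k≡ → i≢x (injective σ∈S i∈ x∈xs (trans σi≡k k≡)))
    ; allowed        = λ σ∈ x∈ → allowed (proj₁ (∈-filter⁻ _ {xs = S} σ∈)) (proj₁ (∈-∖ˣ⁻ x∈))
    ; injective      = λ σ∈ x∈ x′∈ → injective (proj₁ (∈-filter⁻ _ {xs = S} σ∈)) (proj₁ (∈-∖ˣ⁻ x∈)) (proj₁ (∈-∖ˣ⁻ x′∈))
    ; unique         = Uniqueₚ.filter⁺ _ unique
    ; determined     = λ {σ} {τ} σ∈ τ∈ agree →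
        let (σ∈S , σi≡k) = ∈-filter⁻ _ {xs = S} σ∈ ; (τ∈S , τi≡k) = ∈-filter⁻ _ {xs = S} τ∈ in
        determined σ∈S τ∈S λ {x} x∈ → case-i σ τ σi≡k τi≡k agree x x∈ (i ≟ˣ x)
    ; size           = +-cancelʳ-≤ 1 _ _ (subst₂ _≤_ (sym (length-∖ unique-columns k∈)) (sym (length-∖ˣ unique-rows i∈)) size)
    }
    where
    open Family F
    case-i : ∀ σ τ → at σ i ≡ k → at τ i ≡ k → (∀ {x} → x ∈ xs ∖ˣ i → at σ x ≡ at τ x) →
             ∀ x → x ∈ xs → Dec (i ≡ x) → at σ x ≡ at τ x
    case-i σ τ p q agree x x∈ (yes refl) = trans p (sym q)
    case-i σ τ p q agree x x∈ (no i≢x)   = agree (∈-∖ˣ⁺ x∈ i≢x)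

  module Step {xs ys S} (F : Family xs ys S) (0<p : 0 < length S) (0<L : 0 < length xs)
    (minor-bound : ∀ {i k} → i ∈ xs → k ∈ ys →
                   length (through S i k) ^ M ≤ ∏ (xs ∖ˣ i) (λ j → G (row j (ys ∖ k)))) where
    open Family F

    p : ℕ
    p = length S

    w : X → Y → ℕ
    w i k = ∑ S (λ σ → δ (at σ i) k)

    w-row : ∀ {i} → i ∈ xs → ∑ ys (λ k → 𝟙 (A i k) * w i k) ≡ p
    w-row {i} i∈ = begin
      ∑ ys (λ k → 𝟙 (A i k) * w i k)
        ≡⟨ ∑-cong ys (λ {k} _ → sym (∑-*ˡ S (𝟙 (A i k)) _)) ⟩
      ∑ ys (λ k → ∑ S (λ σ → 𝟙 (A i k) * δ (at σ i) k))
        ≡⟨ ∑-swap ys S _ ⟩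
      ∑ S (λ σ → ∑ ys (λ k → 𝟙 (A i k) * δ (at σ i) k))
        ≡⟨ ∑-cong S (λ {σ} σ∈ → trans (∑-cong ys (λ {k} _ → *-comm (𝟙 (A i k)) _))
             (trans (∑-δ unique-columns (into σ∈ i∈) (λ k → 𝟙 (A i k))) (cong 𝟙 (allowed σ∈ i∈)))) ⟩
      ∑ S (λ _ → 1)
        ≡⟨ ∑-1 S ⟩
      p ∎
      where open ≡-Reasoning

    w-column : ∀ k → ∑ xs (λ i → w i k) ≤ p
    w-column k = begin
      ∑ xs (λ i → w i k)                      ≡⟨ ∑-swap xs S _ ⟩
      ∑ S (λ σ → ∑ xs (λ i → δ (at σ i) k))   ≤⟨ ∑-mono S (λ {σ} σ∈ → ∑-δ-injective unique-rows (at σ) (injective σ∈) k) ⟩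
      ∑ S (λ _ → 1)                           ≡⟨ ∑-1 S ⟩
      p                                       ∎
      where open ≤-Reasoning

    -- For a uniformly random member of `S` the column at row `i` has distribution w i k / p, and
    -- its entropy is at most the logarithm of the number of allowed columns. The forbidden columns
    -- can be added to the product because every w ^ w is at least 1.
    entropy : ∀ {i} → i ∈ xs → p ^ p ≤ row i ys ^ p * ∏ ys (λ k → w i k ^ w i k)
    entropy {i} i∈ = begin
      p ^ p
        ≡⟨ cong (λ q → q ^ q) total ⟨
      ∑ ysᵢ (w i) ^ ∑ ysᵢ (w i)
        ≤⟨ log-sum ysᵢ (w i) ⟩
      length ysᵢ ^ ∑ ysᵢ (w i) * ∏ ysᵢ (λ k → w i k ^ w i k)
        ≡⟨ cong₂ (λ l q → l ^ q * ∏ ysᵢ (λ k → w i k ^ w i k)) len total ⟩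
      row i ys ^ p * ∏ ysᵢ (λ k → w i k ^ w i k)
        ≤⟨ *-monoʳ-≤ (row i ys ^ p) (∏-filter-≤ _ ys _ (λ k → 1≤n^n (w i k))) ⟩
      row i ys ^ p * ∏ ys (λ k → w i k ^ w i k) ∎
      where
      open ≤-Reasoning
      ysᵢ = filter (λ k → A i k Bool.≟ true) ys
      does-≟true : ∀ b → does (b Bool.≟ true) ≡ b
      does-≟true true  = refl
      does-≟true false = refl
      total : ∑ ysᵢ (w i) ≡ p
      total = trans (∑-filter _ ys (w i))
        (trans (∑-cong ys (λ {k} _ → cong (λ b → 𝟙 b * w i k) (does-≟true (A i k)))) (w-row i∈))
      len : length ysᵢ ≡ row i ys
      len = trans (length-filter _ ys) (∑-cong ys (λ {k} _ → cong 𝟙 (does-≟true (A i k))))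

    g : X → Y → ℕ
    g j k = G (row j (ys ∖ k))

    ν : X → X → ℕ
    ν j i = 𝟙 (not (does (i ≟ˣ j)))

    -- The exponent ν j i removes the factor j = i, so that the product over the rows of the minor
    -- runs over all of `xs` and can later be exchanged with the product over `i`.
    entry-bound : ∀ {i k} → i ∈ xs → k ∈ ys → (w i k ^ w i k) ^ M ≤ ∏ xs (λ j → g j k ^ (ν j i * w i k))
    entry-bound {i} {k} i∈ k∈ = begin
      (w i k ^ w i k) ^ M
        ≡⟨ ^-swap (w i k) (w i k) M ⟩
      (w i k ^ M) ^ w i k
        ≡⟨ cong (λ l → (l ^ M) ^ w i k) (length-filter _ S) ⟨
      (length (through S i k) ^ M) ^ w i k
        ≤⟨ ^-monoˡ-≤ (w i k) (minor-bound i∈ k∈) ⟩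
      ∏ (xs ∖ˣ i) (λ j → g j k) ^ w i k
        ≡⟨ cong (_^ w i k) (∏-filter _ xs (λ j → g j k)) ⟩
      ∏ xs (λ j → g j k ^ ν j i) ^ w i k
        ≡⟨ ∏-^ xs _ (w i k) ⟨
      ∏ xs (λ j → (g j k ^ ν j i) ^ w i k)
        ≡⟨ ∏-cong xs (λ {j} _ → ^-*-assoc (g j k) (ν j i) (w i k)) ⟩
      ∏ xs (λ j → g j k ^ (ν j i * w i k)) ∎
      where open ≤-Reasoning

    -- As members are injective, this is the number of members that meet column `k` in a row other
    -- than `j`. It is the exponent of `g j k` once the expansions along all rows are multiplied.
    e : X → Y → ℕ
    e j k = ∑ xs (λ i → ν j i * w i k)

    e+w≤p : ∀ {j} → j ∈ xs → ∀ k → e j k + w j k ≤ p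
    e+w≤p {j} j∈ k = begin
      e j k + w j k
        ≡⟨ cong (e j k +_) (∑-δˣ unique-rows j∈ (λ i → w i k)) ⟨
      e j k + ∑ xs (λ i → δˣ j i * w i k)
        ≡⟨ ∑-+ xs _ _ ⟨
      ∑ xs (λ i → ν j i * w i k + δˣ j i * w i k)
        ≡⟨ ∑-cong xs (λ {i} _ → trans (cong (λ d → ν j i * w i k + d * w i k) (δˣ-sym j i)) (join (does (i ≟ˣ j)) (w i k))) ⟩
      ∑ xs (λ i → w i k)
        ≤⟨ w-column k ⟩
      p ∎
      where
      open ≤-Reasoning
      join : ∀ b c → 𝟙 (not b) * c + 𝟙 b * c ≡ c
      join true  c = +-identityʳ c
      join false c = trans (+-identityʳ _) (+-identityʳ c)

    0<row : ∀ {j} → j ∈ xs → 0 < row j ys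
    0<row {j} j∈ = positive S refl
      where
      positive : ∀ S′ → S′ ≡ S → 0 < row j ys
      positive []       refl = contradiction 0<p λ ()
      positive (σ ∷ S′) refl = subst (_≤ row j ys) (cong 𝟙 (allowed (here refl) j∈))
                                     (term≤∑ ys (λ k → 𝟙 (A j k)) (into (here refl) j∈))

    -- Deleting column `k` lowers the row sum r + 1 of `j` exactly when `A j k` holds, so every
    -- factor has base G r or G (r + 1). The total exponents are at most r p and c p, with c the
    -- number of forbidden columns: `e j k` is at most p minus `w j k`, and the `w j k` of the
    -- allowed columns add up to p. What remains is the p-th power of `G-step`.
    row-bound : ∀ {j} → j ∈ xs → (row j ys ^ p) ^ M * ∏ ys (λ k → g j k ^ e j k) ≤ G (row j ys) ^ (length ys * p)
    row-bound {j} j∈ = with-pred (row j ys) refl (0<row j∈)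
      where
      open ≤-Reasoning
      c = ∑ ys (λ k → 𝟙 (not (A j k)))
      with-pred : ∀ ρ → row j ys ≡ ρ → 0 < ρ → (row j ys ^ p) ^ M * ∏ ys (λ k → g j k ^ e j k) ≤ G (row j ys) ^ (length ys * p)
      with-pred (suc r) eq _ = begin
        (row j ys ^ p) ^ M * ∏ ys (λ k → g j k ^ e j k)
          ≡⟨ cong₂ _*_ (trans (cong (λ q → (q ^ p) ^ M) eq) (^-swap (suc r) p M)) (∏-cong ys (λ {k} k∈ → factor
              (A j k) refl k∈)) ⟩
        (suc r ^ M) ^ p * ∏ ys (λ k → G r ^ (𝟙 (A j k) * e j k) * G (suc r) ^ (𝟙 (not (A j k)) * e j k))
          ≡⟨ cong ((suc r ^ M) ^ p *_) (trans (∏-* ys _ _) (cong₂ _*_ (∏-base^ ys (G r) _) (∏-base^ ys (G (suc r)) _))) ⟩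
        (suc r ^ M) ^ p * (G r ^ e₁ * G (suc r) ^ e₀)
          ≤⟨ *-monoʳ-≤ ((suc r ^ M) ^ p) (*-mono-≤ (^-monoʳ-≤ (G r) {{>-nonZero (1≤G r)}} e₁≤)
               (^-monoʳ-≤ (G (suc r)) {{>-nonZero (1≤G (suc r))}} e₀≤)) ⟩
        (suc r ^ M) ^ p * (G r ^ (r * p) * G (suc r) ^ (c * p))
          ≡⟨ *-assoc ((suc r ^ M) ^ p) _ _ ⟨
        (suc r ^ M) ^ p * G r ^ (r * p) * G (suc r) ^ (c * p)
          ≡⟨ cong (_* G (suc r) ^ (c * p)) (trans (cong ((suc r ^ M) ^ p *_) (sym (^-*-assoc (G r) r p)))
               (sym (^-distribʳ-* (suc r ^ M) (G r ^ r) p))) ⟩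
        (suc r ^ M * G r ^ r) ^ p * G (suc r) ^ (c * p)
          ≤⟨ *-monoˡ-≤ (G (suc r) ^ (c * p)) (^-monoˡ-≤ p (G-step r)) ⟩
        (G (suc r) ^ suc r) ^ p * G (suc r) ^ (c * p)
          ≡⟨ cong (_* G (suc r) ^ (c * p)) (^-*-assoc (G (suc r)) (suc r) p) ⟩
        G (suc r) ^ (suc r * p) * G (suc r) ^ (c * p)
          ≡⟨ trans (cong (G (suc r) ^_) (*-distribʳ-+ p (suc r) c)) (^-distribˡ-+-* (G (suc r)) (suc r * p) (c * p)) ⟨
        G (suc r) ^ ((suc r + c) * p)
          ≡⟨ cong₂ (λ q l → G q ^ (l * p)) (sym eq) columns ⟩
        G (row j ys) ^ (length ys * p) ∎
        where
        e₁ = ∑ ys (λ k → 𝟙 (A j k) * e j k)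
        e₀ = ∑ ys (λ k → 𝟙 (not (A j k)) * e j k)
        columns : suc r + c ≡ length ys
        columns = trans (cong (_+ c) (sym eq)) (trans (sym (∑-+ ys _ _)) (trans (∑-cong ys (λ {k} _ → 𝟙+𝟙not
            (A j k))) (∑-1 ys)))
        factor : ∀ b {k} → A j k ≡ b → k ∈ ys → g j k ^ e j k ≡ G r ^ (𝟙 b * e j k) * G (suc r) ^ (𝟙 (not b) * e j k)
        factor b {k} Ajk k∈ with b | trans (cong (λ b → row j (ys ∖ k) + 𝟙 b) (sym Ajk)) (trans
            (∑-∖ unique-columns k∈ (λ k → 𝟙 (A j k))) eq)
        ... | true  | deleted = trans (cong (λ q → G q ^ e j k) (suc-injective (trans (+-comm 1 _) deleted)))
                                  (trans (cong (G r ^_) (sym (+-identityʳ (e j k)))) (sym (*-identityʳ _)))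
        ... | false | deleted = trans (cong (λ q → G q ^ e j k) (trans (sym (+-identityʳ _)) deleted))
                                  (trans (cong (G (suc r) ^_) (sym (+-identityʳ (e j k)))) (sym (*-identityˡ _)))
        e₁≤ : e₁ ≤ r * p
        e₁≤ = +-cancelʳ-≤ p _ _ (begin
          e₁ + p
            ≡⟨ cong (e₁ +_) (w-row j∈) ⟨
          e₁ + ∑ ys (λ k → 𝟙 (A j k) * w j k)
            ≡⟨ trans (∑-cong ys (λ {k} _ → *-distribˡ-+ (𝟙 (A j k)) (e j k) (w j k))) (∑-+ ys _ _) ⟨
          ∑ ys (λ k → 𝟙 (A j k) * (e j k + w j k))
            ≤⟨ ∑-mono ys (λ {k} _ → *-monoʳ-≤ (𝟙 (A j k)) (e+w≤p j∈ k)) ⟩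
          ∑ ys (λ k → 𝟙 (A j k) * p)
            ≡⟨ trans (∑-*ʳ ys p _) (cong (_* p) eq) ⟩
          p + r * p
            ≡⟨ +-comm p (r * p) ⟩
          r * p + p ∎)
        e₀≤ : e₀ ≤ c * p
        e₀≤ = begin
          e₀                                ≤⟨ ∑-mono ys (λ {k} _ → *-monoʳ-≤ (𝟙 (not (A j k))) (≤-trans (m≤m+n _
              (w j k)) (e+w≤p j∈ k))) ⟩
          ∑ ys (λ k → 𝟙 (not (A j k)) * p)  ≡⟨ ∑-*ʳ ys p _ ⟩
          c * p                             ∎

    -- The expansions along all L rows are multiplied, and only at the end is the exponent L p
    -- cancelled. Every row j then collects its own entropy factor together with its weights in all
    -- the minors that retain it, which is what `row-bound` estimates.
    bound : p ^ M ≤ ∏ xs (λ j → G (row j ys))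
    bound = ^-cancelˡ-≤ (L * p) {{m*n≢0 L p {{>-nonZero 0<L}} {{>-nonZero 0<p}}}} (begin
      (p ^ M) ^ (L * p)
        ≡⟨ regroup ⟩
      ((p ^ p) ^ M) ^ L
        ≡⟨ ∏-const xs _ ⟨
      ∏ xs (λ _ → (p ^ p) ^ M)
        ≤⟨ ∏-mono xs (λ i∈ → ^-monoˡ-≤ M (entropy i∈)) ⟩
      ∏ xs (λ i → (row i ys ^ p * ∏ ys (λ k → w i k ^ w i k)) ^ M)
        ≡⟨ ∏-cong xs (λ {i} _ → trans (^-distribʳ-* (row i ys ^ p) _ M) (cong ((row i ys ^ p) ^ M *_) (sym (∏-^ ys _ M)))) ⟩
      ∏ xs (λ i → (row i ys ^ p) ^ M * ∏ ys (λ k → (w i k ^ w i k) ^ M))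
        ≤⟨ ∏-mono xs (λ {i} i∈ → *-monoʳ-≤ ((row i ys ^ p) ^ M) (∏-mono ys (entry-bound i∈))) ⟩
      ∏ xs (λ i → (row i ys ^ p) ^ M * ∏ ys (λ k → ∏ xs (λ j → g j k ^ (ν j i * w i k))))
        ≡⟨ trans (∏-* xs _ _) (cong (∏ xs (λ i → (row i ys ^ p) ^ M) *_) exchange) ⟩
      ∏ xs (λ i → (row i ys ^ p) ^ M) * ∏ xs (λ j → ∏ ys (λ k → g j k ^ e j k))
        ≡⟨ ∏-* xs _ _ ⟨
      ∏ xs (λ j → (row j ys ^ p) ^ M * ∏ ys (λ k → g j k ^ e j k))
        ≤⟨ ∏-mono xs row-bound ⟩
      ∏ xs (λ j → G (row j ys) ^ (length ys * p))
        ≤⟨ ∏-mono xs (λ {j} _ → ^-monoʳ-≤ (G (row j ys)) {{>-nonZero (1≤G _)}} (*-monoˡ-≤ p size)) ⟩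
      ∏ xs (λ j → G (row j ys) ^ (L * p))
        ≡⟨ ∏-^ xs _ (L * p) ⟩
      ∏ xs (λ j → G (row j ys)) ^ (L * p) ∎)
      where
      open ≤-Reasoning
      L = length xs
      regroup : (p ^ M) ^ (L * p) ≡ ((p ^ p) ^ M) ^ L
      regroup = trans (cong ((p ^ M) ^_) (*-comm L p)) (trans (sym (^-*-assoc (p ^ M) p L)) (cong (_^ L) (^-swap p M p)))
      exchange : ∏ xs (λ i → ∏ ys (λ k → ∏ xs (λ j → g j k ^ (ν j i * w i k)))) ≡ ∏ xs (λ j → ∏ ys (λ k → g j k ^ e j k))
      exchange = trans (∏-swap₃ xs ys xs _) (∏-cong xs λ {j} _ → ∏-cong ys λ {k} _ → ∏-base^ xs (g j k) _)

  bregman : ∀ N {xs ys S} → length xs ≡ N → Family xs ys S → length S ^ M ≤ ∏ xs (λ x → G (row x ys))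
  bregman _       {xs} {ys} {[]} _ F = subst (_≤ ∏ xs (λ x → G (row x ys))) (0^ M) z≤n
    where
    0^ : ∀ k .{{_ : NonZero k}} → 0 ≡ 0 ^ k
    0^ (suc k) = refl
  bregman zero    {[]} {S = σ ∷ []} _ F = ≤-reflexive (^-zeroˡ M)
  -- With no rows left, `determined` identifies any two members, so a list without repetitions has
  -- at most one.
  bregman zero    {[]} {S = σ ∷ τ ∷ S} _ F with Family.unique F | Family.determined F (here refl) (there (here refl)) (λ ())
  ... | (σ≢τ ∷ _) ∷ _ | σ≡τ = contradiction σ≡τ σ≢τ
  bregman (suc N) {xs@(_ ∷ _)} {ys} {S@(_ ∷ _)} len F = Step.bound F (s≤s z≤n) (s≤s z≤n) λ i∈ k∈ →
    bregman N (suc-injective (trans (+-comm 1 _) (trans (length-∖ˣ (Family.unique-rows F) i∈) len))) (minor F i∈ k∈)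

-- The weight r ↦ (r!)^(1/r) of Bregman's bound, raised to the power m!

-- The classical argument: the mean inequality for one 1 and n copies of 1 + 1/n, whose sum is n +
-- 2.
1+1/n-increasing : ∀ n → suc n ^ suc n * suc n ^ n ≤ n ^ n * suc (suc n) ^ suc n
1+1/n-increasing n = subst (λ z → suc n ^ suc n * z ≤ n ^ n * suc (suc n) ^ suc n)
                           (*-identityˡ (suc n ^ n)) (amgm-step n 1 (suc n))

≤-induction : ∀ (P : ℕ → Set) {m} → P m → (∀ n → P n → P (suc n)) → ∀ {n} → m ≤ n → P n
≤-induction P {m} base step m≤n = go (≤⇒≤′ m≤n)
  where
  go : ∀ {n} → m ≤′ n → P n
  go ≤′-refl       = base
  go (≤′-step m≤n) = step _ (go m≤n)

-- 13/5 serves as a rational lower approximation of e.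
13/5≤[1+1/n]^n : ∀ {n} → 60 ≤ n → 13 * n ^ n ≤ 5 * suc n ^ n
13/5≤[1+1/n]^n = ≤-induction (λ n → 13 * n ^ n ≤ 5 * suc n ^ n) (≤ᵇ⇒≤ (13 * 60 ^ 60) (5 * 61 ^ 60) tt) step
  where
  open ≤-Reasoning
  step : ∀ n → 13 * n ^ n ≤ 5 * suc n ^ n → 13 * suc n ^ suc n ≤ 5 * suc (suc n) ^ suc n
  step n ih = *-cancelʳ-≤ _ _ (suc n ^ n) {{m^n≢0 (suc n) n}} (begin
    13 * suc n ^ suc n * suc n ^ n           ≡⟨ *-assoc 13 (suc n ^ suc n) (suc n ^ n) ⟩
    13 * (suc n ^ suc n * suc n ^ n)         ≤⟨ *-monoʳ-≤ 13 (1+1/n-increasing n) ⟩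
    13 * (n ^ n * suc (suc n) ^ suc n)       ≡⟨ *-assoc 13 (n ^ n) (suc (suc n) ^ suc n) ⟨
    13 * n ^ n * suc (suc n) ^ suc n         ≤⟨ *-monoˡ-≤ (suc (suc n) ^ suc n) ih ⟩
    5 * suc n ^ n * suc (suc n) ^ suc n      ≡⟨ swap 5 (suc n ^ n) (suc (suc n) ^ suc n) ⟩
    5 * suc (suc n) ^ suc n * suc n ^ n      ∎)
    where
    swap : ∀ a b c → a * b * c ≡ a * c * b
    swap = solve-∀

-- A Stirling bound n! ≤ (5 (n + 1) / 13)^n; each induction step uses (1 + 1/(n+1))^(n+1) ≥ 13/5.
-- Some lower limit on n is unavoidable, since n = 1 violates the bound; at 60 the base case is
-- evaluated.
stirling : ∀ {n} → 60 ≤ n → n ! * 13 ^ n ≤ suc n ^ n * 5 ^ n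
stirling 60≤n = proj₁ (≤-induction (λ n → n ! * 13 ^ n ≤ suc n ^ n * 5 ^ n × 60 ≤ n)
    (≤ᵇ⇒≤ (60 ! * 13 ^ 60) (61 ^ 60 * 5 ^ 60) tt , ≤-refl) (λ n (ih , le) → step n le ih , m≤n⇒m≤1+n le) 60≤n)
  where
  open ≤-Reasoning
  step : ∀ n → 60 ≤ n → n ! * 13 ^ n ≤ suc n ^ n * 5 ^ n →
         suc n ! * 13 ^ suc n ≤ suc (suc n) ^ suc n * 5 ^ suc n
  step n 60≤n ih = begin
    suc n * n ! * (13 * 13 ^ n)                ≡⟨ regroup₁ (suc n) (n !) (13 ^ n) ⟩
    13 * (suc n * (n ! * 13 ^ n))              ≤⟨ *-monoʳ-≤ 13 (*-monoʳ-≤ (suc n) ih) ⟩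
    13 * (suc n * (suc n ^ n * 5 ^ n))         ≡⟨ regroup₂ (suc n) (suc n ^ n) (5 ^ n) ⟩
    13 * (suc n * suc n ^ n) * 5 ^ n           ≤⟨ *-monoˡ-≤ (5 ^ n) (13/5≤[1+1/n]^n (m≤n⇒m≤1+n 60≤n)) ⟩
    5 * suc (suc n) ^ suc n * 5 ^ n            ≡⟨ regroup₃ (suc (suc n) ^ suc n) (5 ^ n) ⟩
    suc (suc n) ^ suc n * (5 * 5 ^ n)          ∎
    where
    regroup₁ : ∀ a b c → a * b * (13 * c) ≡ 13 * (a * (b * c))
    regroup₁ = solve-∀
    regroup₂ : ∀ a b c → 13 * (a * (b * c)) ≡ 13 * (a * b) * c
    regroup₂ = solve-∀
    regroup₃ : ∀ a b → 5 * a * b ≡ a * (5 * b)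
    regroup₃ = solve-∀

n!≤[1+n]^n : ∀ n → n ! ≤ suc n ^ n
n!≤[1+n]^n zero    = ≤-refl
n!≤[1+n]^n (suc n) = *-mono-≤ (n≤1+n (suc n)) (≤-trans (n!≤[1+n]^n n) (^-monoˡ-≤ n (n≤1+n (suc n))))

module Weight (m′ : ℕ) where

  m M M′ : ℕ
  m = suc m′
  M = m !
  M′ = m′ !

  exponent : ℕ → ℕ
  exponent zero    = 0
  exponent (suc r) = M / suc r

  -- The value for r > m is irrelevant; this one makes G-step hold everywhere.
  G : ℕ → ℕ
  G r = if r ≤ᵇ m then (r !) ^ exponent r else (r !) ^ M

  G-small : ∀ {r} → r ≤ m → G r ≡ (r !) ^ exponent r
  G-small {r} r≤m with r ≤ᵇ m | ≤⇒≤ᵇ r≤m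
  ... | true | _ = refl

  G-large : ∀ {r} → m < r → G r ≡ (r !) ^ M
  G-large {r} m<r with r ≤ᵇ m | ≤ᵇ⇒≤ r m
  ... | true  | r≤m = contradiction (r≤m tt) (<⇒≱ m<r)
  ... | false | _   = refl

  1≤G : ∀ r → 1 ≤ G r
  1≤G r with r ≤ᵇ m
  ... | true  = >-nonZero⁻¹ _ {{m^n≢0 (r !) (exponent r) {{r !≢0}}}}
  ... | false = >-nonZero⁻¹ _ {{m^n≢0 (r !) M {{r !≢0}}}}

  G-power : ∀ {r} → r ≤ m → G r ^ r ≡ (r !) ^ M
  G-power {zero}  _    = sym (^-zeroˡ M)
  G-power {suc r} r<m = begin
    G (suc r) ^ suc r               ≡⟨ cong (_^ suc r) (G-small r<m) ⟩
    ((suc r !) ^ (M / suc r)) ^ suc r ≡⟨ ^-*-assoc (suc r !) (M / suc r) (suc r) ⟩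
    (suc r !) ^ (M / suc r * suc r)   ≡⟨ cong ((suc r !) ^_) (m/n*n≡m (∣-trans (m∣m*n (r !)) (m≤n⇒m!∣n! r<m))) ⟩
    (suc r !) ^ M ∎
    where open ≡-Reasoning

  G-step : ∀ r → suc r ^ M * G r ^ r ≤ G (suc r) ^ suc r
  G-step r with suc r ≤? m
  ... | yes r<m = ≤-reflexive (begin
      suc r ^ M * G r ^ r   ≡⟨ cong (suc r ^ M *_) (G-power (<⇒≤ r<m)) ⟩
      suc r ^ M * (r !) ^ M   ≡⟨ ^-distribʳ-* (suc r) (r !) M ⟨
      (suc r !) ^ M           ≡⟨ G-power r<m ⟨
      G (suc r) ^ suc r     ∎)
    where open ≡-Reasoning
  ... | no r≮m = begin
      suc r ^ M * G r ^ r          ≤⟨ *-monoʳ-≤ (suc r ^ M) small ⟩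
      suc r ^ M * ((r !) ^ M) ^ suc r ≤⟨ *-monoˡ-≤ _ (m≤m^ (suc r ^ M) r {{m^n≢0 (suc r) M}}) ⟩
      (suc r ^ M) ^ suc r * ((r !) ^ M) ^ suc r ≡⟨ ^-distribʳ-* (suc r ^ M) ((r !) ^ M) (suc r) ⟨
      (suc r ^ M * (r !) ^ M) ^ suc r ≡⟨ cong (_^ suc r) (^-distribʳ-* (suc r) (r !) M) ⟨
      ((suc r !) ^ M) ^ suc r         ≡⟨ cong (_^ suc r) (G-large (≰⇒> r≮m)) ⟨
      G (suc r) ^ suc r             ∎
    where
    open ≤-Reasoning
    m≤m^ : ∀ a k .{{_ : NonZero a}} → a ≤ a ^ suc k
    m≤m^ a k = ≤-trans (≤-reflexive (sym (*-identityʳ a))) (*-monoʳ-≤ a (m^n>0 a k))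
    small : G r ^ r ≤ ((r !) ^ M) ^ suc r
    small with r ≤? m
    ... | yes r≤m = ≤-trans (≤-reflexive (G-power r≤m)) (m≤m^ ((r !) ^ M) r {{m^n≢0 (r !) M {{r !≢0}}}})
    ... | no  r≰m = ≤-trans (≤-reflexive (cong (_^ r) (G-large (≰⇒> r≰m))))
                            (^-monoʳ-≤ ((r !) ^ M) {{m^n≢0 (r !) M {{r !≢0}}}} (n≤1+n r))

  -- For a(s) = (s!)^(1/s) the quotient a(s+1) / a(s) is ((s+1)^s / s!)^(1/(s(s+1))). By `stirling`
  -- it is at least (13/5)^(1/(s+1)), hence at least (13/5)^(1/m). Raising to the power M turns the
  -- exponent 1/m into M′.
  G-ratio : ∀ {s} → 60 ≤ s → s < m → G s * 13 ^ M′ ≤ G (suc s) * 5 ^ M′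
  G-ratio {s} 60≤s s<m = ^-cancelˡ-≤ (s * suc s) {{m*n≢0 s (suc s) {{>-nonZero (≤-trans (s≤s z≤n) 60≤s)}}}} (begin
    (G s * 13 ^ M′) ^ (s * suc s)
      ≡⟨ trans (^-distribʳ-* (G s) (13 ^ M′) (s * suc s)) (cong₂ _*_ Gˡ (^-swap 13 M′ (s * suc s))) ⟩
    (((s !) ^ m) ^ suc s) ^ M′ * (13 ^ (s * suc s)) ^ M′
      ≡⟨ ^-distribʳ-* (((s !) ^ m) ^ suc s) (13 ^ (s * suc s)) M′ ⟨
    (((s !) ^ m) ^ suc s * 13 ^ (s * suc s)) ^ M′
      ≤⟨ ^-monoˡ-≤ M′ core ⟩
    (((suc s !) ^ m) ^ s * 5 ^ (s * suc s)) ^ M′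
      ≡⟨ ^-distribʳ-* (((suc s !) ^ m) ^ s) (5 ^ (s * suc s)) M′ ⟩
    (((suc s !) ^ m) ^ s) ^ M′ * (5 ^ (s * suc s)) ^ M′
      ≡⟨ trans (^-distribʳ-* (G (suc s)) (5 ^ M′) (s * suc s)) (cong₂ _*_ Gʳ (^-swap 5 M′ (s * suc s))) ⟨
    (G (suc s) * 5 ^ M′) ^ (s * suc s) ∎)
    where
    open ≤-Reasoning
    d = m ∸ suc s
    Gˡ : G s ^ (s * suc s) ≡ (((s !) ^ m) ^ suc s) ^ M′
    Gˡ = trans (sym (^-*-assoc (G s) s (suc s))) (trans (cong (_^ suc s) (trans (G-power (<⇒≤ s<m)) (sym
        (^-*-assoc (s !) m M′))))
           (^-swap ((s !) ^ m) M′ (suc s)))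
    Gʳ : G (suc s) ^ (s * suc s) ≡ (((suc s !) ^ m) ^ s) ^ M′
    Gʳ = trans (cong (G (suc s) ^_) (*-comm s (suc s))) (trans (sym (^-*-assoc (G (suc s)) (suc s) s))
           (trans (cong (_^ s) (trans (G-power s<m) (sym (^-*-assoc (suc s !) m M′)))) (^-swap ((suc s !) ^ m) M′ s)))
    root : s ! * 13 ^ s ≤ suc s ^ s * 5 ^ s
    root = stirling 60≤s
    core₀ : (s !) ^ m * 13 ^ (s * suc s) ≤ (suc s ^ s) ^ m * 5 ^ (s * suc s)
    core₀ = begin
      (s !) ^ m * 13 ^ (s * suc s)
        ≡⟨ cong₂ _*_ (trans (cong ((s !) ^_) (sym (m+[n∸m]≡n s<m))) (^-distribˡ-+-* (s !) (suc s) d)) (sym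
            (^-*-assoc 13 s (suc s))) ⟩
      (s !) ^ suc s * (s !) ^ d * (13 ^ s) ^ suc s
        ≡⟨ swap ((s !) ^ suc s) ((s !) ^ d) _ ⟩
      (s !) ^ suc s * (13 ^ s) ^ suc s * (s !) ^ d
        ≡⟨ cong (_* (s !) ^ d) (^-distribʳ-* (s !) (13 ^ s) (suc s)) ⟨
      (s ! * 13 ^ s) ^ suc s * (s !) ^ d
        -- Of the m factors, s + 1 supply the required power of 13/5; for the other d the crude
        -- bound s! ≤ (s+1)^s suffices.
        ≤⟨ *-mono-≤ (^-monoˡ-≤ (suc s) root) (^-monoˡ-≤ d (n!≤[1+n]^n s)) ⟩
      (suc s ^ s * 5 ^ s) ^ suc s * (suc s ^ s) ^ d
        ≡⟨ cong (_* (suc s ^ s) ^ d) (^-distribʳ-* (suc s ^ s) (5 ^ s) (suc s)) ⟩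
      (suc s ^ s) ^ suc s * (5 ^ s) ^ suc s * (suc s ^ s) ^ d
        ≡⟨ swap ((suc s ^ s) ^ suc s) _ _ ⟩
      (suc s ^ s) ^ suc s * (suc s ^ s) ^ d * (5 ^ s) ^ suc s
        ≡⟨ cong₂ _*_ (trans (cong ((suc s ^ s) ^_) (sym (m+[n∸m]≡n s<m))) (^-distribˡ-+-* (suc s ^ s) (suc s) d))
            (sym (^-*-assoc 5 s (suc s))) ⟨
      (suc s ^ s) ^ m * 5 ^ (s * suc s) ∎
      where
      swap : ∀ a b c → a * b * c ≡ a * c * b
      swap = solve-∀
    core : ((s !) ^ m) ^ suc s * 13 ^ (s * suc s) ≤ ((suc s !) ^ m) ^ s * 5 ^ (s * suc s)
    core = begin
      (s !) ^ m * ((s !) ^ m) ^ s * 13 ^ (s * suc s)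
        ≡⟨ swap ((s !) ^ m) _ _ ⟩
      ((s !) ^ m) ^ s * ((s !) ^ m * 13 ^ (s * suc s))
        ≤⟨ *-monoʳ-≤ (((s !) ^ m) ^ s) core₀ ⟩
      ((s !) ^ m) ^ s * ((suc s ^ s) ^ m * 5 ^ (s * suc s))
        ≡⟨ swap′ (((s !) ^ m) ^ s) ((suc s ^ s) ^ m) _ ⟩
      (suc s ^ s) ^ m * ((s !) ^ m) ^ s * 5 ^ (s * suc s)
        ≡⟨ cong (λ z → z * ((s !) ^ m) ^ s * 5 ^ (s * suc s)) (^-swap (suc s) s m) ⟩
      (suc s ^ m) ^ s * ((s !) ^ m) ^ s * 5 ^ (s * suc s)
        ≡⟨ cong (_* 5 ^ (s * suc s)) (trans (cong (_^ s) (^-distribʳ-* (suc s) (s !) m)) (^-distribʳ-* (suc s ^ m)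
            ((s !) ^ m) s)) ⟨
      ((suc s !) ^ m) ^ s * 5 ^ (s * suc s) ∎
      where
      swap : ∀ a b c → a * b * c ≡ b * (a * c)
      swap = solve-∀
      swap′ : ∀ a b c → a * (b * c) ≡ b * a * c
      swap′ = solve-∀

  -- After the M-th root, removing d entries from a row divides its weight by at least (13/5)^(d/m),
  -- because M′ / M = 1 / m.
  G-drop : ∀ d {s} → 60 ≤ s → s + d ≤ m → G s * (13 ^ M′) ^ d ≤ G (s + d) * (5 ^ M′) ^ d
  G-drop zero    {s} 60≤s le = ≤-reflexive (cong (λ z → G z * 1) (sym (+-identityʳ s)))
  G-drop (suc d) {s} 60≤s le = begin
    G s * (13 ^ M′ * (13 ^ M′) ^ d)      ≡⟨ *-assoc (G s) _ _ ⟨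
    G s * 13 ^ M′ * (13 ^ M′) ^ d        ≤⟨ *-monoˡ-≤ ((13 ^ M′) ^ d) (G-ratio 60≤s (≤-trans (s≤s (m≤m+n s d)) le′)) ⟩
    G (suc s) * 5 ^ M′ * (13 ^ M′) ^ d   ≡⟨ swap (G (suc s)) _ _ ⟩
    G (suc s) * (13 ^ M′) ^ d * 5 ^ M′   ≤⟨ *-monoˡ-≤ (5 ^ M′) (G-drop d (≤-trans 60≤s (n≤1+n s)) le′) ⟩
    G (suc s + d) * (5 ^ M′) ^ d * 5 ^ M′  ≡⟨ swap′ (G (suc s + d)) _ _ ⟩
    G (suc s + d) * (5 ^ M′ * (5 ^ M′) ^ d) ≡⟨ cong (λ z → G z * (5 ^ M′ * (5 ^ M′) ^ d)) (+-suc s d) ⟨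
    G (s + suc d) * (5 ^ M′ * (5 ^ M′) ^ d) ∎
    where
    open ≤-Reasoning
    le′ : suc s + d ≤ m
    le′ = subst (_≤ m) (+-suc s d) le
    swap : ∀ a b c → a * b * c ≡ a * c * b
    swap = solve-∀
    swap′ : ∀ a b c → a * b * c ≡ a * (c * b)
    swap′ = solve-∀

-- Enumerating permutations and tuples

∑-cartesianProductWith : ∀ {C : Set} (f : I → I′ → C) xs ys (h : C → ℕ) →
  ∑ (cartesianProductWith f xs ys) h ≡ ∑ xs (λ x → ∑ ys (λ y → h (f x y)))
∑-cartesianProductWith f []       ys h = refl
∑-cartesianProductWith f (x ∷ xs) ys h = trans (∑-++ (map (f x) ys) _ h)
  (cong₂ _+_ (∑-map (f x) ys h) (∑-cartesianProductWith f xs ys h))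

length-cartesianProductWith : ∀ {C : Set} (f : I → I′ → C) xs ys →
  length (cartesianProductWith f xs ys) ≡ length xs * length ys
length-cartesianProductWith f xs ys = begin
  length (cartesianProductWith f xs ys)   ≡⟨ ∑-1 (cartesianProductWith f xs ys) ⟨
  ∑ (cartesianProductWith f xs ys) _      ≡⟨ ∑-cartesianProductWith f xs ys _ ⟩
  ∑ xs (λ _ → ∑ ys (λ _ → 1))             ≡⟨ ∑-const xs _ ⟩
  length xs * ∑ ys (λ _ → 1)              ≡⟨ cong (length xs *_) (∑-1 ys) ⟩
  length xs * length ys                   ∎
  where open ≡-Reasoning

length-allFin : ∀ n → length (allFin n) ≡ n
length-allFin n = length-tabulate {n = n} id

lookup-ext : ∀ {A : Set} {n} {u v : Vec A n} → (∀ i → lookup u i ≡ lookup v i) → u ≡ v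
lookup-ext {u = []}    {[]}    h = refl
lookup-ext {u = x ∷ u} {y ∷ v} h = cong₂ _∷_ (h zero) (lookup-ext (h ∘ suc))

insert-first : ∀ {n} → Fin (suc n) → Vec (Fin n) n → Vec (Fin (suc n)) (suc n)
insert-first k σ = k ∷ Vec.map (Fin.punchIn k) σ

permutations : ∀ n → List (Vec (Fin n) n)
permutations zero    = [ [] ]
permutations (suc n) = cartesianProductWith insert-first (allFin (suc n)) (permutations n)

permutations-unique : ∀ n → Unique (permutations n)
permutations-unique zero    = [] ∷ []
permutations-unique (suc n) = Uniqueₚ.cartesianProductWith⁺ insert-first separate
                                (Uniqueₚ.allFin⁺ (suc n)) (permutations-unique n)
  where
  separate : ∀ {k l : Fin (suc n)} {σ τ} → insert-first k σ ≡ insert-first l τ → k ≡ l × σ ≡ τ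
  separate {k} {σ = σ} {τ} eq with Vecₚ.∷-injective eq
  ... | refl , eq′ = refl , lookup-ext λ i → Finₚ.punchIn-injective k _ _
    (trans (sym (Vecₚ.lookup-map i (Fin.punchIn k) σ)) (trans (cong (λ v → lookup v i) eq′) (Vecₚ.lookup-map i
        (Fin.punchIn k) τ)))

permutations-length : ∀ n → length (permutations n) ≡ n !
permutations-length zero    = refl
permutations-length (suc n) = trans (length-cartesianProductWith insert-first (allFin (suc n)) (permutations n))
  (cong₂ _*_ (length-allFin (suc n)) (permutations-length n))

permutations-injective : ∀ n {σ} → σ ∈ permutations n → ∀ i j → lookup σ i ≡ lookup σ j → i ≡ j
permutations-injective (suc n) σ∈ i j eq
  with ∈-cartesianProductWith⁻ insert-first (allFin (suc n)) (permutations n) σ∈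
... | k , σ , _ , σ∈′ , refl = by-cases i j eq
  where
  later : ∀ i → lookup (Vec.map (Fin.punchIn k) σ) i ≡ Fin.punchIn k (lookup σ i)
  later i = Vecₚ.lookup-map i (Fin.punchIn k) σ
  by-cases : ∀ i j → lookup (insert-first k σ) i ≡ lookup (insert-first k σ) j → i ≡ j
  by-cases zero    zero    eq = refl
  by-cases zero    (suc j) eq = contradiction (sym (trans eq (later j))) (Finₚ.punchInᵢ≢i k (lookup σ j))
  by-cases (suc i) zero    eq = contradiction (trans (sym (later i)) eq) (Finₚ.punchInᵢ≢i k (lookup σ i))
  by-cases (suc i) (suc j) eq = cong suc (permutations-injective n σ∈′ i j
    (Finₚ.punchIn-injective k _ _ (trans (sym (later i)) (trans eq (later j)))))

tuples : ∀ {A : Set} k → List A → List (Vec A k)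
tuples zero    xs = [ [] ]
tuples (suc k) xs = cartesianProductWith _∷_ xs (tuples k xs)

tuples-unique : ∀ {A : Set} k {xs : List A} → Unique xs → Unique (tuples k xs)
tuples-unique zero    u = [] ∷ []
tuples-unique (suc k) u = Uniqueₚ.cartesianProductWith⁺ _∷_ Vecₚ.∷-injective u (tuples-unique k u)

tuples-length : ∀ {A : Set} k (xs : List A) → length (tuples k xs) ≡ length xs ^ k
tuples-length zero    xs = refl
tuples-length (suc k) xs = trans (length-cartesianProductWith _∷_ xs (tuples k xs)) (cong (length xs *_) (tuples-length k xs))

tuples-lookup : ∀ {A : Set} k {xs : List A} {v} → v ∈ tuples k xs → ∀ i → lookup v i ∈ xs
tuples-lookup (suc k) {xs} v∈ i with ∈-cartesianProductWith⁻ _∷_ xs (tuples k xs) v∈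
tuples-lookup (suc k) v∈ zero    | x , v , x∈ , v∈′ , refl = x∈
tuples-lookup (suc k) v∈ (suc i) | x , v , x∈ , v∈′ , refl = tuples-lookup k v∈′ i

tuples-complete : ∀ {A : Set} {xs : List A} → (∀ x → x ∈ xs) → ∀ {k} (v : Vec A k) → v ∈ tuples k xs
tuples-complete all []      = here refl
tuples-complete all (x ∷ v) = Memₚ.∈-cartesianProductWith⁺ _∷_ (all x) (tuples-complete all v)

-- Independence in counting form: F is dominated by the product of the values of f along the tuple,
-- and the sum of that product over all tuples factorises.
∑-tuples : ∀ {A : Set} k (xs : List A) (f : A → ℕ) (F : Vec A k → ℕ) →
           (∀ {v} → v ∈ tuples k xs → F v ≤ 1) → (∀ {v} → v ∈ tuples k xs → 1 ≤ F v → ∀ i → 1 ≤ f (lookup v i)) →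
           ∑ (tuples k xs) F ≤ ∑ xs f ^ k
∑-tuples {A} k xs f F F≤1 F⇒f = ≤-trans (∑-mono (tuples k xs) pointwise) (≤-reflexive (power k))
  where
  entries : ∀ {k} → Vec A k → ℕ
  entries []      = 1
  entries (x ∷ v) = f x * entries v
  1≤entries : ∀ {k} (v : Vec A k) → (∀ i → 1 ≤ f (lookup v i)) → 1 ≤ entries v
  1≤entries []      h = ≤-refl
  1≤entries (x ∷ v) h = *-mono-≤ (h zero) (1≤entries v (h ∘ suc))
  pointwise : ∀ {v} → v ∈ tuples k xs → F v ≤ entries v
  pointwise {v} v∈ with 1 ≤? F v
  ... | yes 1≤F = ≤-trans (F≤1 v∈) (1≤entries v (F⇒f v∈ 1≤F))
  ... | no  1≰F = ≤-trans (≤-reflexive (n<1⇒n≡0 (≰⇒> 1≰F))) z≤n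
  power : ∀ k → ∑ (tuples k xs) entries ≡ ∑ xs f ^ k
  power zero    = refl
  power (suc k) = begin
    ∑ (tuples (suc k) xs) entries                       ≡⟨ ∑-cartesianProductWith _∷_ xs (tuples k xs) entries ⟩
    ∑ xs (λ x → ∑ (tuples k xs) (λ v → f x * entries v)) ≡⟨ ∑-cong xs (λ {x} _ → ∑-*ˡ (tuples k xs) (f x) entries) ⟩
    ∑ xs (λ x → f x * ∑ (tuples k xs) entries)           ≡⟨ ∑-*ʳ xs _ f ⟩
    ∑ xs f * ∑ (tuples k xs) entries                     ≡⟨ cong (∑ xs f *_) (power k) ⟩
    ∑ xs f * ∑ xs f ^ k                                  ∎
    where open ≡-Reasoning

-- Vertices are arranged in B blocks of size m; a layer permutes every block.

module Layers (B m′ : ℕ) where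
  open Weight m′

  Vertex Layer : Set
  Vertex = Fin B × Fin m
  Layer  = Vec (Vec (Fin m) m) B

  _≟ᵛ_ : DecidableEquality Vertex
  _≟ᵛ_ = Productₚ.≡-dec Fin._≟_ Fin._≟_

  vertices : List Vertex
  vertices = cartesianProduct (allFin B) (allFin m)

  ∈-vertices : ∀ x → x ∈ vertices
  ∈-vertices (b , i) = ∈-cartesianProduct⁺ (∈-allFin b) (∈-allFin i)

  vertices-unique : Unique vertices
  vertices-unique = Uniqueₚ.cartesianProduct⁺ (Uniqueₚ.allFin⁺ B) (Uniqueₚ.allFin⁺ m)

  vertices-length : length vertices ≡ B * m
  vertices-length = trans (length-cartesianProductWith _,_ (allFin B) (allFin m)) (cong₂ _*_ (length-allFin B)
      (length-allFin m))

  ∑-vertices : ∀ f → ∑ vertices f ≡ ∑ (allFin B) (λ b → ∑ (allFin m) (λ i → f (b , i)))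
  ∑-vertices = ∑-cartesianProductWith _,_ (allFin B) (allFin m)

  at : Layer → Vertex → Vertex
  at σ (b , i) = b , lookup (lookup σ b) i

  layers : List Layer
  layers = tuples B (permutations m)

  layers-unique : Unique layers
  layers-unique = tuples-unique B (permutations-unique m)

  layers-length : length layers ≡ M ^ B
  layers-length = trans (tuples-length B (permutations m)) (cong (_^ B) (permutations-length m))

  at-injective : ∀ {σ} → σ ∈ layers → ∀ x y → at σ x ≡ at σ y → x ≡ y
  at-injective σ∈ (b , i) (c , j) eq with Productₚ.,-injective eq
  ... | refl , eq′ = cong (b ,_) (permutations-injective m (tuples-lookup B σ∈ b) i j eq′)

  at-ext : ∀ {σ τ} → (∀ x → at σ x ≡ at τ x) → σ ≡ τ
  at-ext h = lookup-ext λ b → lookup-ext λ i → cong proj₂ (h (b , i))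

  module Avoid (hits : Vertex → Vertex → ℕ) (R : ℕ)
    (hits≤1 : ∀ x y → hits x y ≤ 1)
    (hits-block : ∀ x y → proj₁ x ≢ proj₁ y → hits x y ≡ 0)
    (few : ∀ x → ∑ vertices (hits x) ≤ R) (R+60≤m : R + 60 ≤ m) where

    misses? : ∀ σ → Dec (All (λ x → hits x (at σ x) ≡ 0) vertices)
    misses? σ = All.all? (λ x → hits x (at σ x) ≟ 0) vertices

    avoiding : List Layer
    avoiding = filter misses? layers

    same-block : Vertex → Vertex → Bool
    same-block x y = does (proj₁ x Fin.≟ proj₁ y)

    -- The matrix of the permanent: diagonal blocks of ones from which the hit entries are removed.
    -- It covers all blocks of vertices, so Bregman's bound is applied once per layer.
    free : Vertex → Vertex → Bool
    free x y = same-block x y ∧ (hits x y ≡ᵇ 0)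

    deg : Vertex → ℕ
    deg x = ∑ vertices (hits x)

    open Bregman _≟ᵛ_ _≟ᵛ_ at free M {{m !≢0}} G 1≤G G-step

    family : Family vertices vertices avoiding
    family = record
      { unique-rows    = vertices-unique
      ; unique-columns = vertices-unique
      ; into           = λ _ _ → ∈-vertices _
      ; allowed        = λ {σ} {x} σ∈ _ → free-at σ x (All.lookup (proj₂ (∈-filter⁻ misses? {xs = layers} σ∈)) (∈-vertices x))
      ; injective      = λ σ∈ _ _ → at-injective (proj₁ (∈-filter⁻ misses? {xs = layers} σ∈)) _ _
      ; unique         = Uniqueₚ.filter⁺ misses? layers-unique
      ; determined     = λ _ _ agree → at-ext (λ x → agree (∈-vertices x))
      ; size           = ≤-refl
      }
      where
      free-at : ∀ σ x → hits x (at σ x) ≡ 0 → free x (at σ x) ≡ true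
      free-at σ (b , i) eq with b Fin.≟ b | hits (b , i) (at σ (b , i))
      free-at σ (b , i) refl | yes _   | .0 = refl
      free-at σ (b , i) eq   | no  b≢b | _  = contradiction refl b≢b

    block-size : ∀ x → ∑ vertices (λ y → 𝟙 (same-block x y)) ≡ m
    block-size (b , i) = begin
      ∑ vertices (λ y → 𝟙 (same-block (b , i) y))
        ≡⟨ ∑-vertices _ ⟩
      ∑ (allFin B) (λ c → ∑ (allFin m) (λ _ → 𝟙 (does (b Fin.≟ c))))
        ≡⟨ ∑-cong (allFin B) (λ {c} _ → trans (∑-const (allFin m) _) (trans (cong (_* δ b c) (length-allFin m))
            (*-comm m (δ b c)))) ⟩
      ∑ (allFin B) (λ c → δ b c * m)
        ≡⟨ ∑-δ (Uniqueₚ.allFin⁺ B) (∈-allFin b) (λ _ → m) ⟩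
      m ∎
      where
      open ≡-Reasoning
      open Kronecker (Fin._≟_ {B})

    row+deg : ∀ x → row x vertices + deg x ≡ m
    row+deg x = trans (sym (∑-+ vertices _ _)) (trans (∑-cong vertices (λ {y} _ → pointwise y)) (block-size x))
      where
      pointwise : ∀ y → 𝟙 (free x y) + hits x y ≡ 𝟙 (same-block x y)
      pointwise y with proj₁ x Fin.≟ proj₁ y
      ... | no  x≁y = hits-block x y x≁y
      ... | yes _ with hits x y | hits≤1 x y
      ...   | 0 | _ = refl
      ...   | 1 | _ = refl
      ...   | suc (suc _) | s≤s ()

    -- `R + 60 ≤ m` leaves at least 60 free entries in the row, which is the range of the Stirling
    -- estimate behind `G-drop`.
    weight-bound : ∀ x → G (row x vertices) * (13 ^ M′) ^ deg x ≤ G m * (5 ^ M′) ^ deg x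
    weight-bound x = subst (λ z → G (row x vertices) * (13 ^ M′) ^ deg x ≤ G z * (5 ^ M′) ^ deg x) (row+deg x)
      (G-drop (deg x) (+-cancelʳ-≤ (deg x) 60 _ (subst (60 + deg x ≤_) (sym (row+deg x))
        (≤-trans (≤-reflexive (+-comm 60 (deg x))) (≤-trans (+-monoˡ-≤ 60 (few x)) R+60≤m)))) (≤-reflexive (row+deg x)))

    -- The power M′ turns the exponent m into m · (m-1)! = M, the exponent of `bregman`. For the
    -- unrestricted blocks Bregman's bound is an equality, so comparison with the number of all
    -- layers leaves exactly the losses of `weight-bound`, with total exponent D.
    avoiding-bound : let D = ∑ vertices deg in length avoiding ^ m * 13 ^ D ≤ length layers ^ m * 5 ^ D
    avoiding-bound = ^-cancelˡ-≤ M′ {{m′ !≢0}} (begin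
      (length avoiding ^ m * 13 ^ D) ^ M′
        ≡⟨ spread (length avoiding) 13 ⟩
      length avoiding ^ M * (13 ^ M′) ^ D
        ≤⟨ *-monoˡ-≤ ((13 ^ M′) ^ D) (bregman (length vertices) refl family) ⟩
      ∏ vertices (λ x → G (row x vertices)) * (13 ^ M′) ^ D
        ≡⟨ cong (∏ vertices (λ x → G (row x vertices)) *_) (sym (∏-base^ vertices (13 ^ M′) deg)) ⟩
      ∏ vertices (λ x → G (row x vertices)) * ∏ vertices (λ x → (13 ^ M′) ^ deg x)
        ≡⟨ ∏-* vertices _ _ ⟨
      ∏ vertices (λ x → G (row x vertices) * (13 ^ M′) ^ deg x)
        ≤⟨ ∏-mono vertices (λ {x} _ → weight-bound x) ⟩
      ∏ vertices (λ x → G m * (5 ^ M′) ^ deg x)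
        ≡⟨ trans (∏-* vertices _ _) (cong₂ _*_ (∏-const vertices (G m)) (∏-base^ vertices (5 ^ M′) deg)) ⟩
      G m ^ length vertices * (5 ^ M′) ^ D
        ≡⟨ cong (_* (5 ^ M′) ^ D) full ⟩
      length layers ^ M * (5 ^ M′) ^ D
        ≡⟨ spread (length layers) 5 ⟨
      (length layers ^ m * 5 ^ D) ^ M′ ∎)
      where
      open ≤-Reasoning
      D = ∑ vertices deg
      spread : ∀ a c → (a ^ m * c ^ D) ^ M′ ≡ a ^ M * (c ^ M′) ^ D
      spread a c = trans (^-distribʳ-* (a ^ m) (c ^ D) M′) (cong₂ _*_ (^-*-assoc a m M′) (^-swap c D M′))
      full : G m ^ length vertices ≡ length layers ^ M
      full = trans (cong (G m ^_) (trans vertices-length (*-comm B m))) (trans (sym (^-*-assoc (G m) m B))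
        (trans (cong (_^ B) (G-power ≤-refl)) (trans (^-swap M M B) (cong (_^ M) (sym layers-length)))))

-- Edge lists

module EdgeLists {n : ℕ} where
  open Kronecker (Fin._≟_ {n}) public

  Loopfree : Edge n → Set
  Loopfree e = proj₁ e ≢ proj₂ e

  Distinct : List (Edge n) → Set
  Distinct = AllPairs (λ e f → ¬ SameEdge e f)

  SameEdge-sym : ∀ {e f : Edge n} → SameEdge e f → SameEdge f e
  SameEdge-sym (inj₁ (refl , refl)) = inj₁ (refl , refl)
  SameEdge-sym (inj₂ (refl , refl)) = inj₂ (refl , refl)

  SameEdge-trans : ∀ {e f g : Edge n} → SameEdge e f → SameEdge f g → SameEdge e g
  SameEdge-trans (inj₁ (refl , refl)) s = s
  SameEdge-trans (inj₂ (refl , refl)) (inj₁ (refl , refl)) = inj₂ (refl , refl)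
  SameEdge-trans (inj₂ (refl , refl)) (inj₂ (refl , refl)) = inj₁ (refl , refl)

  SameEdge? : (e f : Edge n) → Dec (SameEdge e f)
  SameEdge? (a , b) (c , d) = ((a Fin.≟ c) ×-dec (b Fin.≟ d)) ⊎-dec ((a Fin.≟ d) ×-dec (b Fin.≟ c))

  incident : Edge n → Fin n → ℕ
  incident (a , b) v = if ⌊ a Fin.≟ v ⌋ ∨ ⌊ b Fin.≟ v ⌋ then 1 else 0

  touch : Edge n → Fin n → ℕ
  touch (a , b) v = δ a v + δ b v

  -- For a loopless edge this is the indicator of `SameEdge e (u , v)`; a loop at u = v would count
  -- twice. Writing it with products of deltas makes its sums over u and v factorise.
  same : Edge n → Fin n → Fin n → ℕ
  same (a , b) u v = δ a u * δ b v + δ a v * δ b u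

  degree-∑ : ∀ v es → degree v es ≡ ∑ es (λ e → incident e v)
  degree-∑ v []       = refl
  degree-∑ v (e ∷ es) = cong (incident e v +_) (degree-∑ v es)

  degree-++ : ∀ v es fs → degree v (es ++ fs) ≡ degree v es + degree v fs
  degree-++ v es fs = trans (degree-∑ v (es ++ fs)) (trans (∑-++ es fs _) (sym (cong₂ _+_ (degree-∑ v es) (degree-∑ v fs))))

  incident≤touch : ∀ e v → incident e v ≤ touch e v
  incident≤touch (a , b) v with a Fin.≟ v | b Fin.≟ v
  ... | yes _ | _     = s≤s z≤n
  ... | no _  | yes _ = ≤-refl
  ... | no _  | no _  = z≤n

  touch≤incident : ∀ e v → Loopfree e → touch e v ≤ incident e v
  touch≤incident (a , b) v a≢b with a Fin.≟ v | b Fin.≟ v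
  ... | yes refl | yes refl = contradiction refl a≢b
  ... | yes _    | no _     = ≤-refl
  ... | no _     | yes _    = ≤-refl
  ... | no _     | no _     = z≤n

  degree≤∑touch : ∀ v es → degree v es ≤ ∑ es (λ e → touch e v)
  degree≤∑touch v es = ≤-trans (≤-reflexive (degree-∑ v es)) (∑-mono es (λ {e} _ → incident≤touch e v))

  ∑touch≤degree : ∀ v {es} → All Loopfree es → ∑ es (λ e → touch e v) ≤ degree v es
  ∑touch≤degree v {es} lf = ≤-trans (∑-mono es (λ {e} e∈ → touch≤incident e v (All.lookup lf e∈))) (≤-reflexive
      (sym (degree-∑ v es)))

  SameEdge⇒1≤same : ∀ {e u v} → SameEdge e (u , v) → 1 ≤ same e u v
  SameEdge⇒1≤same {u = u} {v} (inj₁ (refl , refl)) rewrite δ-refl u | δ-refl v = s≤s z≤n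
  SameEdge⇒1≤same {u = u} {v} (inj₂ (refl , refl)) rewrite δ-refl u | δ-refl v = m≤n+m 1 (δ v u * δ u v)

  ¬SameEdge⇒same≡0 : ∀ {e u v} → ¬ SameEdge e (u , v) → same e u v ≡ 0
  ¬SameEdge⇒same≡0 {a , b} {u} {v} ¬s with a Fin.≟ u | b Fin.≟ v | a Fin.≟ v | b Fin.≟ u
  ... | yes p | yes q | _     | _     = contradiction (inj₁ (p , q)) ¬s
  ... | _     | _     | yes p | yes q = contradiction (inj₂ (p , q)) ¬s
  ... | no _  | _     | no _  | _     = refl
  ... | no _  | _     | yes _ | no _  = refl
  ... | yes _ | no _  | no _  | _     = refl
  ... | yes _ | no _  | yes _ | no _  = refl

  same≤1 : ∀ {e} u v → Loopfree e → same e u v ≤ 1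
  same≤1 {a , b} u v a≢b with a Fin.≟ u | b Fin.≟ v | a Fin.≟ v | b Fin.≟ u
  ... | yes refl | _        | _        | yes refl = contradiction refl a≢b
  ... | _        | yes refl | yes refl | _        = contradiction refl a≢b
  ... | no _     | _        | no _     | _        = z≤n
  ... | no _     | no _     | yes _    | yes _    = ≤-refl
  ... | no _     | no _     | yes _    | no _     = z≤n
  ... | yes _    | yes _    | no _     | no _     = ≤-refl
  ... | yes _    | no _     | no _     | no _     = z≤n
  ... | yes _    | no _     | yes _    | no _     = z≤n

  count-same≤1 : ∀ {es} u v → All Loopfree es → Distinct es → ∑ es (λ e → same e u v) ≤ 1
  count-same≤1 {[]}     u v _         _          = z≤n
  count-same≤1 {e ∷ es} u v (lf ∷ lfs) (new ∷ d) with SameEdge? e (u , v)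
  ... | no ¬s = subst (λ z → z + ∑ es (λ e → same e u v) ≤ 1) (sym (¬SameEdge⇒same≡0 ¬s)) (count-same≤1 u v lfs d)
  ... | yes s = subst (λ z → same e u v + z ≤ 1)
    (sym (∑-0 es (λ f∈ → ¬SameEdge⇒same≡0 (λ t → All.lookup new f∈ (SameEdge-trans s (SameEdge-sym t))))))
    (subst (_≤ 1) (sym (+-identityʳ _)) (same≤1 u v lf))

  ∑δ≤1 : ∀ {vs} → Unique vs → ∀ a → ∑ vs (λ v → δ a v) ≤ 1
  ∑δ≤1 {vs} u a = ≤-trans (≤-reflexive (∑-cong vs (λ {v} _ → δ-sym a v))) (∑-δ-injective u id (λ _ _ eq → eq) a)

  ∑δ≡1 : ∀ {vs} → Unique vs → ∀ {a} → a ∈ vs → ∑ vs (λ v → δ a v) ≡ 1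
  ∑δ≡1 {vs} u {a} a∈ = trans (∑-cong vs (λ {v} _ → sym (*-identityʳ (δ a v)))) (∑-δ u a∈ (λ _ → 1))

  ∑-same : ∀ vs e u → ∑ vs (λ v → same e u v) ≡ δ (proj₁ e) u * ∑ vs (λ v → δ (proj₂ e) v) + δ (proj₂ e) u * ∑ vs
      (λ v → δ (proj₁ e) v)
  ∑-same vs (a , b) u = trans (∑-+ vs _ _) (cong₂ _+_ (∑-*ˡ vs (δ a u) (δ b))
    (trans (∑-*ʳ vs (δ b u) (δ a)) (*-comm _ (δ b u))))

  ∑-same≤touch : ∀ {vs} → Unique vs → ∀ e u → ∑ vs (λ v → same e u v) ≤ touch e u
  ∑-same≤touch {vs} un e@(a , b) u = ≤-trans (≤-reflexive (∑-same vs e u))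
    (+-mono-≤ (≤-trans (*-monoʳ-≤ (δ a u) (∑δ≤1 un b)) (≤-reflexive (*-identityʳ (δ a u))))
              (≤-trans (*-monoʳ-≤ (δ b u) (∑δ≤1 un a)) (≤-reflexive (*-identityʳ (δ b u)))))

  ∑∑-same : ∀ {vs} → Unique vs → ∀ {e} → proj₁ e ∈ vs → proj₂ e ∈ vs → ∑ vs (λ u → ∑ vs (λ v → same e u v)) ≡ 2
  ∑∑-same {vs} un {a , b} a∈ b∈ = begin
    ∑ vs (λ u → ∑ vs (λ v → same (a , b) u v))
      ≡⟨ ∑-cong vs (λ {u} _ → trans (∑-same vs (a , b) u) (cong₂ _+_
           (trans (cong (δ a u *_) (∑δ≡1 un b∈)) (*-identityʳ (δ a u))) (trans (cong (δ b u *_) (∑δ≡1 un a∈))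
               (*-identityʳ (δ b u))))) ⟩
    ∑ vs (λ u → δ a u + δ b u)
      ≡⟨ trans (∑-+ vs (δ a) (δ b)) (cong₂ _+_ (∑δ≡1 un a∈) (∑δ≡1 un b∈)) ⟩
    2 ∎
    where open ≡-Reasoning

  ∑-touch≤2 : ∀ {vs} → Unique vs → ∀ e → ∑ vs (touch e) ≤ 2
  ∑-touch≤2 {vs} un (a , b) = ≤-trans (≤-reflexive (∑-+ vs (δ a) (δ b))) (+-mono-≤ (∑δ≤1 un a) (∑δ≤1 un b))

  ∑-degree≤ : ∀ {vs} → Unique vs → ∀ es → ∑ vs (λ v → degree v es) ≤ length es * 2
  ∑-degree≤ {vs} un es = begin
    ∑ vs (λ v → degree v es)                  ≤⟨ ∑-mono vs (λ {v} _ → degree≤∑touch v es) ⟩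
    ∑ vs (λ v → ∑ es (λ e → touch e v))       ≡⟨ ∑-swap vs es _ ⟩
    ∑ es (λ e → ∑ vs (touch e))               ≤⟨ ∑-mono es (λ {e} _ → ∑-touch≤2 un e) ⟩
    ∑ es (λ _ → 2)                            ≡⟨ ∑-const es 2 ⟩
    length es * 2                             ∎
    where open ≤-Reasoning

  neighbours≤degree : ∀ {es} → All Loopfree es → ∀ u {vs} → Unique vs →
    (∀ {v} → v ∈ vs → ∃ λ e → e ∈ es × SameEdge e (u , v)) → length vs ≤ degree u es
  neighbours≤degree {es} lf u {vs} un adj = begin
    length vs                               ≡⟨ ∑-1 vs ⟨
    ∑ vs (λ _ → 1)                          ≤⟨ ∑-mono vs (λ {v} v∈ → let (e , e∈ , s) = adj v∈ in
                                                 ≤-trans (SameEdge⇒1≤same s) (term≤∑ es (λ e → same e u v) e∈)) ⟩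
    ∑ vs (λ v → ∑ es (λ e → same e u v))    ≡⟨ ∑-swap vs es _ ⟩
    ∑ es (λ e → ∑ vs (λ v → same e u v))    ≤⟨ ∑-mono es (λ {e} _ → ∑-same≤touch un e u) ⟩
    ∑ es (λ e → touch e u)                  ≤⟨ ∑touch≤degree u lf ⟩
    degree u es                             ∎
    where open ≤-Reasoning

  Fresh : List (Edge n) → Edge n → Set
  Fresh es e = Loopfree e × All (λ f → ¬ SameEdge f e) es

  fresh? : ∀ es e → Dec (Fresh es e)
  fresh? es e = ¬? (proj₁ e Fin.≟ proj₂ e) ×-dec All.all? (λ f → ¬? (SameEdge? f e)) es

  -- Layers may have fixed points and may repeat an edge in either direction, whereas a stream must
  -- be simple. Of equal edges the last survives, so a loopless edge at the end of the list is never
  -- dropped.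
  simplify : List (Edge n) → List (Edge n)
  simplify [] = []
  simplify (e ∷ es) with fresh? (simplify es) e
  ... | yes _ = e ∷ simplify es
  ... | no  _ = simplify es

  simplify-loopfree : ∀ es → All Loopfree (simplify es)
  simplify-loopfree [] = []
  simplify-loopfree (e ∷ es) with fresh? (simplify es) e
  ... | yes (lf , _) = lf ∷ simplify-loopfree es
  ... | no  _        = simplify-loopfree es

  simplify-distinct : ∀ es → Distinct (simplify es)
  simplify-distinct [] = []
  simplify-distinct (e ∷ es) with fresh? (simplify es) e
  ... | yes (_ , new) = All.map (_∘ SameEdge-sym) new ∷ simplify-distinct es
  ... | no  _         = simplify-distinct es

  simplify-degree : ∀ v es → degree v (simplify es) ≤ degree v es
  simplify-degree v [] = z≤n
  simplify-degree v (e ∷ es) with fresh? (simplify es) e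
  ... | yes _ = +-monoʳ-≤ (incident e v) (simplify-degree v es)
  ... | no  _ = ≤-trans (simplify-degree v es) (m≤n+m _ (incident e v))

  simplify-nonempty : ∀ es {e} → Loopfree e → 1 ≤ length (simplify (es ++ [ e ]))
  simplify-nonempty [] {e} lf with fresh? [] e
  ... | yes _ = s≤s z≤n
  ... | no ¬f = contradiction (lf , []) ¬f
  simplify-nonempty (x ∷ es) {e} lf with fresh? (simplify (es ++ [ e ])) x
  ... | yes _ = s≤s z≤n
  ... | no  _ = simplify-nonempty es lf

  stale : ∀ {es e} → ¬ Fresh es e → Loopfree e → ∃ λ f → f ∈ es × SameEdge f e
  stale {[]}     ¬f lf = contradiction (lf , []) ¬f
  stale {f ∷ es} {e} ¬f lf with SameEdge? f e
  ... | yes s = f , here refl , s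
  ... | no ¬s with stale {es} (λ (_ , new) → ¬f (lf , ¬s ∷ new)) lf
  ...   | g , g∈ , s = g , there g∈ , s

  simplify-covers : ∀ {es e} → e ∈ es → Loopfree e → ∃ λ f → f ∈ simplify es × SameEdge f e
  simplify-covers {e ∷ es} (here refl) lf with fresh? (simplify es) e
  ... | yes _ = e , here refl , inj₁ (refl , refl)
  ... | no ¬f = stale ¬f lf
  simplify-covers {x ∷ es} (there e∈) lf with fresh? (simplify es) x | simplify-covers e∈ lf
  ... | yes _ | f , f∈ , s = f , there f∈ , s
  ... | no  _ | covered    = covered

-- Selection from lists and the pigeonhole principle for colourings

module _ {A : Set} {P : A → Set} (P? : ∀ x → Dec (P x)) (default : A) where

  first : List A → A
  first [] = default
  first (x ∷ xs) with P? x
  ... | yes _ = x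
  ... | no  _ = first xs

  first-satisfies : ∀ {x} xs → x ∈ xs → P x → first xs ∈ xs × P (first xs)
  first-satisfies (y ∷ xs) x∈ px with P? y
  first-satisfies (y ∷ xs) x∈          px | yes py = here refl , py
  first-satisfies (y ∷ xs) (here refl) px | no ¬py = contradiction px ¬py
  first-satisfies (y ∷ xs) (there x∈)  px | no ¬py = let (f∈ , pf) = first-satisfies xs x∈ px in there f∈ , pf

  first-head : ∀ {x xs} → P x → first (x ∷ xs) ≡ x
  first-head {x} px with P? x
  ... | yes _  = refl
  ... | no ¬px = contradiction px ¬px

headOr : ∀ {A : Set} → A → List A → A
headOr d []      = d
headOr d (x ∷ _) = x

lookup-distinct : ∀ {A : Set} {xs : List A} → Unique xs → ∀ {i j} → i Fin.< j → List.lookup xs i ≢ List.lookup xs j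
lookup-distinct (x∉ ∷ u) {zero}  {suc j} _           = All.lookup x∉ (Memₚ.∈-lookup j)
lookup-distinct (x∉ ∷ u) {suc i} {suc j} (s≤s i<j) = lookup-distinct u i<j

-- The pigeonhole principle is applied to positions in the palette rather than to colours, as the
-- palette vector may repeat entries.
same-colour : ∀ {n K} {A : Set} (c : Coloring n) → UsesAtMost K c → (f : A → Fin n) → ∀ {xs} → Unique xs →
              K < length xs → ∃ λ x → ∃ λ y → x ∈ xs × y ∈ xs × x ≢ y × c (f x) ≡ c (f y)
same-colour c (cs , uses) f {xs} u K< with Finₚ.pigeonhole K< (λ i → VecAny.index (uses (f (List.lookup xs i))))
... | i , j , i<j , eq = List.lookup xs i , List.lookup xs j , Memₚ.∈-lookup i , Memₚ.∈-lookup j , lookup-distinct u i<j ,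
      trans (VecAnyₚ.lookup-index (uses _)) (trans (cong (Vec.lookup cs) eq) (sym (VecAnyₚ.lookup-index (uses _))))

-- The adaptive half of the stream asks for an edge between two equally coloured vertices of a block that have
-- received fewer than R such edges. The alternative candidates matter only when the colouring is improper: the
-- stream has to stay valid even then.

module Greedy {n : ℕ} (B m′ : ℕ) (emb : Layers.Vertex B m′ → Fin n) (emb-injective : ∀ {x y} → emb x ≡ emb y → x ≡ y)
              (L K R : ℕ) (L<K : L + 1 ≤ K) (default : Edge n) where
  open Weight m′ using (m)
  open Layers B m′ using (Vertex; vertices; vertices-unique; ∑-vertices)
  open EdgeLists {n}

  images : List (Fin n)
  images = map emb vertices

  images-unique : Unique images
  images-unique = Uniqueₚ.map⁺ emb-injective vertices-unique

  Inside : Edge n → Set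
  Inside e = ∃ λ b → ∃ λ i → ∃ λ j → e ≡ (emb (b , i) , emb (b , j))

  pair : Fin B × (Fin m × Fin m) → Edge n
  pair (b , i , j) = emb (b , i) , emb (b , j)

  pairs : List (Edge n)
  pairs = map pair (cartesianProduct (allFin B) (cartesianProduct (allFin m) (allFin m)))

  Open : List (Edge n) → Edge n → Set
  Open T e = Loopfree e × degree (proj₁ e) T < R × degree (proj₂ e) T < R

  open? : ∀ T e → Dec (Open T e)
  open? T e = ¬? (proj₁ e Fin.≟ proj₂ e) ×-dec (degree (proj₁ e) T <? R) ×-dec (degree (proj₂ e) T <? R)

  candidates : List (Edge n) → List (Edge n)
  candidates T = filter (open? T) pairs

  mono? : ∀ (c : Coloring n) (e : Edge n) → Dec (c (proj₁ e) ≡ c (proj₂ e))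
  mono? c e = c (proj₁ e) ≟ c (proj₂ e)

  monochromatic : List (Edge n) → Coloring n → List (Edge n)
  monochromatic T c = filter (mono? c) (candidates T)

  -- The choice as it can be made without the fixed edges: `T` and the colouring determine it.
  pick : List (Edge n) → Coloring n → Edge n
  pick T c = headOr default (monochromatic T c)

  choose : List (Edge n) → List (Edge n) → Coloring n → Edge n
  choose g T c = first (fresh? (g ++ T)) default (monochromatic T c ++ candidates T)

  unsaturated? : ∀ T b i → Dec (degree (emb (b , i)) T < R)
  unsaturated? T b i = degree (emb (b , i)) T <? R

  unsaturated : List (Edge n) → Fin B → List (Fin m)
  unsaturated T b = filter (unsaturated? T b) (allFin m)

  unsaturated-unique : ∀ T b → Unique (unsaturated T b)
  unsaturated-unique T b = Uniqueₚ.filter⁺ (unsaturated? T b) (Uniqueₚ.allFin⁺ m)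

  candidates-∈ : ∀ {T b i j} → i ∈ unsaturated T b → j ∈ unsaturated T b → i ≢ j → (emb (b , i) , emb (b , j)) ∈ candidates T
  candidates-∈ {T} {b} {i} {j} i∈ j∈ i≢j = ∈-filter⁺ (open? T)
    (∈-map⁺ pair (∈-cartesianProduct⁺ (∈-allFin b) (∈-cartesianProduct⁺ (∈-allFin i) (∈-allFin j))))
    ((λ eq → i≢j (cong proj₂ (emb-injective eq))) ,
     proj₂ (∈-filter⁻ (unsaturated? T b) {xs = allFin m} i∈) , proj₂ (∈-filter⁻ (unsaturated? T b) {xs = allFin m} j∈))

  candidates-sound : ∀ {T e} → e ∈ candidates T → Inside e × Open T e
  candidates-sound {T} e∈ with ∈-filter⁻ (open? T) {xs = pairs} e∈
  ... | e∈pairs , o with ∈-map⁻ pair e∈pairs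
  ... | (b , i , j) , _ , eq = (b , i , j , eq) , o

  Room : List (Edge n) → Set
  Room T = ∃ λ b → K < length (unsaturated T b)

  -- If every block had at most K unsaturated vertices, each would contain at least m - K vertices
  -- of degree R or more in `T`. The degree sum would reach B R (m - K), although it is at most
  -- twice the length of `T`.
  room : ∀ T → length T * 2 < B * (R * (m ∸ K)) → Room T
  room T short with Finₚ.any? (λ b → K <? length (unsaturated T b))
  ... | yes r = r
  ... | no ¬r = contradiction short (≤⇒≯ (begin
    B * (R * (m ∸ K))
      ≡⟨ cong (_* (R * (m ∸ K))) (length-allFin B) ⟨
    length (allFin B) * (R * (m ∸ K))
      ≡⟨ ∑-const (allFin B) _ ⟨
    ∑ (allFin B) (λ _ → R * (m ∸ K))
      ≤⟨ ∑-mono (allFin B) (λ {b} _ → block b) ⟩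
    ∑ (allFin B) (λ b → ∑ (allFin m) (λ i → degree (emb (b , i)) T))
      ≡⟨ ∑-vertices _ ⟨
    ∑ vertices (λ x → degree (emb x) T)
      ≡⟨ ∑-map emb vertices (λ v → degree v T) ⟨
    ∑ images (λ v → degree v T)
      ≤⟨ ∑-degree≤ images-unique T ⟩
    length T * 2 ∎))
    where
    open ≤-Reasoning
    low : Fin B → Fin m → Bool
    low b i = does (unsaturated? T b i)
    when-not : ∀ {P : Set} (P? : Dec P) {x} → (¬ P → R ≤ x) → R * 𝟙 (not (does P?)) ≤ x
    when-not (yes _) h = ≤-trans (≤-reflexive (*-zeroʳ R)) z≤n
    when-not (no ¬p) h = ≤-trans (≤-reflexive (*-identityʳ R)) (h ¬p)
    saturated : ∀ b i → R * 𝟙 (not (low b i)) ≤ degree (emb (b , i)) T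
    saturated b i = when-not (unsaturated? T b i) ≮⇒≥
    count : ∀ b → m ∸ K ≤ ∑ (allFin m) (λ i → 𝟙 (not (low b i)))
    count b = ≤-trans (∸-monoʳ-≤ m (≮⇒≥ (λ lt → ¬r (b , lt)))) (≤-reflexive
      (trans (cong (_∸ length (unsaturated T b)) total) (m+n∸m≡n (length (unsaturated T b)) _)))
      where
      total : m ≡ length (unsaturated T b) + ∑ (allFin m) (λ i → 𝟙 (not (low b i)))
      total = sym (trans (cong (_+ ∑ (allFin m) (λ i → 𝟙 (not (low b i)))) (length-filter (unsaturated? T b) (allFin m)))
        (trans (sym (∑-+ (allFin m) (λ i → 𝟙 (low b i)) (λ i → 𝟙 (not (low b i))))) (trans (∑-cong (allFin m)
            (λ {i} _ → 𝟙+𝟙not (low b i))) (trans (∑-1 (allFin m)) (length-allFin m)))))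
    block : ∀ b → R * (m ∸ K) ≤ ∑ (allFin m) (λ i → degree (emb (b , i)) T)
    block b = ≤-trans (*-monoʳ-≤ R (count b)) (≤-trans (≤-reflexive (sym (∑-*ˡ (allFin m) R _))) (∑-mono
        (allFin m) (λ {i} _ → saturated b i)))

  -- One unsaturated vertex of a block with room has at least K unsaturated partners, but only L < K
  -- neighbours in `es`, so some pair is new. This keeps the stream valid after improper answers
  -- too.
  exists-fresh : ∀ {es} T → All Loopfree es → (∀ v → degree v es ≤ L) → Room T → ∃ λ e → e ∈ candidates T × Fresh es e
  exists-fresh {es} T lf deg (b , K<) = search (unsaturated T b) refl
    where
    search : ∀ us → unsaturated T b ≡ us → ∃ λ e → e ∈ candidates T × Fresh es e
    search [] eq = contradiction (subst (λ us → K < length us) eq K<) λ ()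
    search (i ∷ us) eq with Any.any? (λ j → fresh? es (emb (b , i) , emb (b , j))) us
    ... | yes found with Mem.find found
    ...   | j , j∈ , fresh = _ , candidates-∈ {T} (subst (i ∈_) (sym eq) (here refl)) (subst (j ∈_) (sym eq) (there j∈))
                                   (λ i≡j → proj₁ fresh (cong (λ k → emb (b , k)) i≡j)) , fresh
    search (i ∷ us) eq | no ¬found = contradiction crowded (<⇒≱ (≤-trans (≤-reflexive (+-comm 1 L)) L<K))
      where
      unique-us : Unique (i ∷ us)
      unique-us = subst Unique eq (unsaturated-unique T b)
      adjacent : ∀ {v} → v ∈ map (λ j → emb (b , j)) us → ∃ λ e → e ∈ es × SameEdge e (emb (b , i) , v)
      adjacent v∈ with ∈-map⁻ (λ j → emb (b , j)) v∈
      ... | j , j∈ , refl = stale (λ fresh → ¬found (Mem.lose j∈ fresh))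
              (λ eq′ → All.lookup (AllPairs.head unique-us) j∈ (cong proj₂ (emb-injective eq′)))
      crowded : K ≤ L
      crowded = begin
        K                                     ≤⟨ s≤s⁻¹ (subst (λ us → K < length us) eq K<) ⟩
        length us                             ≡⟨ Listₚ.length-map (λ j → emb (b , j)) us ⟨
        length (map (λ j → emb (b , j)) us)   ≤⟨ neighbours≤degree lf (emb (b , i))
                                                  (Uniqueₚ.map⁺ (λ eq′ → cong proj₂ (emb-injective eq′))
                                                      (AllPairs.tail unique-us)) adjacent ⟩
        degree (emb (b , i)) es               ≤⟨ deg _ ⟩
        L                                     ∎
        where open ≤-Reasoning

  exists-monochromatic : ∀ T c → UsesAtMost K c → Room T → ∃ λ e → e ∈ monochromatic T c
  exists-monochromatic T c uses (b , K<) with same-colour c uses (λ i → emb (b , i)) (unsaturated-unique T b) K<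
  ... | i , j , i∈ , j∈ , i≢j , eq = _ , ∈-filter⁺ (mono? c) (candidates-∈ {T} i∈ j∈ i≢j) eq

  -- A proper colouring has no monochromatic edge in g ++ T, so the very first monochromatic
  -- candidate is already fresh, and the pigeonhole principle ensures that there is one.
  choose≡pick : ∀ g T c → ProperKColoring K (g ++ T) c → Room T → choose g T c ≡ pick T c
  choose≡pick g T c (uses , proper) r = by-head (monochromatic T c) refl
    where
    separate : ∀ {e f : Edge n} → c (proj₁ e) ≡ c (proj₂ e) → c (proj₁ f) ≢ c (proj₂ f) → ¬ SameEdge f e
    separate eq ≢ (inj₁ (refl , refl)) = ≢ eq
    separate eq ≢ (inj₂ (refl , refl)) = ≢ (sym eq)
    by-head : ∀ ms → monochromatic T c ≡ ms → first (fresh? (g ++ T)) default (ms ++ candidates T) ≡ headOr default ms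
    by-head []       eq = contradiction (subst (proj₁ (exists-monochromatic T c uses r) ∈_) eq (proj₂
        (exists-monochromatic T c uses r))) λ ()
    by-head (e ∷ ms) eq with ∈-filter⁻ (mono? c) {xs = candidates T} (subst (e ∈_) (sym eq) (here refl))
    ... | e∈ , mono = first-head (fresh? (g ++ T)) default {xs = ms ++ candidates T}
                        (proj₁ (proj₂ (candidates-sound {T} e∈)) , All.map (separate mono) proper)

  record Good (g T : List (Edge n)) : Set where
    field
      inside   : All Inside T
      loopfree : All Loopfree (g ++ T)
      distinct : Distinct (g ++ T)
      bounded  : ∀ v → degree v T ≤ R

  module _ {g : List (Edge n)} (light : ∀ v → degree v g + R ≤ L) where

    light-++ : ∀ {T} → Good g T → ∀ v → degree v (g ++ T) ≤ L
    light-++ {T} good v = ≤-trans (≤-reflexive (degree-++ v g T)) (≤-trans (+-monoʳ-≤ (degree v g)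
        (Good.bounded good v)) (light v))

    Good⇒Valid : ∀ {T} → Good g T → ValidStream n L (g ++ T)
    Good⇒Valid good = Good.loopfree good , Good.distinct good , light-++ good

    Good-choose : ∀ {T} c → Good g T → Room T → Good g (T ++ [ choose g T c ])
    Good-choose {T} c good r = record
      { inside   = Allₚ.∷ʳ⁺ inside (proj₁ (candidates-sound {T} e∈))
      ; loopfree = subst (All Loopfree) (Listₚ.++-assoc g T [ e ]) (Allₚ.∷ʳ⁺ loopfree (proj₁ fresh))
      ; distinct = subst Distinct (Listₚ.++-assoc g T [ e ]) (AllPairsₚ.++⁺ distinct ([] ∷ []) (All.map (_∷ []) (proj₂ fresh)))
      ; bounded  = λ v → ≤-trans (≤-reflexive (degree-++ v T [ e ])) (bounded′ v)
      }
      where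
      open Good good
      e = choose g T c
      chosen : e ∈ monochromatic T c ++ candidates T × Fresh (g ++ T) e
      chosen with exists-fresh T loopfree (light-++ good) r
      ... | f , f∈ , fresh = first-satisfies (fresh? (g ++ T)) default _ (∈-++⁺ʳ (monochromatic T c) f∈) fresh
      fresh : Fresh (g ++ T) e
      fresh = proj₂ chosen
      e∈ : e ∈ candidates T
      e∈ with ∈-++⁻ (monochromatic T c) (proj₁ chosen)
      ... | inj₁ p = proj₁ (∈-filter⁻ (mono? c) {xs = candidates T} p)
      ... | inj₂ p = p
      open-e : Open T e
      open-e = proj₂ (candidates-sound {T} e∈)
      bounded′ : ∀ v → degree v T + degree v [ e ] ≤ R
      bounded′ v with proj₁ e Fin.≟ v | proj₂ e Fin.≟ v
      ... | yes refl | _        = subst (_≤ R) (+-comm 1 _) (proj₁ (proj₂ open-e))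
      ... | no _     | yes refl = subst (_≤ R) (+-comm 1 _) (proj₂ (proj₂ open-e))
      ... | no _     | no _     = ≤-trans (≤-reflexive (+-identityʳ _)) (bounded v)

-- The adversary's stream and its simulation from an intermediate state

module Play {n s r : ℕ} (B m′ : ℕ) (emb : Layers.Vertex B m′ → Fin n) (emb-injective : ∀ {x y} → emb x ≡ emb y → x ≡ y)
            (L K R : ℕ) (L<K : L + 1 ≤ K) (default : Edge n)
            (rounds : ℕ) (rounds-bound : ∀ {i} → i < rounds → i * 2 < B * (R * (suc m′ ∸ K)))
            (A : Algorithm n s r) where
  open EdgeLists {n}
  open Greedy B m′ emb emb-injective L K R L<K default

  data Phase : Set where
    fixed    : List (Edge n) → Phase
    adaptive : List (Edge n) → Coloring n → Phase

  next : List (Edge n) → Phase → Edge n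
  next g (fixed [])      = default
  next g (fixed (e ∷ _)) = e
  next g (adaptive T c)  = choose g T c

  -- In `fixed (e ∷ es)` the edge `e` is the one being sent. The answer to the last fixed edge
  -- therefore arrives in the phase `fixed (e ∷ [])` and becomes the colouring on which the first
  -- adaptive edge is based.
  step : List (Edge n) → Phase → Coloring n → Phase
  step g (fixed (_ ∷ e ∷ es)) c = fixed (e ∷ es)
  step g (fixed _)            c = adaptive [] c
  step g (adaptive T c)       d = adaptive (T ++ [ choose g T c ]) d

  phase : List (Edge n) → List (Coloring n) → Phase
  phase g = List.foldl (step g) (fixed g)

  adversary : List (Edge n) → Adversary n
  adversary g os = next g (phase g os)

  module _ (ρ : Fin (suc r)) where

    -- As long as all answers are proper, the adaptive phase depends on the fixed edges only through the state it starts in.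
    simulate : State s → ℕ → State s × List (Edge n)
    simulate st zero    = st , []
    simulate st (suc i) = let (st′ , T) = simulate st i ; e = pick T (query A st′ ρ) in update A st′ e ρ , T ++ [ e ]

    module _ (g : List (Edge n)) (1≤g : 1 ≤ length g) where

      at-time : ℕ → Snapshot n s
      at-time t = run A (adversary g) t ρ

      phase-at : ℕ → Phase
      phase-at t = phase g (outputs (at-time t))

      phase-suc : ∀ t → phase-at (suc t) ≡ step g (phase-at t) (current (at-time (suc t)))
      phase-suc t = Listₚ.foldl-++ (step g) (fixed g) (outputs (at-time t)) _

      current-query : ∀ t → current (at-time t) ≡ query A (state (at-time t)) ρ
      current-query zero    = refl
      current-query (suc t) = refl

      record FixedDone (t : ℕ) : Set where
        field
          sent    : edges (at-time t) ≡ g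
          started : phase-at t ≡ adaptive [] (current (at-time t))

      send-fixed : ∀ t ps e es → edges (at-time t) ≡ ps → phase-at t ≡ fixed (e ∷ es) → ps ++ e ∷ es ≡ g →
                   FixedDone (suc (length es + t))
      send-fixed t ps e [] sent ph eq = record
        { sent    = trans (cong₂ (λ es e → es ++ [ e ]) sent (cong (next g) ph)) eq
        ; started = trans (phase-suc t) (cong (λ p → step g p (current (at-time (suc t)))) ph)
        }
      send-fixed t ps e (e′ ∷ es) sent ph eq = subst (λ k → FixedDone (suc k)) (+-suc (length es) t)
        (send-fixed (suc t) (ps ++ [ e ]) e′ es
          (cong₂ (λ es e → es ++ [ e ]) sent (cong (next g) ph))
          (trans (phase-suc t) (cong (λ p → step g p (current (at-time (suc t)))) ph))
          (trans (Listₚ.++-assoc ps [ e ] (e′ ∷ es)) eq))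

      fixed-done : FixedDone (length g)
      fixed-done = start g refl 1≤g
        where
        start : ∀ g′ → g′ ≡ g → 1 ≤ length g′ → FixedDone (length g′)
        start (e ∷ es) eq _ = subst (λ k → FixedDone (suc k)) (+-identityʳ (length es))
          (send-fixed 0 [] e es refl (cong fixed (sym eq)) eq)

      proper-at : ∀ t → 1 ≤ t → AllProper A (adversary g) K t ρ → ProperKColoring K (edges (at-time t)) (current (at-time t))
      proper-at (suc t) _ (_ , p) = p

      module _ (light : ∀ v → degree v g + R ≤ L) where

        -- Validity of the stream is owed for every random string, so all fields except `simulated`
        -- are to hold whatever the algorithm answers. Agreement with the simulation is claimed for
        -- proper answers.
        record Adaptive (i : ℕ) : Set where
          field
            T         : List (Edge n)
            sent      : edges (at-time (i + length g)) ≡ g ++ T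
            in-phase  : phase-at (i + length g) ≡ adaptive T (current (at-time (i + length g)))
            count     : length T ≡ i
            good      : Good g T
            simulated : AllProper A (adversary g) K (i + length g) ρ →
                        simulate (state (at-time (length g))) i ≡ (state (at-time (i + length g)) , T)

        adaptive-at : Good g [] → ∀ i → i ≤ rounds → Adaptive i
        adaptive-at good zero _ = record
          { T         = []
          ; sent      = trans (FixedDone.sent fixed-done) (sym (Listₚ.++-identityʳ g))
          ; in-phase  = FixedDone.started fixed-done
          ; count     = refl
          ; good      = good
          ; simulated = λ _ → refl
          }
        adaptive-at good₀ (suc i) i< = record
          { T         = T ++ [ choose g T c ]
          ; sent      = trans (cong₂ (λ es e → es ++ [ e ]) sent chosen) (Listₚ.++-assoc g T _)
          ; in-phase  = trans (phase-suc t) (cong (λ p → step g p (current (at-time (suc t)))) in-phase)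
          ; count     = trans (length-++ T) (trans (+-comm (length T) 1) (cong suc count))
          ; good      = Good-choose light c good free
          ; simulated = λ proper → sim (proj₁ proper)
          }
          where
          open Adaptive (adaptive-at good₀ i (<⇒≤ i<))
          t = i + length g
          c = current (at-time t)
          free : Room T
          free = room T (subst (λ k → k * 2 < B * (R * (suc m′ ∸ K))) (sym count) (rounds-bound i<))
          chosen : adversary g (outputs (at-time t)) ≡ choose g T c
          chosen = cong (next g) in-phase
          sim : AllProper A (adversary g) K t ρ →
                simulate (state (at-time (length g))) (suc i) ≡ (state (at-time (suc t)) , T ++ [ choose g T c ])
          sim proper = trans (cong advance (simulated proper)) (cong₂ (λ e e′ → update A (state (at-time t)) e ρ , T ++ [ e′ ])
              (trans picked (sym chosen)) picked)
            where
            advance : State s × List (Edge n) → State s × List (Edge n)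
            advance (st′ , T) = update A st′ (pick T (query A st′ ρ)) ρ , T ++ [ pick T (query A st′ ρ) ]
            picked : pick T (query A (state (at-time t)) ρ) ≡ choose g T c
            picked = trans (cong (pick T) (sym (current-query t)))
              (sym (choose≡pick g T c (subst (λ es → ProperKColoring K es c) sent (proper-at t (≤-trans 1≤g
                  (m≤n+m _ i)) proper)) free))

        transcript : Good g [] → Adaptive rounds
        transcript good = adaptive-at good rounds ≤-refl

-- Counting first parts by random string and state

lookup-sum : ∀ {k} (G : Subset k) → ∣ G ∣ ≡ ∑ (allFin k) (λ i → 𝟙 (lookup G i))
lookup-sum {zero}  []      = refl
lookup-sum {suc k} (b ∷ G) = trans (count b) (cong (𝟙 b +_) (trans (lookup-sum G) (sym tail)))
  where
  count : ∀ b → ∣ b ∷ G ∣ ≡ 𝟙 b + ∣ G ∣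
  count true  = refl
  count false = refl
  tail : ∑ (List.tabulate suc) (λ i → 𝟙 (lookup (b ∷ G) i)) ≡ ∑ (allFin k) (λ i → 𝟙 (lookup G i))
  tail = trans (cong (λ xs → ∑ xs (λ i → 𝟙 (lookup (b ∷ G) i))) (sym (Listₚ.map-tabulate id suc))) (∑-map suc (allFin k) _)

Distinct-++ : ∀ {n} (g : List (Edge n)) {T f e} → EdgeLists.Distinct (g ++ T) → f ∈ g → e ∈ T → ¬ SameEdge f e
Distinct-++ (_ ∷ g) (new ∷ _) (here refl) e∈ = All.lookup new (∈-++⁺ʳ g e∈)
Distinct-++ (_ ∷ g) (_ ∷ d)   (there f∈)  e∈ = Distinct-++ g d f∈ e∈

positive-term : (xs : List I) (f : I → ℕ) → 1 ≤ ∑ xs f → ∃ λ x → x ∈ xs × 1 ≤ f x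
positive-term (x ∷ xs) f 1≤ with 1 ≤? f x
... | yes p = x , here refl , p
... | no ¬p with positive-term xs f (subst (λ z → 1 ≤ z + ∑ xs f) (n<1⇒n≡0 (≰⇒> ¬p)) 1≤)
...   | y , y∈ , q = y , there y∈ , q

module Count {n s r : ℕ} (B m′ : ℕ) (emb : Layers.Vertex B m′ → Fin n) (emb-injective : ∀ {x y} → emb x ≡ emb y → x ≡ y)
             (L K R : ℕ) (L<K : L + 1 ≤ K) (default : Edge n) (default-loopfree : proj₁ default ≢ proj₂ default)
             (rounds : ℕ) (rounds-bound : ∀ {i} → i < rounds → i * 2 < B * (R * (suc m′ ∸ K)))
             (h : ℕ) (budget : h * 2 + 1 + R ≤ L) (R+60≤m : R + 60 ≤ suc m′)
             (A : Algorithm n s r) (robust : Robust L K A) where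
  open EdgeLists {n}
  open Weight m′ using (m)
  open Layers B m′
  open Greedy B m′ emb emb-injective L K R L<K default
  open Play B m′ emb emb-injective L K R L<K default rounds rounds-bound A

  Design : Set
  Design = Vec Layer h

  designs : List Design
  designs = tuples h layers

  layer-edges : Layer → List (Edge n)
  layer-edges σ = map (λ x → emb x , emb (at σ x)) vertices

  all-edges : ∀ {k} → Vec Layer k → List (Edge n)
  all-edges []      = []
  all-edges (σ ∷ τ) = layer-edges σ ++ all-edges τ

  -- The default edge guarantees that a colouring has been reported before the adaptive phase starts.
  graph : Design → List (Edge n)
  graph τ = simplify (all-edges τ ++ [ default ])

  layer-degree : ∀ {σ} → σ ∈ layers → ∀ v → degree v (layer-edges σ) ≤ 2
  layer-degree {σ} σ∈ v = begin
    degree v (layer-edges σ)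
      ≤⟨ degree≤∑touch v (layer-edges σ) ⟩
    ∑ (layer-edges σ) (λ e → touch e v)
      ≡⟨ trans (∑-map _ vertices _) (∑-+ vertices _ _) ⟩
    ∑ vertices (λ x → δ (emb x) v) + ∑ vertices (λ x → δ (emb (at σ x)) v)
      ≤⟨ +-mono-≤ (∑-δ-injective vertices-unique emb (λ _ _ → emb-injective) v)
                  (∑-δ-injective vertices-unique (emb ∘ at σ) (λ _ _ eq → at-injective σ∈ _ _ (emb-injective eq)) v) ⟩
    2 ∎
    where open ≤-Reasoning

  all-degree : ∀ {k} (τ : Vec Layer k) → (∀ i → lookup τ i ∈ layers) → ∀ v → degree v (all-edges τ) ≤ k * 2
  all-degree []      _  v = z≤n
  all-degree (σ ∷ τ) τ∈ v = ≤-trans (≤-reflexive (degree-++ v (layer-edges σ) (all-edges τ)))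
    (+-mono-≤ (layer-degree (τ∈ zero) v) (all-degree τ (τ∈ ∘ suc) v))

  incident≤1 : ∀ e v → incident e v ≤ 1
  incident≤1 (a , b) v with ⌊ a Fin.≟ v ⌋ ∨ ⌊ b Fin.≟ v ⌋
  ... | true  = ≤-refl
  ... | false = z≤n

  light : ∀ {τ} → τ ∈ designs → ∀ v → degree v (graph τ) + R ≤ L
  light {τ} τ∈ v = begin
    degree v (graph τ) + R                          ≤⟨ +-monoˡ-≤ R (simplify-degree v (all-edges τ ++ [ default ])) ⟩
    degree v (all-edges τ ++ [ default ]) + R       ≡⟨ cong (_+ R) (degree-++ v (all-edges τ) [ default ]) ⟩
    degree v (all-edges τ) + (incident default v + 0) + R ≤⟨ +-monoˡ-≤ R (+-mono-≤ (all-degree τ (tuples-lookup h τ∈) v)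
                                                         (≤-trans (≤-reflexive (+-identityʳ _)) (incident≤1 default v))) ⟩
    h * 2 + 1 + R                                   ≤⟨ budget ⟩
    L                                               ∎
    where open ≤-Reasoning

  nonempty : ∀ τ → 1 ≤ length (graph τ)
  nonempty τ = simplify-nonempty (all-edges τ) default-loopfree

  initially-good : ∀ τ → Good (graph τ) []
  initially-good τ = record
    { inside   = []
    ; loopfree = subst (All Loopfree) (sym (Listₚ.++-identityʳ (graph τ))) (simplify-loopfree (all-edges τ ++ [ default ]))
    ; distinct = subst Distinct (sym (Listₚ.++-identityʳ (graph τ))) (simplify-distinct (all-edges τ ++ [ default ]))
    ; bounded  = λ _ → z≤n
    }

  ∈-all-edges : ∀ {k} (τ : Vec Layer k) i {e} → e ∈ layer-edges (lookup τ i) → e ∈ all-edges τ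
  ∈-all-edges (σ ∷ τ) zero    e∈ = ∈-++⁺ˡ e∈
  ∈-all-edges (σ ∷ τ) (suc i) e∈ = ∈-++⁺ʳ (layer-edges σ) (∈-all-edges τ i e∈)

  hits : List (Edge n) → Vertex → Vertex → ℕ
  hits T x y = ∑ T (λ e → same e (emb x) (emb y))

  Loopfree-right : ∀ g {T} → All Loopfree (g ++ T) → All Loopfree T
  Loopfree-right g = Allₚ.++⁻ʳ g

  Distinct-right : ∀ g {T} → Distinct (g ++ T) → Distinct T
  Distinct-right []      d       = d
  Distinct-right (_ ∷ g) (_ ∷ d) = Distinct-right g d

  -- At a fixed point of the layer the pair is a loop, and `T` has none. Otherwise the pair survives
  -- in `graph τ` up to orientation, and `T` shares no edge with that graph.
  unhit : ∀ {τ T} → Good (graph τ) T → ∀ i x → hits T x (at (lookup τ i) x) ≡ 0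
  unhit {τ} {T} good i x = ∑-0 T (λ {e} e∈ → ¬SameEdge⇒same≡0 (separate e∈))
    where
    open Good good
    y = at (lookup τ i) x
    separate : ∀ {e} → e ∈ T → ¬ SameEdge e (emb x , emb y)
    separate {e} e∈ s with emb x Fin.≟ emb y
    ... | yes loop = All.lookup (Loopfree-right (graph τ) loopfree) e∈ (loop-transfer s)
      where
      loop-transfer : SameEdge e (emb x , emb y) → proj₁ e ≡ proj₂ e
      loop-transfer (inj₁ (p , q)) = trans p (trans loop (sym q))
      loop-transfer (inj₂ (p , q)) = trans p (trans (sym loop) (sym q))
    ... | no ¬loop with simplify-covers {all-edges τ ++ [ default ]}
                          (∈-++⁺ˡ (∈-all-edges τ i (∈-map⁺ (λ x → emb x , emb (at (lookup τ i) x)) (∈-vertices x)))) ¬loop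
    ...   | f , f∈ , t = Distinct-++ (graph τ) distinct f∈ e∈ (SameEdge-trans t (SameEdge-sym s))

  module Target {g T} (good : Good g T) where
    open Good good

    T-loopfree : All Loopfree T
    T-loopfree = Loopfree-right g loopfree

    hits≤1 : ∀ x y → hits T x y ≤ 1
    hits≤1 x y = count-same≤1 (emb x) (emb y) T-loopfree (Distinct-right g distinct)

    hits-block : ∀ x y → proj₁ x ≢ proj₁ y → hits T x y ≡ 0
    hits-block x y x≁y = ∑-0 T (λ e∈ → ¬SameEdge⇒same≡0 (λ s → x≁y (aligned (All.lookup inside e∈) s)))
      where
      aligned : ∀ {e} → Inside e → SameEdge e (emb x , emb y) → proj₁ x ≡ proj₁ y
      aligned (b , i , j , refl) (inj₁ (p , q)) = trans (sym (cong proj₁ (emb-injective p))) (cong proj₁ (emb-injective q))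
      aligned (b , i , j , refl) (inj₂ (p , q)) = trans (sym (cong proj₁ (emb-injective q))) (cong proj₁ (emb-injective p))

    ∑-hits : ∀ x → ∑ vertices (hits T x) ≡ ∑ T (λ e → ∑ images (same e (emb x)))
    ∑-hits x = trans (∑-swap vertices T _) (∑-cong T (λ {e} _ → sym (∑-map emb vertices (same e (emb x)))))

    few : ∀ x → ∑ vertices (hits T x) ≤ R
    few x = begin
      ∑ vertices (hits T x)                      ≡⟨ ∑-hits x ⟩
      ∑ T (λ e → ∑ images (same e (emb x)))      ≤⟨ ∑-mono T (λ {e} _ → ∑-same≤touch images-unique e (emb x)) ⟩
      ∑ T (λ e → touch e (emb x))                ≤⟨ ∑touch≤degree (emb x) T-loopfree ⟩
      degree (emb x) T                           ≤⟨ bounded (emb x) ⟩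
      R                                          ∎
      where open ≤-Reasoning

    total-hits : ∑ vertices (λ x → ∑ vertices (hits T x)) ≡ length T * 2
    total-hits = begin
      ∑ vertices (λ x → ∑ vertices (hits T x))
        ≡⟨ ∑-cong vertices (λ {x} _ → ∑-hits x) ⟩
      ∑ vertices (λ x → ∑ T (λ e → ∑ images (same e (emb x))))
        ≡⟨ ∑-swap vertices T _ ⟩
      ∑ T (λ e → ∑ vertices (λ x → ∑ images (same e (emb x))))
        ≡⟨ ∑-cong T (λ {e} e∈ → trans (sym (∑-map emb vertices (λ u → ∑ images (same e u)))) (twice (All.lookup inside e∈))) ⟩
      ∑ T (λ _ → 2)
        ≡⟨ ∑-const T 2 ⟩
      length T * 2 ∎
      where
      open ≡-Reasoning
      twice : ∀ {e} → Inside e → ∑ images (λ u → ∑ images (same e u)) ≡ 2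
      twice (b , i , j , refl) = ∑∑-same images-unique (∈-map⁺ emb (∈-vertices (b , i))) (∈-map⁺ emb (∈-vertices (b , j)))

    open Avoid (hits T) R hits≤1 hits-block few R+60≤m public

  play : ∀ {τ} (τ∈ : τ ∈ designs) ρ → Adaptive ρ (graph τ) (nonempty τ) (light τ∈) rounds
  play {τ} τ∈ ρ = transcript ρ (graph τ) (nonempty τ) (light τ∈) (initially-good τ)

  duration : Design → ℕ
  duration τ = rounds + length (graph τ)

  outcome : ∀ {τ} → τ ∈ designs → Σ (Subset (suc r)) λ G →
    suc r ≤ ∣ G ∣ * 4 × (∀ ρ → ρ Subset.∈ G → AllProper A (adversary (graph τ)) K (duration τ) ρ)
  outcome {τ} τ∈ = robust (adversary (graph τ)) (duration τ) λ ρ →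
    subst (ValidStream n L) (sym (Adaptive.sent (play τ∈ ρ))) (Good⇒Valid (light τ∈) (Adaptive.good (play τ∈ ρ)))

  _≟ᵈ_ : DecidableEquality Design
  _≟ᵈ_ = Vecₚ.≡-dec (Vecₚ.≡-dec (Vecₚ.≡-dec Fin._≟_))

  open DecMem _≟ᵈ_ using (_∈?_)

  -- `outcome` depends on a membership proof. Deciding membership selects one such proof, so that
  -- each design has a single lucky set that can appear in sums.
  lucky-from : ∀ {τ} → Dec (τ ∈ designs) → Subset (suc r)
  lucky-from (yes τ∈) = proj₁ (outcome τ∈)
  lucky-from (no _)   = Subset.⊥

  lucky : Design → Subset (suc r)
  lucky τ = lucky-from (τ ∈? designs)

  lucky-size : ∀ {τ} → τ ∈ designs → suc r ≤ ∣ lucky τ ∣ * 4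
  lucky-size {τ} τ∈ = from (τ ∈? designs)
    where
    from : ∀ d → suc r ≤ ∣ lucky-from {τ} d ∣ * 4
    from (yes p) = proj₁ (proj₂ (outcome p))
    from (no ¬p) = contradiction τ∈ ¬p

  lucky-proper : ∀ {τ ρ} → τ ∈ designs → lookup (lucky τ) ρ ≡ true → AllProper A (adversary (graph τ)) K (duration τ) ρ
  lucky-proper {τ} {ρ} τ∈ = from (τ ∈? designs)
    where
    from : ∀ d → lookup (lucky-from {τ} d) ρ ≡ true → AllProper A (adversary (graph τ)) K (duration τ) ρ
    from (yes p) eq = proj₂ (proj₂ (outcome p)) ρ (Vecₚ.lookup⇒[]= ρ _ eq)
    from (no ¬p) _  = contradiction τ∈ ¬p

  _≟ˢ_ : DecidableEquality (State s)
  _≟ˢ_ = Vecₚ.≡-dec Bool._≟_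

  open Kronecker _≟ˢ_ using () renaming (δ to δˢ; ∑-δ to ∑-δˢ)

  states : List (State s)
  states = tuples s (true ∷ false ∷ [])

  states-unique : Unique states
  states-unique = tuples-unique s (((λ ()) ∷ []) ∷ [] ∷ [])

  ∈-states : ∀ st → st ∈ states
  ∈-states = tuples-complete λ { true → here refl ; false → there (here refl) }

  halfway : Design → Fin (suc r) → State s
  halfway τ ρ = state (run A (adversary (graph τ)) (length (graph τ)) ρ)

  member : Fin (suc r) → State s → Design → ℕ
  member ρ st τ = 𝟙 (lookup (lucky τ) ρ) * δˢ (halfway τ ρ) st

  member≤1 : ∀ ρ st τ → member ρ st τ ≤ 1
  member≤1 ρ st τ = *-mono-≤ (𝟙≤1 (lookup (lucky τ) ρ)) (𝟙≤1 (does (halfway τ ρ ≟ˢ st)))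

  member⇒ : ∀ {ρ st τ} → 1 ≤ member ρ st τ → lookup (lucky τ) ρ ≡ true × halfway τ ρ ≡ st
  member⇒ {ρ} {st} {τ} = from (lookup (lucky τ) ρ) (halfway τ ρ ≟ˢ st)
    where
    from : ∀ b (d : Dec (halfway τ ρ ≡ st)) → 1 ≤ 𝟙 b * 𝟙 (does d) → b ≡ true × halfway τ ρ ≡ st
    from true (yes eq) _ = refl , eq

  class : Fin (suc r) → State s → ℕ
  class ρ st = ∑ designs (member ρ st)

  reconstructed : Fin (suc r) → State s → List (Edge n)
  reconstructed ρ st = proj₂ (simulate ρ st rounds)

  -- With a lucky random string all answers are proper, so the actual adaptive edges are the
  -- simulated ones. These depend on `ρ` and `st` but not on `τ`: the whole class shares one edge
  -- list.
  member-good : ∀ {ρ st τ} → τ ∈ designs → 1 ≤ member ρ st τ →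
                Good (graph τ) (reconstructed ρ st) × length (reconstructed ρ st) ≡ rounds
  member-good {ρ} {st} {τ} τ∈ 1≤ = from (member⇒ {ρ} {st} {τ} 1≤)
    where
    open Adaptive (play τ∈ ρ)
    from : lookup (lucky τ) ρ ≡ true × halfway τ ρ ≡ st →
           Good (graph τ) (reconstructed ρ st) × length (reconstructed ρ st) ≡ rounds
    from (luck , refl) = subst (Good (graph τ)) (sym T≡) good , trans (cong length T≡) count
      where
      T≡ : reconstructed ρ (halfway τ ρ) ≡ T
      T≡ = cong proj₂ (simulated (lucky-proper τ∈ luck))

  D : ℕ
  D = rounds * 2

  regroup : ∀ a c → (a ^ h) ^ m * c ^ (h * D) ≡ (a ^ m * c ^ D) ^ h
  regroup a c = trans (cong₂ _*_ (^-swap a h m) (trans (cong (c ^_) (*-comm h D)) (sym (^-*-assoc c D h))))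
                      (sym (^-distribʳ-* (a ^ m) (c ^ D) h))

  -- Every layer of every design in the class avoids the list `reconstructed ρ st`, so the class has
  -- at most `length avoiding ^ h` elements. A member is required to see that this list is loopless,
  -- simple and of bounded degree; an empty class satisfies the bound trivially.
  class-bound : ∀ ρ st → class ρ st ^ m * 13 ^ (h * D) ≤ length designs ^ m * 5 ^ (h * D)
  class-bound ρ st = from (1 ≤? class ρ st)
    where
    from : Dec (1 ≤ class ρ st) → class ρ st ^ m * 13 ^ (h * D) ≤ length designs ^ m * 5 ^ (h * D)
    from (no ¬1≤) = subst (λ q → q ^ m * 13 ^ (h * D) ≤ length designs ^ m * 5 ^ (h * D)) (sym (n<1⇒n≡0 (≰⇒> ¬1≤))) z≤n
    from (yes 1≤) = inhabited (positive-term designs (member ρ st) 1≤)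
      where
      inhabited : (∃ λ τ → τ ∈ designs × 1 ≤ member ρ st τ) → class ρ st ^ m * 13 ^ (h * D) ≤ length designs ^ m * 5 ^ (h * D)
      inhabited (τ₀ , τ₀∈ , 1≤₀) = begin
        class ρ st ^ m * 13 ^ (h * D)
          ≤⟨ *-monoˡ-≤ (13 ^ (h * D)) (^-monoˡ-≤ m small) ⟩
        (length avoiding ^ h) ^ m * 13 ^ (h * D)
          ≡⟨ regroup (length avoiding) 13 ⟩
        (length avoiding ^ m * 13 ^ D) ^ h
          ≤⟨ ^-monoˡ-≤ h (subst (λ d → length avoiding ^ m * 13 ^ d ≤ length layers ^ m * 5 ^ d)
               (trans total-hits (cong (_* 2) (proj₂ (member-good τ₀∈ 1≤₀)))) avoiding-bound) ⟩
        (length layers ^ m * 5 ^ D) ^ h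
          ≡⟨ regroup (length layers) 5 ⟨
        (length layers ^ h) ^ m * 5 ^ (h * D)
          ≡⟨ cong (λ l → l ^ m * 5 ^ (h * D)) (tuples-length h layers) ⟨
        length designs ^ m * 5 ^ (h * D) ∎
        where
        open ≤-Reasoning
        open Target (proj₁ (member-good τ₀∈ 1≤₀))
        misses : Layer → ℕ
        misses σ = 𝟙 (does (misses? σ))
        misses-true : ∀ {σ} → All (λ x → hits (reconstructed ρ st) x (at σ x) ≡ 0) vertices → 1 ≤ misses σ
        misses-true {σ} all with misses? σ
        ... | yes _ = ≤-refl
        ... | no ¬p = contradiction all ¬p
        small : class ρ st ≤ length avoiding ^ h
        small = subst (λ l → class ρ st ≤ l ^ h) (sym (length-filter misses? layers))
          (∑-tuples h layers misses (member ρ st) (λ {τ} _ → member≤1 ρ st τ)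
            (λ {τ} τ∈ 1≤ i → misses-true {lookup τ i} (All.tabulate (λ {x} _ → unhit {τ} (proj₁ (member-good τ∈ 1≤)) i x))))

  1≤designs : 1 ≤ length designs
  1≤designs = subst (1 ≤_) (sym (trans (tuples-length h layers) (cong (_^ h) layers-length)))
                    (m^n>0 (M ^ B) {{m^n≢0 M B {{m !≢0}}}} h)
    where open Weight m′ using (M)

  classes : List (Fin (suc r) × State s)
  classes = cartesianProduct (allFin (suc r)) states

  classes-length : length classes ≡ suc r * 2 ^ s
  classes-length = trans (length-cartesianProductWith _,_ (allFin (suc r)) states)
    (cong₂ _*_ (length-allFin (suc r)) (tuples-length s (true ∷ false ∷ [])))

  luck-total : length designs * suc r ≤ ∑ classes (λ (ρ , st) → class ρ st) * 4
  luck-total = begin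
    length designs * suc r
      ≡⟨ ∑-const designs (suc r) ⟨
    ∑ designs (λ _ → suc r)
      ≤⟨ ∑-mono designs lucky-size ⟩
    ∑ designs (λ τ → ∣ lucky τ ∣ * 4)
      ≡⟨ ∑-*ʳ designs 4 _ ⟩
    ∑ designs (λ τ → ∣ lucky τ ∣) * 4
      ≡⟨ cong (_* 4) (∑-cong designs (λ {τ} _ → by-state τ)) ⟩
    ∑ designs (λ τ → ∑ classes (λ (ρ , st) → member ρ st τ)) * 4
      ≡⟨ cong (_* 4) (∑-swap designs classes _) ⟩
    ∑ classes (λ (ρ , st) → class ρ st) * 4 ∎
    where
    open ≤-Reasoning
    by-state : ∀ τ → ∣ lucky τ ∣ ≡ ∑ classes (λ (ρ , st) → member ρ st τ)
    by-state τ = trans (lookup-sum (lucky τ)) (trans (∑-cong (allFin (suc r)) (λ {ρ} _ → split ρ))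
      (sym (∑-cartesianProductWith _,_ (allFin (suc r)) states _)))
      where
      split : ∀ ρ → 𝟙 (lookup (lucky τ) ρ) ≡ ∑ states (λ st → member ρ st τ)
      split ρ = sym (trans (∑-*ˡ states (𝟙 (lookup (lucky τ) ρ)) _)
        (trans (cong (𝟙 (lookup (lucky τ) ρ) *_) (trans (∑-cong states (λ {st} _ → sym (*-identityʳ _)))
          (∑-δˢ states-unique (∈-states (halfway τ ρ)) (λ _ → 1)))) (*-identityʳ _)))

  -- Averaging over random strings and states together: at least a quarter of all pairs of a design
  -- and a random string are lucky, and they are spread over (r+1) · 2^s classes. The factor r + 1
  -- cancels, so fixing the random string costs no bits.
  large-class : ∃ λ ρ → ∃ λ st → length designs ≤ 4 * 2 ^ s * class ρ st
  large-class = from (max-term classes (λ (ρ , st) → class ρ st) 1≤∑)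
    where
    open ≤-Reasoning
    total : ℕ
    total = ∑ classes (λ (ρ , st) → class ρ st)
    1≤∑ : 1 ≤ total
    1≤∑ = >-nonZero⁻¹ total {{m*n≢0⇒m≢0 total {4} {{>-nonZero (≤-trans (*-mono-≤ 1≤designs (s≤s (z≤n {r}))) luck-total)}}}}
    rearrange : ∀ a b c → a * b * c * 4 ≡ 4 * b * c * a
    rearrange = solve-∀
    from : (∃ λ (ρ , st) → total ≤ length classes * class ρ st) → ∃ λ ρ → ∃ λ st → length designs ≤ 4 * 2 ^ s * class ρ st
    from ((ρ , st) , max) = ρ , st , *-cancelʳ-≤ _ _ (suc r) (begin
      length designs * suc r
        ≤⟨ luck-total ⟩
      ∑ classes (λ (ρ , st) → class ρ st) * 4
        ≤⟨ *-monoˡ-≤ 4 max ⟩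
      length classes * class ρ st * 4
        ≡⟨ cong (λ l → l * class ρ st * 4) classes-length ⟩
      suc r * 2 ^ s * class ρ st * 4
        ≡⟨ rearrange (suc r) (2 ^ s) (class ρ st) ⟩
      4 * 2 ^ s * class ρ st * suc r ∎)

  -- In logarithms: h D ln(13/5) ≤ m (s + 2) ln 2. It compares the lower bound for the largest class
  -- with the upper bound for every class.
  communication : 13 ^ (h * D) ≤ (4 * 2 ^ s) ^ m * 5 ^ (h * D)
  communication = from large-class
    where
    open ≤-Reasoning
    rearrange : ∀ a b c → a * (b * c) ≡ b * (a * c)
    rearrange = solve-∀
    from : (∃ λ ρ → ∃ λ st → length designs ≤ 4 * 2 ^ s * class ρ st) → 13 ^ (h * D) ≤ (4 * 2 ^ s) ^ m * 5 ^ (h * D)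
    from (ρ , st , large) = *-cancelˡ-≤ (length designs ^ m) {{m^n≢0 (length designs) m {{>-nonZero 1≤designs}}}} (begin
      length designs ^ m * 13 ^ (h * D)
        ≤⟨ *-monoˡ-≤ (13 ^ (h * D)) (^-monoˡ-≤ m large) ⟩
      (4 * 2 ^ s * class ρ st) ^ m * 13 ^ (h * D)
        ≡⟨ trans (cong (_* 13 ^ (h * D)) (^-distribʳ-* (4 * 2 ^ s) (class ρ st) m)) (*-assoc ((4 * 2 ^ s) ^ m)
            (class ρ st ^ m) (13 ^ (h * D))) ⟩
      (4 * 2 ^ s) ^ m * (class ρ st ^ m * 13 ^ (h * D))
        ≤⟨ *-monoʳ-≤ ((4 * 2 ^ s) ^ m) (class-bound ρ st) ⟩
      (4 * 2 ^ s) ^ m * (length designs ^ m * 5 ^ (h * D))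
        ≡⟨ rearrange ((4 * 2 ^ s) ^ m) (length designs ^ m) (5 ^ (h * D)) ⟩
      length designs ^ m * ((4 * 2 ^ s) ^ m * 5 ^ (h * D)) ∎)

-- Comparing the exponential series with powers

-- expNum₁₀₀ y N is the N-th partial sum of the series of e^(y/100), multiplied by N! 100^N.

expNum₁₀₀ : ℕ → ℕ → ℕ
expNum₁₀₀ y zero    = 1
expNum₁₀₀ y (suc N) = 100 * (suc N * expNum₁₀₀ y N) + y ^ suc N

-- The mean value bound for a power, with the derivative at the right end; it is the estimate for a
-- single term of the series.
power-increment : ∀ y k → suc y ^ suc k ≤ y ^ suc k + suc k * suc y ^ k
power-increment y zero    = ≤-reflexive (base y)
  where
  base : ∀ y → suc y * 1 ≡ y * 1 + 1
  base = solve-∀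
power-increment y (suc k) = begin
  p + y * p                                ≤⟨ +-monoʳ-≤ p (*-monoʳ-≤ y (power-increment y k)) ⟩
  p + y * (y ^ suc k + suc k * suc y ^ k)  ≡⟨ cong (p +_) (expand y (y ^ suc k) (suc k) (suc y ^ k)) ⟩
  p + (y * y ^ suc k + suc k * (y * suc y ^ k)) ≤⟨ +-monoʳ-≤ p (+-monoʳ-≤ (y * y ^ suc k) (*-monoʳ-≤ (suc k)
      (*-monoˡ-≤ (suc y ^ k) (n≤1+n y)))) ⟩
  p + (y * y ^ suc k + suc k * p)          ≡⟨ collect p (y * y ^ suc k) (suc k) ⟩
  y * y ^ suc k + suc (suc k) * p          ∎
  where
  open ≤-Reasoning
  p = suc y ^ suc k
  expand : ∀ y a k b → y * (a + k * b) ≡ y * a + k * (y * b)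
  expand = solve-∀
  collect : ∀ p a k → p + (a + k * p) ≡ a + (1 + k) * p
  collect = solve-∀

-- Convexity: (f((y+1)/100) − f(y/100)) · 100 ≤ f′((y+1)/100) for each truncation f of the series.
expNum₁₀₀-convex : ∀ y N → expNum₁₀₀ (suc y) (suc N) ≤ expNum₁₀₀ y (suc N) + suc N * expNum₁₀₀ (suc y) N
expNum₁₀₀-convex y zero    = ≤-reflexive (cong (100 +_) (base y))
  where
  base : ∀ y → suc y * 1 ≡ y * 1 + 1
  base = solve-∀
expNum₁₀₀-convex y (suc N) = begin
  100 * (k * E′) + suc y ^ k
    ≤⟨ +-mono-≤ (*-monoʳ-≤ 100 (*-monoʳ-≤ k (expNum₁₀₀-convex y N))) (power-increment y (suc N)) ⟩
  100 * (k * (E + suc N * F′)) + (y ^ k + k * suc y ^ suc N)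
    ≡⟨ regroup 100 k E (suc N * F′) (y ^ k) (suc y ^ suc N) ⟩
  100 * (k * E) + y ^ k + k * (100 * (suc N * F′) + suc y ^ suc N) ∎
  where
  open ≤-Reasoning
  k = suc (suc N)
  E = expNum₁₀₀ y (suc N)
  E′ = expNum₁₀₀ (suc y) (suc N)
  F′ = expNum₁₀₀ (suc y) N
  regroup : ∀ q k e f a b → q * (k * (e + f)) + (a + k * b) ≡ q * (k * e) + a + k * (q * f + b)
  regroup = solve-∀

-- In effect e^(1/100) ≤ 100/99: the derivative of a truncated series is the shorter truncation,
-- hence at most the series itself, and convexity bounds the increment by a hundredth of it.
expNum₁₀₀-ratio : ∀ y N → 99 * expNum₁₀₀ (suc y) N ≤ 100 * expNum₁₀₀ y N
expNum₁₀₀-ratio y zero    = n≤1+n 99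
expNum₁₀₀-ratio y (suc N) = +-cancelʳ-≤ E′ _ _ (begin
  99 * E′ + E′                     ≡⟨ +-comm (99 * E′) E′ ⟩
  100 * E′                         ≤⟨ *-monoʳ-≤ 100 (expNum₁₀₀-convex y N) ⟩
  100 * (E + suc N * F′)           ≡⟨ *-distribˡ-+ 100 E (suc N * F′) ⟩
  100 * E + 100 * (suc N * F′)     ≤⟨ +-monoʳ-≤ (100 * E) (m≤m+n _ _) ⟩
  100 * E + E′                     ∎)
  where
  open ≤-Reasoning
  E = expNum₁₀₀ y (suc N)
  E′ = expNum₁₀₀ (suc y) (suc N)
  F′ = expNum₁₀₀ (suc y) N

expNum₁₀₀-bound : ∀ y N → 99 ^ y * expNum₁₀₀ y N ≤ 100 ^ y * expNum₁₀₀ 0 N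
expNum₁₀₀-bound zero    N = ≤-refl
expNum₁₀₀-bound (suc y) N = begin
  99 * 99 ^ y * expNum₁₀₀ (suc y) N    ≡⟨ swap 99 (99 ^ y) _ ⟩
  99 ^ y * (99 * expNum₁₀₀ (suc y) N)  ≤⟨ *-monoʳ-≤ (99 ^ y) (expNum₁₀₀-ratio y N) ⟩
  99 ^ y * (100 * expNum₁₀₀ y N)       ≡⟨ swap′ 100 (99 ^ y) _ ⟩
  100 * (99 ^ y * expNum₁₀₀ y N)       ≤⟨ *-monoʳ-≤ 100 (expNum₁₀₀-bound y N) ⟩
  100 * (100 ^ y * expNum₁₀₀ 0 N)      ≡⟨ *-assoc 100 (100 ^ y) _ ⟨
  100 * 100 ^ y * expNum₁₀₀ 0 N        ∎
  where
  open ≤-Reasoning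
  swap : ∀ a b c → a * b * c ≡ b * (a * c)
  swap = solve-∀
  swap′ : ∀ a b c → b * (a * c) ≡ a * (b * c)
  swap′ = solve-∀

expNum₁₀₀-0 : ∀ N → expNum₁₀₀ 0 N ≡ 100 ^ N * N !
expNum₁₀₀-0 zero    = refl
expNum₁₀₀-0 (suc N) = trans (+-identityʳ _) (trans (cong (λ e → 100 * (suc N * e)) (expNum₁₀₀-0 N))
                        (regroup 100 (suc N) (100 ^ N) (N !)))
  where
  regroup : ∀ q k a b → q * (k * (a * b)) ≡ q * a * (k * b)
  regroup = solve-∀

expNum₁₀₀-100 : ∀ x N → expNum₁₀₀ (100 * x) N ≡ 100 ^ N * expNum x N
expNum₁₀₀-100 x zero    = refl
expNum₁₀₀-100 x (suc N) = trans (cong₂ (λ e p → 100 * (suc N * e) + p) (expNum₁₀₀-100 x N) (^-distribʳ-* 100 x (suc N)))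
                            (regroup 100 (suc N) (100 ^ N) (expNum x N) (x ^ suc N))
  where
  regroup : ∀ q k a b p → q * (k * (a * b)) + q * a * p ≡ q * a * (k * b + p)
  regroup = solve-∀

-- Every partial sum of e^x is at most (100/99)^(100x), by 100 x steps of length 1/100 starting from
-- 0.
expNum-bound : ∀ x N → 99 ^ (100 * x) * expNum x N ≤ 100 ^ (100 * x) * N !
expNum-bound x N = *-cancelˡ-≤ (100 ^ N) {{m^n≢0 100 N}} (begin
  100 ^ N * (99 ^ (100 * x) * expNum x N)     ≡⟨ swap (100 ^ N) (99 ^ (100 * x)) _ ⟩
  99 ^ (100 * x) * (100 ^ N * expNum x N)     ≡⟨ cong (99 ^ (100 * x) *_) (expNum₁₀₀-100 x N) ⟨
  99 ^ (100 * x) * expNum₁₀₀ (100 * x) N      ≤⟨ expNum₁₀₀-bound (100 * x) N ⟩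
  100 ^ (100 * x) * expNum₁₀₀ 0 N             ≡⟨ cong (100 ^ (100 * x) *_) (expNum₁₀₀-0 N) ⟩
  100 ^ (100 * x) * (100 ^ N * N !)           ≡⟨ swap (100 ^ (100 * x)) (100 ^ N) _ ⟩
  100 ^ N * (100 ^ (100 * x) * N !)           ∎)
  where
  open ≤-Reasoning
  swap : ∀ a b c → a * (b * c) ≡ b * (a * c)
  swap = solve-∀

-- Since (100/99)^100 exceeds e, this is a form of e^19 ≤ (13/5)^20.
e-versus-13/5 : 100 ^ 1900 * 5 ^ 20 ≤ 13 ^ 20 * 99 ^ 1900
e-versus-13/5 = ≤ᵇ⇒≤ (100 ^ 1900 * 5 ^ 20) (13 ^ 20 * 99 ^ 1900) tt

-- The hypothesis says (13/5)^Z ≤ 2^(38c). Its 20th power gives e^(19Z) ≤ 2^(760c), and 760 = 19 ·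
-- 40; this is how 38 becomes the 40 of the theorem.
exp-from-13/5 : ∀ Z c → 13 ^ Z ≤ 2 ^ (38 * c) * 5 ^ Z → ExpAtMost Z (2 ^ (40 * c))
exp-from-13/5 Z c le N = *-cancelˡ-≤ (99 ^ (100 * Z)) {{m^n≢0 99 (100 * Z)}} (begin
  99 ^ (100 * Z) * expNum Z N                     ≤⟨ expNum-bound Z N ⟩
  100 ^ (100 * Z) * N !                           ≤⟨ *-monoˡ-≤ (N !) root ⟩
  2 ^ (40 * c) * 99 ^ (100 * Z) * N !             ≡⟨ rearrange (2 ^ (40 * c)) (99 ^ (100 * Z)) (N !) ⟩
  99 ^ (100 * Z) * (2 ^ (40 * c) * N !)           ∎)
  where
  open ≤-Reasoning
  rearrange : ∀ a b c → a * b * c ≡ b * (a * c)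
  rearrange = solve-∀
  nineteenth : ∀ b → (b ^ (100 * Z)) ^ 19 ≡ (b ^ 1900) ^ Z
  nineteenth b = trans (^-*-assoc b (100 * Z) 19) (trans (cong (b ^_) (trans (*-comm (100 * Z) 19) (sym
      (*-assoc 19 100 Z)))) (sym (^-*-assoc b 1900 Z)))
  powers : (2 ^ (38 * c)) ^ 20 ≡ (2 ^ (40 * c)) ^ 19
  powers = trans (^-*-assoc 2 (38 * c) 20) (trans (cong (2 ^_) (exponents c)) (sym (^-*-assoc 2 (40 * c) 19)))
    where
    exponents : ∀ c → 38 * c * 20 ≡ 40 * c * 19
    exponents c = trans (*-comm (38 * c) 20) (trans (sym (*-assoc 20 38 c)) (trans (*-assoc 19 40 c) (*-comm 19 (40 * c))))
  root : 100 ^ (100 * Z) ≤ 2 ^ (40 * c) * 99 ^ (100 * Z)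
  root = ^-cancelˡ-≤ 19 (*-cancelʳ-≤ _ _ ((5 ^ 20) ^ Z) {{m^n≢0 (5 ^ 20) Z}} (begin
    (100 ^ (100 * Z)) ^ 19 * (5 ^ 20) ^ Z             ≡⟨ cong (_* (5 ^ 20) ^ Z) (nineteenth 100) ⟩
    (100 ^ 1900) ^ Z * (5 ^ 20) ^ Z                   ≡⟨ ^-distribʳ-* (100 ^ 1900) (5 ^ 20) Z ⟨
    (100 ^ 1900 * 5 ^ 20) ^ Z                         ≤⟨ ^-monoˡ-≤ Z e-versus-13/5 ⟩
    (13 ^ 20 * 99 ^ 1900) ^ Z                         ≡⟨ ^-distribʳ-* (13 ^ 20) (99 ^ 1900) Z ⟩
    (13 ^ 20) ^ Z * (99 ^ 1900) ^ Z                   ≡⟨ cong (_* (99 ^ 1900) ^ Z) (^-swap 13 20 Z) ⟩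
    (13 ^ Z) ^ 20 * (99 ^ 1900) ^ Z                   ≤⟨ *-monoˡ-≤ ((99 ^ 1900) ^ Z) (^-monoˡ-≤ 20 le) ⟩
    (2 ^ (38 * c) * 5 ^ Z) ^ 20 * (99 ^ 1900) ^ Z     ≡⟨ cong (_* (99 ^ 1900) ^ Z) (trans (^-distribʳ-* (2 ^
        (38 * c)) (5 ^ Z) 20) (cong₂ _*_ powers (^-swap 5 Z 20))) ⟩
    (2 ^ (40 * c)) ^ 19 * (5 ^ 20) ^ Z * (99 ^ 1900) ^ Z ≡⟨ swap ((2 ^ (40 * c)) ^ 19) ((5 ^ 20) ^ Z) ((99 ^ 1900) ^ Z) ⟩
    (2 ^ (40 * c)) ^ 19 * (99 ^ 1900) ^ Z * (5 ^ 20) ^ Z ≡⟨ cong (λ z → (2 ^ (40 * c)) ^ 19 * z * (5 ^ 20) ^ Z)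
        (nineteenth 99) ⟨
    (2 ^ (40 * c)) ^ 19 * (99 ^ (100 * Z)) ^ 19 * (5 ^ 20) ^ Z ≡⟨ cong (_* (5 ^ 20) ^ Z) (^-distribʳ-* (2 ^
        (40 * c)) (99 ^ (100 * Z)) 19) ⟨
    (2 ^ (40 * c) * 99 ^ (100 * Z)) ^ 19 * (5 ^ 20) ^ Z ∎))
    where
    swap : ∀ a b c → a * b * c ≡ a * c * b
    swap = solve-∀

-- Numerical estimates for the parameters

-- As n ≥ 2K ≥ 2 (L+1), the hypothesis e^L ≥ (4n)^12 implies e^L ≥ (8 (L+1))^12. Each L below 77 is
-- refuted by evaluation, with (100/99)^(100L) in place of e^L. The threshold is 4 · 19 + 1, which
-- makes the number of layers at least 19.
L-large : ∀ {n L K} → 2 * K ≤ n → L + 1 ≤ K → ExpAtLeast L ((4 * n) ^ 12) → 77 ≤ L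
L-large {n} {L} {K} 2K≤n L<K (N , large) with 77 ≤? L
... | yes p = p
... | no ¬p = contradiction (begin-strict
    100 ^ (100 * L)                       <⟨ checked {L} (≰⇒> ¬p) ⟩
    (8 * (L + 1)) ^ 12 * 99 ^ (100 * L)   ≤⟨ *-monoˡ-≤ (99 ^ (100 * L)) (^-monoˡ-≤ 12 8[L+1]≤4n) ⟩
    (4 * n) ^ 12 * 99 ^ (100 * L)         ≤⟨ upper ⟩
    100 ^ (100 * L)                       ∎) (<-irrefl refl)
  where
  open ≤-Reasoning
  checked : ∀ {L} → L < 77 → 100 ^ (100 * L) < (8 * (L + 1)) ^ 12 * 99 ^ (100 * L)
  checked = toWitness {a? = allUpTo? (λ L → 100 ^ (100 * L) <? (8 * (L + 1)) ^ 12 * 99 ^ (100 * L)) 77} tt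
  8[L+1]≤4n : 8 * (L + 1) ≤ 4 * n
  8[L+1]≤4n = ≤-trans (≤-reflexive (*-assoc 4 2 (L + 1))) (*-monoʳ-≤ 4 (≤-trans (*-monoʳ-≤ 2 L<K) 2K≤n))
  upper : (4 * n) ^ 12 * 99 ^ (100 * L) ≤ 100 ^ (100 * L)
  upper = *-cancelʳ-≤ _ _ (N !) {{N !≢0}} (begin
    (4 * n) ^ 12 * 99 ^ (100 * L) * N !    ≡⟨ swap ((4 * n) ^ 12) (99 ^ (100 * L)) (N !) ⟩
    99 ^ (100 * L) * ((4 * n) ^ 12 * N !)  ≤⟨ *-monoʳ-≤ (99 ^ (100 * L)) large ⟩
    99 ^ (100 * L) * expNum L N            ≤⟨ expNum-bound L N ⟩
    100 ^ (100 * L) * N !                  ∎)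
    where
    swap : ∀ a b c → a * b * c ≡ b * (a * c)
    swap = solve-∀

rearrangement : ∀ {a b c d} → a ≤ b → c ≤ d → a * d + b * c ≤ a * c + b * d
rearrangement {a} {b} {c} {d} a≤b c≤d = subst₂ (λ b d → a * d + b * c ≤ a * c + b * d) (m+[n∸m]≡n a≤b) (m+[n∸m]≡n c≤d)
  (≤-trans (m≤m+n _ ((b ∸ a) * (d ∸ c))) (≤-reflexive (expand a (b ∸ a) c (d ∸ c))))
  where
  expand : ∀ a x c y → a * (c + y) + (a + x) * c + x * y ≡ a * c + (a + x) * (c + y)
  expand = solve-∀

-- The difference of the two sides is concave in z, and (2z + 1 − K)(2K − z) ≥ 0 interpolates between the ends of the range.
block-inequality : ∀ K z → 78 ≤ K → K ≤ 2 * z + 1 → z ≤ 2 * K →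
                   288 * ((K + z) * (K + z + 1)) ≤ 1330 * (K * z)
block-inequality K z 78≤K K≤ z≤ = +-cancelʳ-≤ (144 * z) _ _ (begin
  288 * ((K + z) * (K + z + 1)) + 144 * z
    ≡⟨ expand K z ⟩
  144 * (K * (2 * K) + (2 * z + 1) * z) + (576 * (K * z) + 288 * K + 288 * z)
    ≤⟨ +-monoˡ-≤ _ (*-monoʳ-≤ 144 (rearrangement K≤ z≤)) ⟩
  144 * (K * z + (2 * z + 1) * (2 * K)) + (576 * (K * z) + 288 * K + 288 * z)
    ≡⟨ collect K z ⟩
  1296 * (K * z) + (576 * K + 144 * z) + 144 * z
    ≤⟨ +-monoˡ-≤ (144 * z) (+-monoʳ-≤ (1296 * (K * z)) (+-mono-≤ left right)) ⟩
  1296 * (K * z) + (17 * (K * z) + 17 * (K * z)) + 144 * z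
    ≡⟨ join K z ⟩
  1330 * (K * z) + 144 * z ∎)
  where
  open ≤-Reasoning
  expand : ∀ K z → 288 * ((K + z) * (K + z + 1)) + 144 * z
                 ≡ 144 * (K * (2 * K) + (2 * z + 1) * z) + (576 * (K * z) + 288 * K + 288 * z)
  expand = solve-∀
  collect : ∀ K z → 144 * (K * z + (2 * z + 1) * (2 * K)) + (576 * (K * z) + 288 * K + 288 * z)
                  ≡ 1296 * (K * z) + (576 * K + 144 * z) + 144 * z
  collect = solve-∀
  join : ∀ K z → 1296 * (K * z) + (17 * (K * z) + 17 * (K * z)) + 144 * z ≡ 1330 * (K * z) + 144 * z
  join = solve-∀
  39≤z : 39 ≤ z
  39≤z with 39 ≤? z
  ... | yes p = p
  ... | no ¬p = contradiction (≤-trans 78≤K (≤-trans K≤ (+-monoˡ-≤ 1 (*-monoʳ-≤ 2 (s≤s⁻¹ (≰⇒> ¬p)))))) λ le → <-irrefl refl le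
  left : 576 * K ≤ 17 * (K * z)
  left = begin
    576 * K           ≤⟨ *-monoˡ-≤ K (m≤m+n 576 87) ⟩
    17 * 39 * K       ≡⟨ *-assoc 17 39 K ⟩
    17 * (39 * K)     ≤⟨ *-monoʳ-≤ 17 (*-monoˡ-≤ K 39≤z) ⟩
    17 * (z * K)      ≡⟨ cong (17 *_) (*-comm z K) ⟩
    17 * (K * z)      ∎
  right : 144 * z ≤ 17 * (K * z)
  right = begin
    144 * z           ≤⟨ *-monoˡ-≤ z (m≤m+n 144 1182) ⟩
    17 * 78 * z       ≡⟨ *-assoc 17 78 z ⟩
    17 * (78 * z)     ≤⟨ *-monoʳ-≤ 17 (*-monoˡ-≤ z 78≤K) ⟩
    17 * (K * z)      ∎

-- For L ≈ 4h and R ≈ 2h the ratio L² / (h R) is about 8 = 288 / 36. Weakening 36 to 35 frees 16 h²,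
-- which absorbs the terms linear in h.
degree-split : ∀ {h ρ} → 19 ≤ h → ρ ≤ 3 → 35 * (suc (ρ + h * 4) * suc (ρ + h * 4)) ≤ 288 * (h * (h * 2 + ρ))
degree-split {h} {ρ} 19≤h ρ≤3 = begin
  35 * (suc (ρ + h * 4) * suc (ρ + h * 4))
    ≡⟨ expand h ρ ⟩
  560 * (h * h) + 280 * (h * (ρ + 1)) + 35 * ((ρ + 1) * (ρ + 1))
    -- The coefficient 8 completes 280 h ρ to 288 h ρ and makes the remaining linear terms add up to
    -- exactly 16 · 19 h.
    ≤⟨ +-monoʳ-≤ (560 * (h * h) + 280 * (h * (ρ + 1))) low ⟩
  560 * (h * h) + 280 * (h * (ρ + 1)) + 8 * (h * (ρ + 3))
    ≡⟨ collect h ρ ⟩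
  560 * (h * h) + 288 * (h * ρ) + 16 * (19 * h)
    ≤⟨ +-monoʳ-≤ (560 * (h * h) + 288 * (h * ρ)) (*-monoʳ-≤ 16 (*-monoˡ-≤ h 19≤h)) ⟩
  560 * (h * h) + 288 * (h * ρ) + 16 * (h * h)
    ≡⟨ join h ρ ⟩
  288 * (h * (h * 2 + ρ)) ∎
  where
  open ≤-Reasoning
  expand : ∀ h ρ → 35 * ((1 + (ρ + h * 4)) * (1 + (ρ + h * 4)))
                 ≡ 560 * (h * h) + 280 * (h * (ρ + 1)) + 35 * ((ρ + 1) * (ρ + 1))
  expand = solve-∀
  collect : ∀ h ρ → 560 * (h * h) + 280 * (h * (ρ + 1)) + 8 * (h * (ρ + 3))
                  ≡ 560 * (h * h) + 288 * (h * ρ) + 16 * (19 * h)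
  collect = solve-∀
  join : ∀ h ρ → 560 * (h * h) + 288 * (h * ρ) + 16 * (h * h) ≡ 288 * (h * (h * 2 + ρ))
  join = solve-∀
  split : ∀ ρ → 8 * (19 * (ρ + 3)) ≡ 35 * ((ρ + 1) * 4) + (12 * ρ + 316)
  split = solve-∀
  low : 35 * ((ρ + 1) * (ρ + 1)) ≤ 8 * (h * (ρ + 3))
  low = begin
    35 * ((ρ + 1) * (ρ + 1))               ≤⟨ *-monoʳ-≤ 35 (*-monoʳ-≤ (ρ + 1) (+-monoˡ-≤ 1 ρ≤3)) ⟩
    35 * ((ρ + 1) * 4)                     ≤⟨ m≤m+n _ (12 * ρ + 316) ⟩
    35 * ((ρ + 1) * 4) + (12 * ρ + 316)    ≡⟨ split ρ ⟨
    8 * (19 * (ρ + 3))                     ≤⟨ *-monoʳ-≤ 8 (*-monoˡ-≤ (ρ + 3) 19≤h) ⟩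
    8 * (h * (ρ + 3))                      ∎

-- To leading order h R = L² / 8 and m² ≤ (9/2) K z, which would give 36 K. The weaker ratios 288/35
-- and 1330/288 pay for the rounding, and since 1330 = 35 · 38 their product is 38.
edge-count : ∀ {n B L K h R z} → let m = K + z in n ≤ (m + 1) * B → 35 * (L * L) ≤ 288 * (h * R) →
             288 * (m * (m + 1)) ≤ 1330 * (K * z) → n * (L * L) * m ≤ 38 * K * (h * (B * (R * z)))
edge-count {n} {B} {L} {K} {h} {R} {z} n≤ L≤ m≤ = *-cancelˡ-≤ (288 * 35) (begin
  288 * 35 * (n * (L * L) * m)
    ≡⟨ regroup₁ 288 35 n (L * L) m ⟩
  n * (288 * m * (35 * (L * L)))
    ≤⟨ *-mono-≤ n≤ (*-monoʳ-≤ (288 * m) L≤) ⟩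
  (m + 1) * B * (288 * m * (288 * (h * R)))
    ≡⟨ regroup₂ 288 m B (h * R) ⟩
  288 * (m * (m + 1)) * (288 * (B * (h * R)))
    ≤⟨ *-monoˡ-≤ (288 * (B * (h * R))) m≤ ⟩
  35 * 38 * (K * z) * (288 * (B * (h * R)))
    ≡⟨ regroup₃ 288 35 38 K z B h R ⟩
  288 * 35 * (38 * K * (h * (B * (R * z)))) ∎)
  where
  open ≤-Reasoning
  m = K + z
  regroup₁ : ∀ a b n l m → a * b * (n * l * m) ≡ n * (a * m * (b * l))
  regroup₁ = solve-∀
  regroup₂ : ∀ a m b w → (m + 1) * b * (a * m * (a * w)) ≡ a * (m * (m + 1)) * (a * (b * w))
  regroup₂ = solve-∀
  regroup₃ : ∀ a b c k z d h r → b * c * (k * z) * (a * (d * (h * r))) ≡ a * b * (c * k * (h * (d * (r * z))))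
  regroup₃ = solve-∀

-- The communication bound is raised to the power 38 K, and an m-th root is taken. The surplus t of
-- 38 K Y over Z m can be discarded because (13/5)^t ≥ 1.
from-communication : ∀ {Z m Y K s} .{{_ : NonZero m}} → Z * m ≤ 38 * K * Y → 13 ^ Y ≤ (4 * 2 ^ s) ^ m * 5 ^ Y →
                     13 ^ Z ≤ 2 ^ (38 * (K * (2 + s))) * 5 ^ Z
from-communication {Z} {m} {Y} {K} {s} Zm≤ le = ^-cancelˡ-≤ m (*-cancelʳ-≤ _ _ (13 ^ t) {{m^n≢0 13 t}} (begin
  (13 ^ Z) ^ m * 13 ^ t
    ≡⟨ split 13 ⟨
  (13 ^ Y) ^ k
    ≤⟨ ^-monoˡ-≤ k le ⟩
  ((4 * 2 ^ s) ^ m * 5 ^ Y) ^ k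
    ≡⟨ trans (^-distribʳ-* ((4 * 2 ^ s) ^ m) (5 ^ Y) k) (cong₂ _*_ bits (split 5)) ⟩
  (2 ^ (38 * (K * (2 + s)))) ^ m * ((5 ^ Z) ^ m * 5 ^ t)
    ≤⟨ *-monoʳ-≤ ((2 ^ (38 * (K * (2 + s)))) ^ m) (*-monoʳ-≤ ((5 ^ Z) ^ m) (^-monoˡ-≤ t (m≤m+n 5 8))) ⟩
  (2 ^ (38 * (K * (2 + s)))) ^ m * ((5 ^ Z) ^ m * 13 ^ t)
    ≡⟨ trans (cong (_* 13 ^ t) (^-distribʳ-* (2 ^ (38 * (K * (2 + s)))) (5 ^ Z) m)) (*-assoc ((2 ^ (38 * (K *
        (2 + s)))) ^ m) ((5 ^ Z) ^ m) (13 ^ t)) ⟨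
  (2 ^ (38 * (K * (2 + s))) * 5 ^ Z) ^ m * 13 ^ t ∎))
  where
  open ≤-Reasoning
  k = 38 * K
  t = k * Y ∸ Z * m
  split : ∀ b → (b ^ Y) ^ k ≡ (b ^ Z) ^ m * b ^ t
  split b = trans (^-*-assoc b Y k) (trans (cong (b ^_) (trans (*-comm Y k) (sym (m+[n∸m]≡n Zm≤))))
    (trans (^-distribˡ-+-* b (Z * m) t) (cong (_* b ^ t) (sym (^-*-assoc b Z m)))))
  bits : ((4 * 2 ^ s) ^ m) ^ k ≡ (2 ^ (38 * (K * (2 + s)))) ^ m
  bits = trans (^-swap (4 * 2 ^ s) m k) (cong (_^ m) (trans (cong (_^ k) (*-assoc 2 2 (2 ^ s)))
    (trans (^-*-assoc 2 (2 + s) k) (cong (2 ^_) (trans (*-comm (2 + s) k) (*-assoc 38 K (2 + s)))))))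

-- Dividing the vertices into blocks

record Blocks (n K : ℕ) : Set where
  field
    number size : ℕ
    fits        : number * size ≤ n
    fills       : n ≤ (size + 1) * number
    size-lower  : 3 * K ≤ 2 * size + 1
    size-upper  : size ≤ 3 * K

-- The number B of blocks is n / (2K) rounded to the nearest integer, so (2B - 1) K ≤ n < (2B + 1)
-- K. For B ≥ 2 this puts n / B between 3K/2 and 3K; for B = 1 the lower end comes from n ≥ 2K.
blocks : ∀ {n K} → 1 ≤ K → 2 * K ≤ n → Blocks n K
blocks {n} {K@(suc _)} _ 2K≤n = divide ((n + K) / (2 * K)) (n + K) refl
  (m/n*n≤m (n + K) (2 * K)) (subst (_< 2 * K + (n + K) / (2 * K) * (2 * K)) (sym (m≡m%n+[m/n]*n (n + K) (2 * K)))
      (+-monoˡ-< _ (m%n<n (n + K) (2 * K))))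
  where
  open ≤-Reasoning
  divide : ∀ B N → N ≡ n + K → B * (2 * K) ≤ N → N < 2 * K + B * (2 * K) → Blocks n K
  divide zero      N refl _  up = contradiction (≤-trans (+-monoʳ-≤ (2 * K) z≤n) (≤-trans (+-monoˡ-≤ K 2K≤n) ≤-refl)) (<⇒≱ up)
  divide B@(suc B′) N refl lo up = record
    { number     = B
    ; size       = m
    ; fits       = ≤-trans (≤-reflexive (*-comm B m)) (m/n*n≤m n B)
    ; fills      = <⇒≤ n<
    ; size-lower = ≮⇒≥ too-small
    ; size-upper = ≮⇒≥ too-large
    }
    where
    m = n / B
    n< : n < (m + 1) * B
    n< = begin-strict
      n               ≡⟨ m≡m%n+[m/n]*n n B ⟩
      n % B + m * B   <⟨ +-monoˡ-< (m * B) (m%n<n n B) ⟩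
      B + m * B       ≡⟨ cong (_* B) (+-comm 1 m) ⟩
      (m + 1) * B     ∎
    too-large : ¬ 3 * K < m
    too-large 3K<m = <⇒≱ up (begin
      2 * K + B * (2 * K)            ≡⟨ regroup K B ⟩
      K + (2 * K * B + 0) + K        ≤⟨ +-monoˡ-≤ K (+-mono-≤ (m≤m*n K B) (+-monoʳ-≤ (2 * K * B) (z≤n {B}))) ⟩
      K * B + (2 * K * B + B) + K    ≡⟨ regroup′ K B ⟩
      suc (3 * K) * B + K            ≤⟨ +-monoˡ-≤ K (*-monoˡ-≤ B 3K<m) ⟩
      m * B + K                      ≤⟨ +-monoˡ-≤ K (m/n*n≤m n B) ⟩
      n + K                          ∎)
      where
      regroup : ∀ K B → 2 * K + B * (2 * K) ≡ K + (2 * K * B + 0) + K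
      regroup = solve-∀
      regroup′ : ∀ K B → K * B + (2 * K * B + B) + K ≡ (1 + 3 * K) * B + K
      regroup′ = solve-∀
    too-small : ¬ 2 * m + 1 < 3 * K
    too-small lt = by-count B′ refl
      where
      twice : 2 * suc n ≤ 3 * K * B
      twice = begin
        2 * suc n            ≤⟨ *-monoʳ-≤ 2 n< ⟩
        2 * ((m + 1) * B)    ≡⟨ regroup m B ⟩
        suc (2 * m + 1) * B  ≤⟨ *-monoˡ-≤ B lt ⟩
        3 * K * B            ∎
        where
        regroup : ∀ m B → 2 * ((m + 1) * B) ≡ (1 + (2 * m + 1)) * B
        regroup = solve-∀
      by-count : ∀ b → b ≡ B′ → ⊥
      by-count zero refl = <-irrefl refl (begin-strict
        3 * K * 1       ≡⟨ *-identityʳ (3 * K) ⟩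
        3 * K           ≤⟨ *-monoˡ-≤ K (n≤1+n 3) ⟩
        2 * 2 * K       ≡⟨ *-assoc 2 2 K ⟩
        2 * (2 * K)     ≤⟨ *-monoʳ-≤ 2 2K≤n ⟩
        2 * n           <⟨ *-monoʳ-< 2 (n<1+n n) ⟩
        2 * suc n       ≤⟨ twice ⟩
        3 * K * 1       ∎)
      by-count (suc b) refl = <-irrefl refl (begin-strict
        3 * K * B + 2 * K            ≤⟨ +-monoʳ-≤ (3 * K * B) (m≤m+n (2 * K) (b * K)) ⟩
        3 * K * B + (2 * K + b * K)  ≡⟨ regroup K b ⟩
        2 * (B * (2 * K))            ≤⟨ *-monoʳ-≤ 2 lo ⟩
        2 * (n + K)                  ≡⟨ *-distribˡ-+ 2 n K ⟩
        2 * n + 2 * K                <⟨ +-monoˡ-< (2 * K) (*-monoʳ-< 2 (n<1+n n)) ⟩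
        2 * suc n + 2 * K            ≤⟨ +-monoˡ-≤ (2 * K) twice ⟩
        3 * K * B + 2 * K            ∎)
        where
        regroup : ∀ K b → 3 * K * (2 + b) + (2 * K + b * K) ≡ 2 * ((2 + b) * (2 * K))
        regroup = solve-∀

-- Choice of the parameters and conclusion

half-bound : ∀ {i W} → i < ⌈ W /2⌉ → i * 2 < W
half-bound {i} {W} i< = ≰⇒> λ W≤ → <⇒≱ i< (≤-trans (⌈n/2⌉-mono W≤)
  (≤-reflexive (trans (cong ⌈_/2⌉ (trans (*-comm i 2) (cong (i +_) (+-identityʳ i)))) (sym (n≡⌈n+n/2⌉ i)))))

W≤⌈W/2⌉*2 : ∀ W → W ≤ ⌈ W /2⌉ * 2
W≤⌈W/2⌉*2 W = begin
  W                        ≡⟨ ⌊n/2⌋+⌈n/2⌉≡n W ⟨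
  ⌊ W /2⌋ + ⌈ W /2⌉        ≤⟨ +-monoˡ-≤ ⌈ W /2⌉ (⌊n/2⌋≤⌈n/2⌉ W) ⟩
  ⌈ W /2⌉ + ⌈ W /2⌉        ≡⟨ trans (*-comm ⌈ W /2⌉ 2) (cong (⌈ W /2⌉ +_) (+-identityʳ ⌈ W /2⌉)) ⟨
  ⌈ W /2⌉ * 2              ∎
  where open ≤-Reasoning

an-edge : ∀ {n} → 2 ≤ n → Σ (Edge n) λ e → proj₁ e ≢ proj₂ e
an-edge {suc (suc n)} _             = (zero , suc zero) , λ ()
an-edge {suc zero}    (s≤s ())

module Main (n L K s r h ρ B m′ : ℕ) (L≡ : L ≡ suc (ρ + h * 4)) (ρ≤3 : ρ ≤ 3) (77≤L : 77 ≤ L)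
            (L<K : L + 1 ≤ K) (2K≤n : 2 * K ≤ n)
            (fits : B * suc m′ ≤ n) (fills : n ≤ (suc m′ + 1) * B)
            (lower : 3 * K ≤ 2 * suc m′ + 1) (upper : suc m′ ≤ 3 * K)
            (A : Algorithm n s r) (robust : Robust L K A) where
  open ≤-Reasoning

  m R z W : ℕ
  m = suc m′
  -- The entire degree left over: each layer uses at most 2, the default edge at most 1, and L = 2h
  -- + 1 + R.
  R = h * 2 + ρ
  z = m ∸ K
  W = B * (R * z)

  78≤K : 78 ≤ K
  78≤K = ≤-trans (+-monoˡ-≤ 1 77≤L) L<K

  K≤m : K ≤ m
  K≤m = *-cancelˡ-≤ 2 (+-cancelʳ-≤ 1 _ _ (begin
    2 * K + 1     ≤⟨ +-monoʳ-≤ (2 * K) (≤-trans (s≤s z≤n) 78≤K) ⟩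
    2 * K + K     ≡⟨ +-comm (2 * K) K ⟩
    3 * K         ≤⟨ lower ⟩
    2 * m + 1     ∎))

  K+z≡m : K + z ≡ m
  K+z≡m = m+[n∸m]≡n K≤m

  K≤2z+1 : K ≤ 2 * z + 1
  K≤2z+1 = +-cancelˡ-≤ (2 * K) _ _ (begin
    2 * K + K             ≡⟨ +-comm (2 * K) K ⟩
    3 * K                 ≤⟨ lower ⟩
    2 * m + 1             ≡⟨ cong (λ k → 2 * k + 1) K+z≡m ⟨
    2 * (K + z) + 1       ≡⟨ trans (cong (_+ 1) (*-distribˡ-+ 2 K z)) (+-assoc (2 * K) (2 * z) 1) ⟩
    2 * K + (2 * z + 1)   ∎)

  z≤2K : z ≤ 2 * K
  z≤2K = +-cancelˡ-≤ K _ _ (≤-trans (≤-reflexive K+z≡m) upper)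

  19≤h : 19 ≤ h
  19≤h with 19 ≤? h
  ... | yes p = p
  ... | no ¬p = contradiction (≤-trans 77≤L (≤-trans (≤-reflexive L≡) (s≤s (+-mono-≤ ρ≤3 (*-monoˡ-≤ 4 (s≤s⁻¹
      (≰⇒> ¬p))))))) λ le → <-irrefl refl le

  budget : h * 2 + 1 + R ≤ L
  budget = ≤-reflexive (trans (identity h ρ) (sym L≡))
    where
    identity : ∀ h ρ → h * 2 + 1 + (h * 2 + ρ) ≡ 1 + (ρ + h * 4)
    identity = solve-∀

  R+60≤m : R + 60 ≤ m
  R+60≤m = *-cancelˡ-≤ 2 (+-cancelʳ-≤ 1 _ _ (begin
    2 * (R + 60) + 1                           ≡⟨ trans (expand h ρ) (cong (_+ (ρ + 120)) (sym L≡)) ⟩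
    L + (ρ + 120)                              ≤⟨ +-monoʳ-≤ L (+-monoˡ-≤ 120 ρ≤3) ⟩
    L + 123                                    ≤⟨ +-monoʳ-≤ L (m≤m+n 123 34) ⟩
    L + (77 + 77 + 3)                          ≤⟨ +-monoʳ-≤ L (+-monoˡ-≤ 3 (+-mono-≤ 77≤L 77≤L)) ⟩
    L + (L + L + 3)                            ≡⟨ collect L ⟩
    3 * (L + 1)                                ≤⟨ *-monoʳ-≤ 3 L<K ⟩
    3 * K                                      ≤⟨ lower ⟩
    2 * m + 1                                  ∎))
    where
    expand : ∀ h ρ → 2 * (h * 2 + ρ + 60) + 1 ≡ 1 + (ρ + h * 4) + (ρ + 120)
    expand = solve-∀
    collect : ∀ L → L + (L + L + 3) ≡ 3 * (L + 1)
    collect = solve-∀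

  emb : Layers.Vertex B m′ → Fin n
  emb (b , i) = Fin.inject≤ (Fin.combine b i) fits

  emb-injective : ∀ {x y} → emb x ≡ emb y → x ≡ y
  emb-injective {b , i} {c , j} eq with Finₚ.combine-injective b i c j (Finₚ.inject≤-injective fits fits _ _ eq)
  ... | refl , refl = refl

  2≤n : 2 ≤ n
  2≤n = ≤-trans (*-monoʳ-≤ 2 (≤-trans (s≤s z≤n) 78≤K)) 2K≤n

  -- Rounding W / 2 up is right on both sides: before each round twice the number of adaptive edges
  -- is still below W, and at the end it has reached W.
  open Count B m′ emb emb-injective L K R L<K (proj₁ (an-edge 2≤n)) (proj₂
      (an-edge 2≤n)) ⌈ W /2⌉ half-bound h budget R+60≤m A robust

  enough : n * (L * L) * m ≤ 38 * K * (h * D)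
  enough = begin
    n * (L * L) * m           ≡⟨ cong (n * (L * L) *_) K+z≡m ⟨
    n * (L * L) * (K + z)     ≤⟨ edge-count {n} {B} {L} {K} {h} {R} {z} (subst (λ k → n ≤ (k + 1) * B) (sym K+z≡m) fills)
                                   (subst (λ L → 35 * (L * L) ≤ 288 * (h * R)) (sym L≡)
                                       (degree-split {h} {ρ} 19≤h ρ≤3)) (block-inequality K z 78≤K K≤2z+1 z≤2K) ⟩
    38 * K * (h * W)          ≤⟨ *-monoʳ-≤ (38 * K) (*-monoʳ-≤ h (W≤⌈W/2⌉*2 W)) ⟩
    38 * K * (h * D)          ∎

  space-bound : ExpAtMost (n * (L * L)) (2 ^ (40 * K * (s + 3)))
  space-bound N = ≤-trans (exp-from-13/5 (n * (L * L)) (K * (2 + s)) (from-communication {n *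
      (L * L)} {m} {h * D} {K} {s} enough communication) N)
    (*-monoˡ-≤ (N !) (^-monoʳ-≤ 2 (begin
      40 * (K * (2 + s))    ≡⟨ *-assoc 40 K (2 + s) ⟨
      40 * K * (2 + s)      ≤⟨ *-monoʳ-≤ (40 * K) (n≤1+n (2 + s)) ⟩
      40 * K * (3 + s)      ≡⟨ cong (40 * K *_) (+-comm 3 s) ⟩
      40 * K * (s + 3)      ∎)))

theorem4p3 : (n L K s r : ℕ) → 2 * K ≤ n → L + 1 ≤ K →
    ExpAtLeast L ((4 * n) ^ 12) →
    (A : Algorithm n s r) → Robust L K A →
    ExpAtMost (n * (L * L)) (2 ^ (40 * K * (s + 3)))
theorem4p3 n zero       K s r 2K≤n L<K exp A robust = contradiction (L-large 2K≤n L<K exp) λ ()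
theorem4p3 n L@(suc L′) K s r 2K≤n L<K exp A robust = split (blocks (≤-trans (m≤n+m 1 L) L<K) 2K≤n)
  where
  split : Blocks n K → ExpAtMost (n * (L * L)) (2 ^ (40 * K * (s + 3)))
  split record { size = zero ; size-lower = lower } =
    contradiction (≤-trans (*-monoʳ-≤ 3 (≤-trans (m≤n+m 1 L) L<K)) lower) λ { (s≤s ()) }
  split record { number = B ; size = suc m′ ; fits = fits ; fills = fills ; size-lower = lower ; size-upper = upper } =
    Main.space-bound n L K s r (L′ / 4) (L′ % 4) B m′ (cong suc (m≡m%n+[m/n]*n L′ 4)) (s≤s⁻¹ (m%n<n L′ 4))
      (L-large 2K≤n L<K exp) L<K 2K≤n fits fills lower upper A robust
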